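{- Let $t$ and $\Delta$ be integers with $3 \le t \le \Delta+1$. Let $G$ be a graph with $m$ edges and maximum degree at most $\Delta$, and write $m = q\binom{\Delta+1}{2} + b$ with integers $q \ge 0$ and $0 \le b < \binom{\Delta+1}{2}$. Then $k_t(G) \le k_t(qK_{\Delta+1} \cup L_b)$. Moreover, equality holds if and only if $G$ is isomorphic to $qK_{\Delta+1} \cup L$ for some $L \in \mathcal{L}_{t,\Delta}(b)$.
   Context: All graphs are finite and simple. Two graphs are considered equivalent if they are isomorphic after deleting all isolated vertices (equivalently, graphs are taken to have no isolated vertices). For a graph $H$, $k_t(H)$ denotes the number of cliques of order $t$ (copies of $K_t$) in $H$. $qK_{\Delta+1} \cup L$ denotes the disjoint union of $q$ copies of $K_{\Delta+1}$ and the graph $L$. Every non-negative integer $m$ can be written uniquely as $m = \binom{r}{2} + s$ with integers $0 \le s < r$. The colex graph $L_m$ (for $m=\binom{r}{2}+s$, $0\le s<r$) is the graph consisting of a clique on $r$ vertices together with one additional vertex adjacent to exactly $s$ vertices of the clique (equivalently, the graph on $\mathbb{N}$ whose edges are the first $m$ two-element subsets of $\mathbb{N}$ in colex order, where $A<B$ iff $\max(A \triangle B)\in B$); $L_0$ is the empty graph. For $m=0$, $\mathcal{L}_{t,\Delta}(0)$ consists of the empty graph. For $0 < m \le \binom{\Delta+1}{2}$ with $m = \binom{r}{2}+s$, $0 \le s < r$, the family $\mathcal{L}_{t,\Delta}(m)$ is: if $s \ge t-1$, just $\{L_m\}$; if $r \ge t$ and $s < t-1$, $L_m$ together with all $m$-edge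 graphs of maximum degree at most $\Delta$ containing $K_r$ as a subgraph; if $r < t$, $L_m$ together with all $m$-edge graphs of maximum degree at most $\Delta$. -}

module Defs where

open import Data.Bool using (Bool; true; false; not; _∧_; _∨_; if_then_else_)
open import Data.Nat using (ℕ; zero; suc; _+_; _*_; _≤_; _<_; _<ᵇ_; _⊔_; _⊓_)
open import Data.Nat.Properties using (⊔-comm; ⊓-comm)
open import Data.Nat.Combinatorics using (_C_)
open import Data.Fin using (Fin; toℕ; splitAt; _≟_)
import Data.Fin
import Data.Empty
open import Data.Sum using (_⊎_; inj₁; inj₂)
open import Data.Product using (Σ; ∃; _×_; _,_)
open import Data.Empty using (⊥)
open import Relation.Nullary using (yes; no; ¬_)
open import Relation.Nullary.Decidable using (⌊_⌋)
open import Relation.Binary.PropositionalEquality using (_≡_; _≢_; refl; sym; cong; cong₂)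

record Graph : Set where
  field
    n      : ℕ
    adj    : Fin n → Fin n → Bool
    adj-sym    : ∀ u v → adj u v ≡ adj v u
    adj-irrefl : ∀ v → adj v v ≡ false
open Graph public

b2n : Bool → ℕ
b2n true  = 1
b2n false = 0

countFin : ∀ {k} → (Fin k → Bool) → ℕ
countFin {zero}  P = 0
countFin {suc k} P = b2n (P Data.Fin.zero) + countFin (λ i → P (Data.Fin.suc i))

allFin : ∀ {k} → (Fin k → Bool) → Bool
allFin {zero}  P = true
allFin {suc k} P = P Data.Fin.zero ∧ allFin (λ i → P (Data.Fin.suc i))

Subset : ℕ → Set
Subset k = Fin k → Bool

countSubsets : ∀ {k} → (Subset k → Bool) → ℕ
countSubsets {zero}  P = b2n (P (λ ()))
countSubsets {suc k} P =
  countSubsets (λ S → P (extend true S)) + countSubsets (λ S → P (extend false S))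
  where
    extend : Bool → Subset k → Subset (suc k)
    extend b S Data.Fin.zero    = b
    extend b S (Data.Fin.suc i) = S i

degree : (G : Graph) → Fin (n G) → ℕ
degree G v = countFin (λ u → adj G v u)

MaxDegLe : Graph → ℕ → Set
MaxDegLe G Δ = ∀ v → degree G v ≤ Δ

sumFin : ∀ {k} → (Fin k → ℕ) → ℕ
sumFin {zero}  f = 0
sumFin {suc k} f = f Data.Fin.zero + sumFin (λ i → f (Data.Fin.suc i))

edges : Graph → ℕ
edges G = sumFin (λ u → countFin (λ v → adj G u v ∧ (toℕ u <ᵇ toℕ v)))

eqᵇ : ∀ {k} → Fin k → Fin k → Bool
eqᵇ i j = ⌊ i ≟ j ⌋

isCliqueᵇ : (G : Graph) → Subset (n G) → Bool
isCliqueᵇ G S = allFin (λ i → allFin (λ j →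
  not (S i ∧ S j ∧ not (eqᵇ i j)) ∨ adj G i j))

sizeᵇ : ∀ {k} → Subset k → ℕ
sizeᵇ S = countFin S

kt : ℕ → Graph → ℕ
kt t G = countSubsets (λ S → isCliqueᵇ G S ∧ (sizeᵇ S Data.Nat.≡ᵇ t))

ContainsK : Graph → ℕ → Set
ContainsK G r = Σ (Fin r → Fin (n G)) λ f → ∀ i j → i ≢ j → adj G (f i) (f j) ≡ true

-- Isomorphism up to isolated vertices

NonIso : (G : Graph) → Fin (n G) → Set
NonIso G v = ∃ λ u → adj G v u ≡ true

record _≃_ (G H : Graph) : Set where
  field
    f    : ∀ v → NonIso G v → Fin (n H)
    g    : ∀ w → NonIso H w → Fin (n G)
    f-ni : ∀ v p → NonIso H (f v p)
    g-ni : ∀ w p → NonIso G (g w p)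
    gf   : ∀ v p p′ → g (f v p) p′ ≡ v
    fg   : ∀ w p p′ → f (g w p) p′ ≡ w
    adj-pres : ∀ u v p p′ → adj H (f u p) (f v p′) ≡ adj G u v

eqᵇ-refl : ∀ {k} (i : Fin k) → eqᵇ i i ≡ true
eqᵇ-refl i with i ≟ i
... | yes _ = refl
... | no ¬p = Data.Empty.⊥-elim (¬p refl)

eqᵇ-sym : ∀ {k} (i j : Fin k) → eqᵇ i j ≡ eqᵇ j i
eqᵇ-sym i j with i ≟ j | j ≟ i
... | yes _ | yes _ = refl
... | no _  | no _  = refl
... | yes p | no ¬q = Data.Empty.⊥-elim (¬q (sym p))
... | no ¬p | yes q = Data.Empty.⊥-elim (¬p (sym q))

emptyGraph : Graph
emptyGraph = record { n = 0 ; adj = λ () ; adj-sym = λ () ; adj-irrefl = λ () }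

K : ℕ → Graph
K k = record
  { n = k
  ; adj = λ u v → not (eqᵇ u v)
  ; adj-sym = λ u v → cong not (eqᵇ-sym u v)
  ; adj-irrefl = λ v → cong not (eqᵇ-refl v)
  }

module _ {a b : ℕ} (A : Fin a → Fin a → Bool) (B : Fin b → Fin b → Bool) where
  sumAdj : Fin a ⊎ Fin b → Fin a ⊎ Fin b → Bool
  sumAdj (inj₁ x) (inj₁ y) = A x y
  sumAdj (inj₂ x) (inj₂ y) = B x y
  sumAdj (inj₁ _) (inj₂ _) = false
  sumAdj (inj₂ _) (inj₁ _) = false

  sumAdj-sym : (∀ x y → A x y ≡ A y x) → (∀ x y → B x y ≡ B y x) →
               ∀ u v → sumAdj u v ≡ sumAdj v u
  sumAdj-sym sA sB (inj₁ x) (inj₁ y) = sA x y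
  sumAdj-sym sA sB (inj₂ x) (inj₂ y) = sB x y
  sumAdj-sym sA sB (inj₁ _) (inj₂ _) = refl
  sumAdj-sym sA sB (inj₂ _) (inj₁ _) = refl

  sumAdj-irr : (∀ x → A x x ≡ false) → (∀ x → B x x ≡ false) →
               ∀ u → sumAdj u u ≡ false
  sumAdj-irr iA iB (inj₁ x) = iA x
  sumAdj-irr iA iB (inj₂ x) = iB x

_∪_ : Graph → Graph → Graph
G ∪ H = record
  { n = n G + n H
  ; adj = λ u v → sumAdj (adj G) (adj H) (splitAt (n G) u) (splitAt (n G) v)
  ; adj-sym = λ u v → sumAdj-sym (adj G) (adj H) (adj-sym G) (adj-sym H)
                        (splitAt (n G) u) (splitAt (n G) v)
  ; adj-irrefl = λ u → sumAdj-irr (adj G) (adj H) (adj-irrefl G) (adj-irrefl H)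
                        (splitAt (n G) u)
  }

copiesK∪ : ℕ → ℕ → Graph → Graph
copiesK∪ zero    k L = L
copiesK∪ (suc q) k L = K k ∪ copiesK∪ q k L

-- colex graph L_m: edge {i,j} (i < j) has colex position (j choose 2) + i;
-- L_m has exactly the edges of position < m. Vertex set Fin (m + 2)
-- (large enough; all extra vertices are isolated).
colexPos : ℕ → ℕ → ℕ
colexPos a b = ((a ⊔ b) C 2) + (a ⊓ b)

colexPos-sym : ∀ a b → colexPos a b ≡ colexPos b a
colexPos-sym a b = cong₂ (λ x y → (x C 2) + y) (⊔-comm a b) (⊓-comm a b)

colex : ℕ → Graph
colex m = record
  { n = suc (suc m)
  ; adj = λ i j → not (eqᵇ i j) ∧ (colexPos (toℕ i) (toℕ j) <ᵇ m)
  ; adj-sym = λ i j → cong₂ (λ x y → not x ∧ (y <ᵇ m)) (eqᵇ-sym i j)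
                        (colexPos-sym (toℕ i) (toℕ j))
  ; adj-irrefl = λ i → cong (λ x → not x ∧ (colexPos (toℕ i) (toℕ i) <ᵇ m)) (eqᵇ-refl i)
  }

-- The family 𝓛_{t,Δ}(b), as a predicate on graphs (up to ≃).
-- L ∈ 𝓛 iff L ≃ L_b, or b > 0 and, writing b = (r choose 2) + s with
-- 0 ≤ s < r: s < t - 1 (i.e. s + 1 < t), L has b edges and maximum
-- degree ≤ Δ, and if r ≥ t then L contains K_r.

InFamily : ℕ → ℕ → ℕ → Graph → Set
InFamily t Δ b L =
  (L ≃ colex b) ⊎
  (0 < b × (∀ r s → (r C 2) + s ≡ b → s < r →
      (suc s < t) × (edges L ≡ b) × MaxDegLe L Δ × (t ≤ r → ContainsK L r)))

-- All cliques are counted with an order on their vertices, so that the bound for qN + C(r,2) + s edges (N = C(Δ+1,2))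
-- becomes f = q·ff(Δ+1,t) + ff(r,t) + t·ff(s,t-1) with falling factorials ff. Components K_{Δ+1} can be split off one by
-- one, and for q = 0 the claim is the Kruskal–Katona theorem with its equality case. What remains is that f is not
-- attained when q ≥ 1 and there is no component K_{Δ+1}. In a counterexample with fewest edges:
--   * every non-empty edge cut has at least r edges, since a cut of E < r edges carries at most C(E,t-1) cliques, and f
--     drops by at least as much when the number of edges drops by E; hence all degrees are ≥ r, and at least r edges
--     leave each closed neighbourhood N[v] (if none does, N[v] is a component and f is superadditive);
--   * every vertex lies in more than C(r-1,t-1) cliques (otherwise delete r-1 edges at it);
--   * there are more than q(Δ+1) + r non-isolated vertices, by Chase's theorem.
-- Now sum the number of cliques at v over all v. Convexity of C(d,t-1) between r and Δ bounds the sum in terms of the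
-- numbers of edges and vertices, and the non-adjacent pairs inside the neighbourhoods, which are as numerous as half the
-- edges leaving the sets N[v], lower it below t·f.

module Submission where

open import Defs
open import Data.Bool using (Bool; true; false; not; _∧_; _∨_; T)
import Data.Bool
open import Data.Bool.Properties using (∧-comm; ∧-zeroʳ; ∧-identityʳ; ∨-comm)
open import Data.Empty using (⊥; ⊥-elim)
open import Data.Fin using (Fin; toℕ; splitAt; join; _↑ˡ_; _↑ʳ_; fromℕ<)
  renaming (zero to fz; suc to fs; _≟_ to _≟F_)
open import Data.Fin.Properties using (any?; toℕ-injective; toℕ-fromℕ<; toℕ<n; splitAt-join; join-splitAt;
  splitAt-↑ˡ; splitAt-↑ʳ; splitAt⁻¹-↑ˡ; splitAt⁻¹-↑ʳ; ↑ˡ-injective; ↑ʳ-injective; toℕ-↑ˡ; toℕ-↑ʳ)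
  renaming (suc-injective to fs-injective)
open import Data.Nat
open import Data.Nat.Combinatorics using (_C_; nC1≡n; nCk+nC[k+1]≡[n+1]C[k+1])
open import Data.Nat.Properties
open import Data.Nat.Tactic.RingSolver using (solve-∀)
open import Data.Product using (Σ; ∃; _×_; _,_; proj₁; proj₂)
open import Data.Sum using (_⊎_; inj₁; inj₂)
open import Data.Vec using (Vec; []; _∷_; lookup; _[_]≔_)
open import Data.Vec.Properties using (lookup∘update; lookup∘update′)
open import Function using (_∘_)
open import Function.Bundles using (_⇔_; mk⇔)
open import Relation.Binary.Definitions using (tri<; tri≈; tri>)
open import Relation.Binary.PropositionalEquality hiding (J)
open import Relation.Nullary using (yes; no; ¬_)
open import Relation.Nullary.Decidable using (_×-dec_)

-- The final sum compares `G` with q copies of K_{Δ+1} and one K_{r+1}. That graph has the smallest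
-- number of vertices left open by Chase's theorem and only the degrees r and Δ, so the chord is
-- exact on it. But it has w = r - s edges more than `G`, and in ordered cliques it exceeds f by
-- t·(ff(r,t-1) - ff(s,t-1)); convexity alone therefore cannot succeed. The excess is paid from two
-- sources. Each of the 2w missing edge ends saves the slope of the chord, which is at least
-- (t-1)·ff(r,t-2). Each non-adjacent pair in a neighbourhood saves (t-1)·ff(r-2,t-3), but only if
-- the neighbourhood spans enough cliques, which is why vertices in few cliques are removed
-- beforehand. For q ≥ 1 there are at least 2(r+1) vertices, and with r edges leaving every closed
-- neighbourhood this gives at least r(r+1) such pairs. If r < t-1, the remainder carries no cliques
-- and the missing edge ends suffice.

BSet : ℕ → Set
BSet k = Fin k → Bool

Rel₂ : ℕ → Set
Rel₂ k = Fin k → Fin k → Bool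

-- Elementary tools: Booleans, finite sums and counts.

+-interchange : ∀ a b c d → (a + b) + (c + d) ≡ (a + c) + (b + d)
+-interchange = solve-∀

b2n-mono : ∀ {a b} → (a ≡ true → b ≡ true) → b2n a ≤ b2n b
b2n-mono {false} h = z≤n
b2n-mono {true} {true} h = ≤-refl
b2n-mono {true} {false} h with h refl
... | ()

b2n-∧ : ∀ a b → b2n (a ∧ b) ≡ b2n a * b2n b
b2n-∧ true  b = sym (+-identityʳ _)
b2n-∧ false b = refl

b2n-pos : ∀ {b} → 0 < b2n b → b ≡ true
b2n-pos {true} _ = refl

T→ : ∀ {b} → T b → b ≡ true
T→ {true} _ = refl

→T : ∀ {b} → b ≡ true → T b
→T refl = _

full : ∀ {k} → BSet k
full _ = true

eqᵇ-true : ∀ {k} {i j : Fin k} → eqᵇ i j ≡ true → i ≡ j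
eqᵇ-true {i = i} {j} h with i ≟F j
... | yes p = p

eqᵇ-false : ∀ {k} {i j : Fin k} → i ≢ j → eqᵇ i j ≡ false
eqᵇ-false {i = i} {j} h with i ≟F j
... | yes p = ⊥-elim (h p)
... | no _  = refl

eqᵇ-≢ : ∀ {k} {i j : Fin k} → eqᵇ i j ≡ false → i ≢ j
eqᵇ-≢ h refl with trans (sym (eqᵇ-refl _)) h
... | ()

bool-ext : ∀ {a b} → (a ≡ true → b ≡ true) → (b ≡ true → a ≡ true) → a ≡ b
bool-ext {true}  {true}  f g = refl
bool-ext {true}  {false} f g = sym (f refl)
bool-ext {false} {true}  f g = g refl
bool-ext {false} {false} f g = refl

eqᵇ-suc : ∀ {k} (i j : Fin k) → eqᵇ (fs i) (fs j) ≡ eqᵇ i j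
eqᵇ-suc i j = bool-ext
  (λ h → trans (cong (eqᵇ i) (sym (fs-injective (eqᵇ-true {i = fs i} h)))) (eqᵇ-refl i))
  (λ h → trans (cong (λ z → eqᵇ (fs i) (fs z)) (sym (eqᵇ-true {i = i} h))) (eqᵇ-refl (fs i)))

infixl 7 _∩_ _\\_
_∩_ : ∀ {k} → BSet k → BSet k → BSet k
(S ∩ T) x = S x ∧ T x

_\\_ : ∀ {k} → BSet k → Fin k → BSet k
(S \\ v) x = S x ∧ not (eqᵇ v x)

-- opaque versions of sumFin and countFin, so that unification can infer their implicit arguments
opaque
  ∑ : ∀ {k} → (Fin k → ℕ) → ℕ
  ∑ = sumFin

  # : ∀ {k} → BSet k → ℕ
  # = countFin

  ∑-def : ∀ {k} (f : Fin k → ℕ) → ∑ f ≡ sumFin f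
  ∑-def f = refl

  #-def : ∀ {k} (P : BSet k) → # P ≡ countFin P
  #-def P = refl

opaque
  unfolding ∑ #

  sum-cong : ∀ {k} {f g : Fin k → ℕ} → (∀ i → f i ≡ g i) → ∑ f ≡ ∑ g
  sum-cong {zero}  h = refl
  sum-cong {suc k} h = cong₂ _+_ (h fz) (sum-cong (h ∘ fs))

  sum-mono : ∀ {k} {f g : Fin k → ℕ} → (∀ i → f i ≤ g i) → ∑ f ≤ ∑ g
  sum-mono {zero}  h = z≤n
  sum-mono {suc k} h = +-mono-≤ (h fz) (sum-mono (h ∘ fs))

  sum-zero : ∀ {k} {f : Fin k → ℕ} → (∀ i → f i ≡ 0) → ∑ f ≡ 0
  sum-zero {zero}  h = refl
  sum-zero {suc k} h = cong₂ _+_ (h fz) (sum-zero (h ∘ fs))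

  sum-+ : ∀ {k} (f g : Fin k → ℕ) → ∑ (λ i → f i + g i) ≡ ∑ f + ∑ g
  sum-+ {zero}  f g = refl
  sum-+ {suc k} f g = trans (cong (f fz + g fz +_) (sum-+ (f ∘ fs) (g ∘ fs)))
                            (+-interchange (f fz) (g fz) _ _)

  sum-*ˡ : ∀ {k} c (f : Fin k → ℕ) → ∑ (λ i → c * f i) ≡ c * ∑ f
  sum-*ˡ {zero}  c f = sym (*-zeroʳ c)
  sum-*ˡ {suc k} c f = trans (cong (c * f fz +_) (sum-*ˡ c (f ∘ fs)))
                             (sym (*-distribˡ-+ c (f fz) _))

  sum-*ʳ : ∀ {k} c (f : Fin k → ℕ) → ∑ (λ i → f i * c) ≡ ∑ f * c
  sum-*ʳ c f = trans (sum-cong (λ i → *-comm (f i) c)) (trans (sum-*ˡ c f) (*-comm c _))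

  sum-swap : ∀ {k l} (f : Fin k → Fin l → ℕ) →
             ∑ (λ i → ∑ (f i)) ≡ ∑ (λ j → ∑ (λ i → f i j))
  sum-swap {zero} {l} f = sym (sum-zero {l} (λ _ → refl))
  sum-swap {suc k} f = trans (cong (∑ (f fz) +_) (sum-swap (f ∘ fs)))
                             (sym (sum-+ (f fz) _))

  count-sum : ∀ {k} (P : BSet k) → # P ≡ ∑ (λ i → b2n (P i))
  count-sum {zero}  P = refl
  count-sum {suc k} P = cong (b2n (P fz) +_) (count-sum (P ∘ fs))

  count-cong : ∀ {k} {P Q : BSet k} → (∀ i → P i ≡ Q i) → # P ≡ # Q
  count-cong {zero}  h = refl
  count-cong {suc k} h = cong₂ _+_ (cong b2n (h fz)) (count-cong (h ∘ fs))

  count-mono : ∀ {k} {P Q : BSet k} → (∀ i → P i ≡ true → Q i ≡ true) → # P ≤ # Q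
  count-mono {zero}  h = z≤n
  count-mono {suc k} h = +-mono-≤ (b2n-mono (h fz)) (count-mono (h ∘ fs))

  sum-pos : ∀ {k} (f : Fin k → ℕ) → 0 < ∑ f → ∃ λ i → 0 < f i
  sum-pos {suc k} f h with f fz in eq
  ... | suc m = fz , subst (0 <_) (sym eq) (s≤s z≤n)
  ... | zero with sum-pos (f ∘ fs) h
  ... | i , p = fs i , p

  count-pos : ∀ {k} (P : BSet k) → 0 < # P → ∃ λ i → P i ≡ true
  count-pos P h with sum-pos _ (subst (0 <_) (count-sum P) h)
  ... | i , p = i , b2n-pos p

  sum-point : ∀ {k} (f : Fin k → ℕ) i → f i ≤ ∑ f
  sum-point f fz     = m≤m+n _ _
  sum-point f (fs i) = ≤-trans (sum-point (f ∘ fs) i) (m≤n+m _ _)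

  count-point : ∀ {k} (P : BSet k) i → P i ≡ true → 1 ≤ # P
  count-point P i p = subst (1 ≤_) (sym (count-sum P)) (≤-trans (≤-reflexive (cong b2n (sym p)))
    (sum-point (b2n ∘ P) i))

  count-zero : ∀ {k} (P : BSet k) → (∀ i → P i ≡ false) → # P ≡ 0
  count-zero P h = trans (count-sum P) (sum-zero (λ i → cong b2n (h i)))

  count-zero⁻ : ∀ {k} (P : BSet k) → # P ≡ 0 → ∀ i → P i ≡ false
  count-zero⁻ P h i with P i in eq
  ... | false = refl
  ... | true with subst (1 ≤_) h (count-point P i eq)
  ... | ()

  count-full : ∀ k → # (full {k}) ≡ k
  count-full zero    = refl
  count-full (suc k) = cong suc (count-full k)

  sum-single : ∀ {k} (v : Fin k) (f : Fin k → ℕ) → ∑ (λ x → b2n (eqᵇ v x) * f x) ≡ f v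
  sum-single fz     f = trans (cong₂ _+_ (+-identityʳ (f fz))
    (sum-zero {f = λ i → b2n (eqᵇ fz (fs i)) * f (fs i)} (λ i → refl))) (+-identityʳ _)
  sum-single (fs v) f = trans (sum-cong (λ i → cong (λ z → b2n z * f (fs i)) (eqᵇ-suc v i))) (sum-single v (f ∘ fs))

  count-⊕ : ∀ {k} (S P : BSet k) → # S ≡ # (S ∩ P) + # (S ∩ (not ∘ P))
  count-⊕ {zero}  S P = refl
  count-⊕ {suc k} S P with S fz | P fz
  ... | true  | true  = cong suc (count-⊕ (S ∘ fs) (P ∘ fs))
  ... | true  | false = trans (cong suc (count-⊕ (S ∘ fs) (P ∘ fs))) (sym (+-suc _ _))
  ... | false | true  = count-⊕ (S ∘ fs) (P ∘ fs)
  ... | false | false = count-⊕ (S ∘ fs) (P ∘ fs)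

sum-split : ∀ {k} (S : BSet k) v (F : Fin k → ℕ) →
  ∑ (λ x → b2n (S x) * F x) ≡ ∑ (λ x → b2n ((S \\ v) x) * F x) + b2n (S v) * F v
sum-split S v F =
  trans (sum-cong pt) (trans (sum-+ (λ x → b2n ((S \\ v) x) * F x) _)
    (cong (∑ (λ x → b2n ((S \\ v) x) * F x) +_) (sum-single v (λ x → b2n (S x) * F x))))
  where
  pt : ∀ x → b2n (S x) * F x ≡ b2n ((S \\ v) x) * F x + b2n (eqᵇ v x) * (b2n (S x) * F x)
  pt x with S x | eqᵇ v x
  ... | true  | true  = sym (+-identityʳ _)
  ... | true  | false = sym (+-identityʳ _)
  ... | false | true  = refl
  ... | false | false = refl

∧-true : ∀ {a b} → a ∧ b ≡ true → a ≡ true × b ≡ true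
∧-true {true} {true} _ = refl , refl

∧-intro : ∀ {a b} → a ≡ true → b ≡ true → a ∧ b ≡ true
∧-intro refl refl = refl

not-true : ∀ {a} → not a ≡ true → a ≡ false
not-true {false} _ = refl

not-false : ∀ {a} → a ≡ false → not a ≡ true
not-false refl = refl

¬true : ∀ {a} → ¬ (a ≡ true) → a ≡ false
¬true {false} h = refl
¬true {true}  h = ⊥-elim (h refl)

false≢true : ∀ {a} → a ≡ false → ¬ (a ≡ true)
false≢true refl ()

count-split : ∀ {k} (S : BSet k) v → # S ≡ # (S \\ v) + b2n (S v)
count-split S v = begin
  # S ≡⟨ count-sum S ⟩
  ∑ (λ x → b2n (S x)) ≡⟨ sum-cong (λ x → sym (*-identityʳ _)) ⟩
  ∑ (λ x → b2n (S x) * 1) ≡⟨ sum-split S v (λ _ → 1) ⟩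
  ∑ (λ x → b2n ((S \\ v) x) * 1) + b2n (S v) * 1 ≡⟨ cong₂ _+_ (sum-cong (λ x → *-identityʳ _)) (*-identityʳ _) ⟩
  ∑ (λ x → b2n ((S \\ v) x)) + b2n (S v) ≡⟨ cong (_+ b2n (S v)) (sym (count-sum (S \\ v))) ⟩
  # (S \\ v) + b2n (S v) ∎
  where open ≡-Reasoning

count-∈ : ∀ {k} (S : BSet k) x → S x ≡ true → # S ≡ suc (# (S \\ x))
count-∈ S x sx = trans (count-split S x) (trans (cong (λ b → # (S \\ x) + b2n b) sx) (+-comm (# (S \\ x)) 1))

-- the number of ordered t-cliques inside S, that is t! times the number of t-cliques

cl : ∀ {k} → Rel₂ k → ℕ → BSet k → ℕ
cl A zero    S = 1
cl A (suc t) S = ∑ (λ x → b2n (S x) * cl A t (S ∩ A x))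

cl-congS : ∀ {k} {A B : Rel₂ k} t {S T : BSet k} → (∀ x → S x ≡ T x) →
  (∀ x y → S x ≡ true → S y ≡ true → A x y ≡ B x y) → cl A t S ≡ cl B t T
cl-congS zero    h e = refl
cl-congS {A = A} {B} (suc t) {S} {T} h e = sum-cong pt
  where
  pt : ∀ x → b2n (S x) * cl A t (S ∩ A x) ≡ b2n (T x) * cl B t (T ∩ B x)
  pt x with S x in eq | T x | h x
  ... | false | _ | refl = refl
  ... | true  | _ | refl = cong (1 *_) (cl-congS t pt2 (λ y z p q → e y z (proj₁ (∧-true p)) (proj₁ (∧-true q))))
    where
    pt2 : ∀ y → (S y ∧ A x y) ≡ (T y ∧ B x y)
    pt2 y with S y in eq2 | T y | h y
    ... | false | _ | refl = refl
    ... | true  | _ | refl = e x y eq eq2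

cl-cong : ∀ {k} {A : Rel₂ k} t {S T : BSet k} → (∀ x → S x ≡ T x) → cl A t S ≡ cl A t T
cl-cong t h = cl-congS t h (λ _ _ _ _ → refl)

cl-mono : ∀ {k} {A B : Rel₂ k} t {S T : BSet k} → (∀ x → S x ≡ true → T x ≡ true) →
  (∀ x y → A x y ≡ true → B x y ≡ true) → cl A t S ≤ cl B t T
cl-mono zero    h e = ≤-refl
cl-mono (suc t) h e = sum-mono (λ x → *-mono-≤ (b2n-mono (h x))
  (cl-mono t (λ y p → ∧-intro (h y (proj₁ (∧-true p))) (e x y (proj₂ (∧-true p)))) e))

cl-1 : ∀ {k} (A : Rel₂ k) S → cl A 1 S ≡ # S
cl-1 A S = trans (sum-cong (λ x → *-identityʳ _)) (sym (count-sum S))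

cl-empty : ∀ {k} (A : Rel₂ k) t S → (∀ x → S x ≡ false) → cl A (suc t) S ≡ 0
cl-empty A t S h = sum-zero (λ x → cong (λ z → b2n z * cl A t (S ∩ A x)) (h x))

record Simple {k} (A : Rel₂ k) : Set where
  constructor simple
  field
    symm : ∀ u v → A u v ≡ A v u
    irr  : ∀ v → A v v ≡ false
open Simple public

adj-simple : (G : Graph) → Simple (adj G)
adj-simple G = simple (adj-sym G) (adj-irrefl G)

adj-≠ : ∀ {k} {A : Rel₂ k} → Simple A → ∀ {x y} → A x y ≡ true → eqᵇ x y ≡ false
adj-≠ {A = A} sA {x} p = ¬true (λ h → false≢true (irr sA x) (trans (cong (A x) (eqᵇ-true {i = x} h)) p))

-- In a clique through `v`, the vertex `v` has one of `suc t` positions and the other entries form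
-- an ordered clique in its link. Most clique counts below are decomposed by this identity.
cl-del : ∀ {k} {A : Rel₂ k} → Simple A → ∀ t S v →
  cl A (suc t) S ≡ cl A (suc t) (S \\ v) + suc t * (b2n (S v) * cl A t (S ∩ A v))
cl-del {A = A} sA zero S v =
  trans (cl-1 A S) (trans (count-split S v) (cong₂ _+_ (sym (cl-1 A (S \\ v)))
    (trans (sym (*-identityʳ (b2n (S v)))) (sym (+-identityʳ _)))))
cl-del {k} {A} sA (suc t) S v = begin
  ∑ (λ x → b2n (S x) * F x) ≡⟨ sum-split S v F ⟩
  ∑ (λ x → b2n ((S \\ v) x) * F x) + b2n (S v) * F v ≡⟨ cong (_+ b2n (S v) * F v) (sum-cong pt) ⟩
  ∑ (λ x → P x + suc t * (b2n (S v) * Q x)) + b2n (S v) * F v ≡⟨ cong (_+ b2n (S v) * F v) (sum-+ P _) ⟩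
  ∑ P + ∑ (λ x → suc t * (b2n (S v) * Q x)) + b2n (S v) * F v
    ≡⟨ cong (λ z → ∑ P + z + b2n (S v) * F v) (trans (sum-*ˡ (suc t) _) (cong (suc t *_) (sum-*ˡ (b2n (S v)) Q))) ⟩
  -- The later positions of `v` give `suc t` copies, and the position in front gives one more.
  ∑ P + suc t * (b2n (S v) * F v) + b2n (S v) * F v ≡⟨ arith (∑ P) t (b2n (S v) * F v) ⟩
  ∑ P + suc (suc t) * (b2n (S v) * F v) ∎
  where
  open ≡-Reasoning
  F P Q : Fin k → ℕ
  F x = cl A (suc t) (S ∩ A x)
  P x = b2n ((S \\ v) x) * cl A (suc t) ((S \\ v) ∩ A x)
  Q x = b2n ((S ∩ A v) x) * cl A t ((S ∩ A v) ∩ A x)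
  arith : ∀ p t m → p + suc t * m + m ≡ p + suc (suc t) * m
  arith = solve-∀
  comm3 : ∀ a b c → (a ∧ b) ∧ c ≡ (a ∧ c) ∧ b
  comm3 true  b c = ∧-comm b c
  comm3 false b c = refl
  pt : ∀ x → b2n ((S \\ v) x) * F x ≡ P x + suc t * (b2n (S v) * Q x)
  pt x with eqᵇ v x in eqv
  ... | true with eqᵇ-true {i = v} eqv
  ... | refl rewrite irr sA v | ∧-zeroʳ (S v) = sym (trans (cong (suc t *_) (*-zeroʳ (b2n (S v)))) (*-zeroʳ (suc t)))
  pt x | false with S x
  ... | false = sym (trans (cong (suc t *_) (*-zeroʳ (b2n (S v)))) (*-zeroʳ (suc t)))
  ... | true = trans (+-identityʳ _) (trans (cl-del sA t (S ∩ A x) v)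
        (cong₂ _+_ (trans (cl-cong (suc t) (λ y → comm3 (S y) (A x y) _)) (sym (+-identityʳ _))) (cong (suc t *_) q)))
    where
    q : b2n (S v ∧ A x v) * cl A t ((S ∩ A x) ∩ A v) ≡ b2n (S v) * (b2n (A v x) * cl A t ((S ∩ A v) ∩ A x))
    q = trans (cong₂ _*_ (trans (b2n-∧ (S v) (A x v)) (cong (λ z → b2n (S v) * b2n z) (symm sA x v)))
                         (cl-cong t (λ y → comm3 (S y) (A x y) (A v y))))
              (*-assoc (b2n (S v)) _ _)

-- Falling factorials and colex numbers

ff : ℕ → ℕ → ℕ
ff x       zero    = 1
ff zero    (suc t) = 0
ff (suc x) (suc t) = suc x * ff x t

-- Pascal's rule for C(x+1,t+1), multiplied by (t+1)!.
ff-pascal : ∀ x t → ff (suc x) (suc t) ≡ ff x (suc t) + suc t * ff x t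
ff-pascal zero    zero    = refl
ff-pascal zero    (suc t) = sym (*-zeroʳ (suc (suc t)))
ff-pascal (suc x) zero    = arith x
  where
  arith : ∀ x → suc (suc x) * 1 ≡ suc x * 1 + 1 * 1
  arith = solve-∀
ff-pascal (suc x) (suc t) = begin
  suc (suc x) * F                    ≡⟨ split x F ⟩
  suc x * F + F                      ≡⟨ cong (λ z → suc x * z + F) (ff-pascal x t) ⟩
  suc x * (ff x (suc t) + suc t * ff x t) + suc x * ff x t ≡⟨ arith x t (ff x (suc t)) (ff x t) ⟩
  suc x * ff x (suc t) + suc (suc t) * (suc x * ff x t) ∎
  where
  open ≡-Reasoning
  F = ff (suc x) (suc t)
  split : ∀ x f → suc (suc x) * f ≡ suc x * f + f
  split = solve-∀
  arith : ∀ x t u w → suc x * (u + suc t * w) + suc x * w ≡ suc x * u + suc (suc t) * (suc x * w)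
  arith = solve-∀

ff-1 : ∀ d → ff d 1 ≡ d
ff-1 zero    = refl
ff-1 (suc d) = *-identityʳ (suc d)

ff-suc-mono : ∀ x t → ff x t ≤ ff (suc x) t
ff-suc-mono x zero    = ≤-refl
ff-suc-mono x (suc t) = subst (ff x (suc t) ≤_) (sym (ff-pascal x t)) (m≤m+n _ _)

ff-mono+ : ∀ h x t → ff x t ≤ ff (h + x) t
ff-mono+ zero    x t = ≤-refl
ff-mono+ (suc h) x t = ≤-trans (ff-mono+ h x t) (ff-suc-mono (h + x) t)

ff-mono : ∀ {x y} t → x ≤ y → ff x t ≤ ff y t
ff-mono {x} {y} t x≤y = subst (λ z → ff x t ≤ ff z t) (m∸n+n≡m x≤y) (ff-mono+ (y ∸ x) x t)

ff-pos : ∀ {x t} → t ≤ x → 1 ≤ ff x t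
ff-pos {x} {zero} _ = ≤-refl
ff-pos {suc x} {suc t} (s≤s p) = ≤-trans (ff-pos p) (m≤m+n _ _)

ff-zero : ∀ {x t} → x < t → ff x t ≡ 0
ff-zero {zero}  {suc t} _ = refl
ff-zero {suc x} {suc t} (s≤s p) = trans (cong (suc x *_) (ff-zero p)) (*-zeroʳ (suc x))

ff-< : ∀ {x y k} → x < y → 1 ≤ k → k ≤ y → ff x k < ff y k
ff-< {x} {suc y} {suc k} (s≤s x≤y) _ (s≤s k≤y) =
  subst (ff x (suc k) <_) (sym (ff-pascal y k))
    (≤-trans (≤-reflexive (+-comm 1 _)) (+-mono-≤ (ff-mono (suc k) x≤y) (≤-trans (ff-pos k≤y) (m≤m+n _ _))))

-- Convexity in the first argument: an increase by `h` gains at least as much at the larger starting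
-- point. By `ff-pascal` the last unit of the increase gains `suc k * ff (x + h) k`, which is
-- monotone in `x`.
ff-conv : ∀ t {x y} h → x ≤ y → ff (x + h) t + ff y t ≤ ff x t + ff (y + h) t
ff-conv t {x} {y} zero x≤y rewrite +-identityʳ x | +-identityʳ y = ≤-refl
ff-conv zero    (suc h) x≤y = ≤-refl
ff-conv (suc k) {x} {y} (suc h) x≤y rewrite +-suc x h | +-suc y h | ff-pascal (x + h) k | ff-pascal (y + h) k =
  subst₂ _≤_ (arith (ff (x + h) (suc k)) (ff y (suc k)) (suc k * ff (x + h) k)) (arith2 (ff x (suc k)) _ _)
    (+-mono-≤ (ff-conv (suc k) h x≤y) (*-monoʳ-≤ (suc k) (ff-mono k (+-monoˡ-≤ h x≤y))))
  where
  arith : ∀ a b c → a + b + c ≡ a + c + b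
  arith = solve-∀
  arith2 : ∀ a b c → a + b + c ≡ a + (b + c)
  arith2 = solve-∀

-- The last unit of the increase already gains strictly more at `y`; the bound `k ≤ y + h` makes
-- `ff (y + h) k` positive, so that `ff-<` applies.
ff-conv< : ∀ k {x y} h → x < y → 1 ≤ k → k ≤ y + h →
           ff (x + suc h) (suc k) + ff y (suc k) < ff x (suc k) + ff (y + suc h) (suc k)
ff-conv< k {x} {y} h x<y 1≤k k≤ rewrite +-suc x h | +-suc y h | ff-pascal (x + h) k | ff-pascal (y + h) k =
  subst₂ _<_ (arith (ff (x + h) (suc k)) (ff y (suc k)) (suc k * ff (x + h) k)) (arith2 (ff x (suc k)) _ _)
    (+-mono-≤-< (ff-conv (suc k) h (<⇒≤ x<y)) (*-monoʳ-< (suc k) (ff-< (+-monoˡ-< h x<y) 1≤k k≤)))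
  where
  arith : ∀ a b c → a + b + c ≡ a + c + b
  arith = solve-∀
  arith2 : ∀ a b c → a + b + c ≡ a + (b + c)
  arith2 = solve-∀

-- This is `ff-conv` from the starting point 0, where `ff` vanishes.
ff-super : ∀ {t} x y → 1 ≤ t → ff x t + ff y t ≤ ff (x + y) t
ff-super {suc t} x y _ = subst (ff x (suc t) + ff y (suc t) ≤_) (cong (λ z → ff z (suc t)) (+-comm y x))
  (ff-conv (suc t) {0} {y} x z≤n)

-- The binomial coefficient C(r,2), the number of edges of K_r; the index is one larger than that of
-- the usual triangular number.
tri : ℕ → ℕ
tri zero    = 0
tri (suc r) = r + tri r

tri-mono : ∀ {x y} → x ≤ y → tri x ≤ tri y
tri-mono {zero} _ = z≤n
tri-mono {suc x} {suc y} (s≤s p) = +-mono-≤ p (tri-mono p)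

2tri : ∀ r → 2 * tri (suc r) ≡ suc r * r
2tri zero = refl
2tri (suc r) = trans (trans (arith r (tri (suc r))) (cong (2 * suc r +_) (2tri r))) (arith2 r)
  where
  arith : ∀ r x → 2 * (suc r + x) ≡ 2 * suc r + 2 * x
  arith = solve-∀
  arith2 : ∀ r → 2 * suc r + suc r * r ≡ suc (suc r) * suc r
  arith2 = solve-∀

-- (a + 1)! times the number of K_{a+1} in the colex graph with tri r + s edges, s ≤ r
val : ℕ → ℕ → ℕ → ℕ
val a r s = ff r (suc a) + suc a * ff s a

val-row : ∀ a r → val a r r ≡ ff (suc r) (suc a)
val-row a r = sym (ff-pascal r a)

-- The clique of the colex graph has `suc r` vertices, so `s ≤ r` is the condition that its last row
-- is not full. The number 0 is represented by a clique on one vertex.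
rep : ∀ m → ∃ λ r → ∃ λ s → s ≤ r × m ≡ tri (suc r) + s
rep zero = 0 , 0 , z≤n , refl
rep (suc m) with rep m
... | r , s , s≤r , eq with s ≟ r
... | yes refl = suc r , 0 , z≤n , trans (cong suc (trans eq (+-comm (tri (suc s)) s))) (sym (+-identityʳ _))
... | no s≢r = r , suc s , ≤∧≢⇒< s≤r s≢r , trans (cong suc eq) (sym (+-suc _ s))

row-< : ∀ {r s r' s'} → s ≤ r → r < r' → tri (suc r) + s < tri (suc r') + s'
row-< {r} {s} {r'} {s'} p q = ≤-trans (s≤s (≤-trans (≤-reflexive (+-comm (tri (suc r)) s))
  (+-monoˡ-≤ (tri (suc r)) p)))
   (≤-trans (tri-mono (s≤s q)) (m≤m+n (tri (suc r')) s'))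

rep-unique : ∀ {r s r' s'} → s ≤ r → s' ≤ r' → tri (suc r) + s ≡ tri (suc r') + s' → r ≡ r' × s ≡ s'
rep-unique {r} {s} {r'} {s'} p p' eq with <-cmp r r'
... | tri≈ _ refl _ = refl , +-cancelˡ-≡ (tri (suc r)) s s' eq
... | tri< r<r' _ _ = ⊥-elim (<⇒≢ (row-< p r<r') eq)
... | tri> _ _ r'<r = ⊥-elim (<⇒≢ (row-< p' r'<r) (sym eq))

-- The last E ≤ r edges of a colex graph containing K_{r+1} carry at least as many cliques as a star with E edges whose leaves form a clique.
window : ∀ a → 1 ≤ a → ∀ r s E → s ≤ r → E ≤ r → 1 ≤ E →
  ∃ λ r₂ → ∃ λ s₂ → s₂ ≤ r₂ × r₂ ≤ r × (tri (suc r₂) + s₂ + E ≡ tri (suc r) + s)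
    × suc a * ff E a + val a (suc r₂) s₂ ≤ val a (suc r) s
window a 1≤a r s E s≤r E≤r 1≤E with E ≤? s
... | yes E≤s = r , s ∸ E , ≤-trans (m∸n≤m s E) s≤r , ≤-refl ,
      trans (+-assoc (tri (suc r)) _ E) (cong (tri (suc r) +_) (m∸n+n≡m E≤s)) ,
      ≤-trans (≤-reflexive (arith (suc a) (ff E a) (ff (s ∸ E) a) (ff (suc r) (suc a))))
        (+-monoʳ-≤ (ff (suc r) (suc a)) (*-monoʳ-≤ (suc a)
          (subst (λ z → ff E a + ff (s ∸ E) a ≤ ff z a) (m+[n∸m]≡n E≤s) (ff-super E (s ∸ E) 1≤a))))
  where
  arith : ∀ a x y z → a * x + (z + a * y) ≡ z + a * (x + y)
  arith = solve-∀
window a 1≤a zero s E s≤r E≤r 1≤E | no E≰s = ⊥-elim (<⇒≱ 1≤E E≤r)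
window a 1≤a (suc r) s E s≤r E≤r 1≤E | no E≰s with ≰⇒> E≰s
-- The last row is used up entirely, and the previous row, of length `suc r`, loses `E - s` edges
-- and keeps `s + h`.
... | s<E = r , s + h , s+h≤r , n≤1+n r , sumeq ,
      ≤-trans (≤-reflexive (arith (suc a) (ff E a) (ff (s + h) a) (ff (suc r) (suc a))))
       (≤-trans (+-monoʳ-≤ (ff (suc r) (suc a)) (*-monoʳ-≤ (suc a) cv))
        (≤-reflexive (trans (arith2 (ff (suc r) (suc a)) (suc a) (ff s a) (ff (suc r) a))
           (cong (_+ suc a * ff s a) (sym (ff-pascal (suc r) a))))))
  where
  h = suc r ∸ E
  E+h : E + h ≡ suc r
  E+h = m+[n∸m]≡n E≤r
  s+h≤r : s + h ≤ r
  s+h≤r = ≤-pred (subst (suc (s + h) ≤_) E+h (+-monoˡ-≤ h s<E))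
  sumeq : tri (suc r) + (s + h) + E ≡ tri (suc (suc r)) + s
  sumeq = trans (ar (tri (suc r)) s h E) (cong (λ z → z + tri (suc r) + s) E+h)
    where
    ar : ∀ x s h E → x + (s + h) + E ≡ E + h + x + s
    ar = solve-∀
  arith : ∀ a x y z → a * x + (z + a * y) ≡ z + a * (y + x)
  arith = solve-∀
  arith2 : ∀ x a u w → x + a * (u + w) ≡ x + a * w + a * u
  arith2 = solve-∀
  cv : ff (s + h) a + ff E a ≤ ff s a + ff (suc r) a
  cv = subst (λ z → ff (s + h) a + ff E a ≤ ff s a + ff z a) E+h (ff-conv a h (<⇒≤ s<E))

cl-≤-ff : ∀ {k} (A : Rel₂ k) → (∀ v → A v v ≡ false) → ∀ t S → cl A t S ≤ ff (# S) t
cl-≤-ff A ir zero S = ≤-refl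
cl-≤-ff {k} A ir (suc t) S with # S in eqS
... | zero = ≤-reflexive (cl-empty A t S (count-zero⁻ S eqS))
... | suc m = ≤-trans (sum-mono pt) (≤-reflexive (trans (sum-*ʳ (ff m t) (λ x → b2n (S x)))
                (cong (_* ff m t) (trans (sym (count-sum S)) eqS))))
  where
  pt : ∀ x → b2n (S x) * cl A t (S ∩ A x) ≤ b2n (S x) * ff m t
  pt x with S x in eq
  ... | false = z≤n
  ... | true  = *-monoʳ-≤ 1 (≤-trans (cl-≤-ff A ir t (S ∩ A x)) (ff-mono t le))
    where
    le : # (S ∩ A x) ≤ m
    le = ≤-trans (count-mono sub) (≤-reflexive (suc-injective (trans (sym (count-∈ S x eq)) eqS)))
      where
      sub : ∀ y → (S ∩ A x) y ≡ true → (S \\ x) y ≡ true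
      sub y p with ∧-true {S y} p
      ... | sy , axy = ∧-intro sy (not-false (¬true λ h → false≢true (ir x)
        (trans (cong (A x) (eqᵇ-true {i = x} h)) axy)))

-- Deleting edges across a cut

degSum : ∀ {k} → Rel₂ k → ℕ
degSum A = ∑ (λ u → # (A u))

cl-2 : ∀ {k} (A : Rel₂ k) → cl A 2 full ≡ degSum A
cl-2 A = sum-cong (λ x → trans (+-identityʳ _) (cl-1 A (A x)))

-- `D` lists each removed edge in exactly one direction, so its row sums count removed edges and not
-- edge ends. The handshake lemma, cuts and stars are all instances.
degSum-split : ∀ {k} {A A' D : Rel₂ k} →
  (∀ x y → b2n (A x y) ≡ b2n (A' x y) + (b2n (D x y) + b2n (D y x))) →
  degSum A ≡ degSum A' + 2 * ∑ (λ x → # (D x))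
degSum-split {A = A} {A'} {D} h = begin
  ∑ (λ u → # (A u)) ≡⟨ sum-cong row ⟩
  ∑ (λ u → # (A' u) + (# (D u) + # (λ v → D v u))) ≡⟨ sum-+ (λ u → # (A' u)) _ ⟩
  degSum A' + ∑ (λ u → # (D u) + # (λ v → D v u)) ≡⟨ cong (degSum A' +_) (sum-+ (λ u → # (D u)) _) ⟩
  degSum A' + (∑ (λ u → # (D u)) + ∑ (λ u → # (λ v → D v u))) ≡⟨ cong (λ z → degSum A' + (∑ (λ u → # (D u)) + z))
    swap ⟩
  degSum A' + (∑ (λ u → # (D u)) + ∑ (λ u → # (D u))) ≡⟨ cong (degSum A' +_)
    (sym (cong (∑ (λ u → # (D u)) +_) (+-identityʳ _))) ⟩
  degSum A' + 2 * ∑ (λ x → # (D x)) ∎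
  where
  open ≡-Reasoning
  swap : ∑ (λ u → # (λ v → D v u)) ≡ ∑ (λ u → # (D u))
  swap = trans (sum-cong (λ u → count-sum (λ v → D v u))) (trans (sum-swap (λ u v → b2n (D v u)))
    (sum-cong (λ u → sym (count-sum (D u)))))
  row : ∀ u → # (A u) ≡ # (A' u) + (# (D u) + # (λ v → D v u))
  row u = begin
    # (A u) ≡⟨ count-sum (A u) ⟩
    ∑ (λ v → b2n (A u v)) ≡⟨ sum-cong (h u) ⟩
    ∑ (λ v → b2n (A' u v) + (b2n (D u v) + b2n (D v u))) ≡⟨ sum-+ (λ v → b2n (A' u v)) _ ⟩
    ∑ (λ v → b2n (A' u v)) + ∑ (λ v → b2n (D u v) + b2n (D v u)) ≡⟨ cong₂ _+_ (sym (count-sum (A' u)))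
      (sum-+ (λ v → b2n (D u v)) _) ⟩
    # (A' u) + (∑ (λ v → b2n (D u v)) + ∑ (λ v → b2n (D v u))) ≡⟨ cong (# (A' u) +_)
      (cong₂ _+_ (sym (count-sum (D u))) (sym (count-sum (λ v → D v u)))) ⟩
    # (A' u) + (# (D u) + # (λ v → D v u)) ∎

handshake : ∀ G → degSum (adj G) ≡ 2 * edges G
handshake G = trans (degSum-split {A = A} {λ _ _ → false} {D} pt)
    (trans (cong (_+ 2 * ∑ (λ x → # (D x))) (trans (sum-zero {f = λ (u : Fin (n G)) → # (λ (v : Fin (n G)) → false)}
      (λ u → count-zero _ (λ _ → refl))) refl))
    (cong (2 *_) (trans (sum-cong (λ u → #-def (D u))) (∑-def _))))
  where
  A = adj G
  D : Rel₂ (n G)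
  D u v = A u v ∧ (toℕ u <ᵇ toℕ v)
  pt : ∀ x y → b2n (A x y) ≡ b2n (D x y) + b2n (D y x)
  pt x y rewrite adj-sym G y x with A x y in eq | toℕ x <ᵇ toℕ y in eq1 | toℕ y <ᵇ toℕ x in eq2
  ... | false | _ | _ = refl
  ... | true | true | false = refl
  ... | true | false | true = refl
  ... | true | true | true = ⊥-elim (<-asym (<ᵇ⇒< (toℕ x) (toℕ y) (→T eq1)) (<ᵇ⇒< (toℕ y) (toℕ x) (→T eq2)))
  ... | true | false | false with <-cmp (toℕ x) (toℕ y)
  ... | tri< l _ _ = ⊥-elim (false≢true eq1 (T→ (<⇒<ᵇ l)))
  ... | tri> _ _ l = ⊥-elim (false≢true eq2 (T→ (<⇒<ᵇ l)))
  ... | tri≈ _ e _ = ⊥-elim (false≢true (adj-irrefl G x) (trans (cong (A x) (toℕ-injective e)) eq))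

sub : (G : Graph) (keep : Rel₂ (n G)) → (∀ u v → keep u v ≡ keep v u) → Graph
sub G keep ks = record
  { n = n G
  ; adj = λ u v → adj G u v ∧ keep u v
  ; adj-sym = λ u v → cong₂ _∧_ (adj-sym G u v) (ks u v)
  ; adj-irrefl = λ v → cong (_∧ keep v v) (adj-irrefl G v)
  }

infix 4 _⊑_
_⊑_ : ∀ {k} → Rel₂ k → Rel₂ k → Set
A ⊑ B = ∀ x y → A x y ≡ true → B x y ≡ true

same : Bool → Bool → Bool
same true  b = b
same false b = not b

same-sym : ∀ a b → same a b ≡ same b a
same-sym true  true  = refl
same-sym true  false = refl
same-sym false true  = refl
same-sym false false = refl

cutG : (G : Graph) → BSet (n G) → Graph
cutG G X = sub G (λ u v → same (X u) (X v)) (λ u v → same-sym (X u) (X v))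

-- Only the direction from `X` outwards is recorded, so every cut edge occurs once.
cross : ∀ {k} → Rel₂ k → BSet k → Rel₂ k
cross A X x y = X x ∧ (A x y ∧ not (X y))

cutE : ∀ {k} → Rel₂ k → BSet k → ℕ
cutE A X = ∑ (λ x → # (cross A X x))

cut-degSum : ∀ G X → degSum (adj G) ≡ degSum (adj (cutG G X)) + 2 * cutE (adj G) X
cut-degSum G X = degSum-split pt
  where
  pt : ∀ x y → b2n (adj G x y) ≡ b2n (adj G x y ∧ same (X x) (X y)) +
    (b2n (cross (adj G) X x y) + b2n (cross (adj G) X y x))
  pt x y rewrite adj-sym G y x with adj G x y | X x | X y
  ... | true  | true  | true  = refl
  ... | true  | true  | false = refl
  ... | true  | false | true  = refl
  ... | true  | false | false = refl
  ... | false | true  | true  = refl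
  ... | false | true  | false = refl
  ... | false | false | true  = refl
  ... | false | false | false = refl

edgeOff : (G : Graph) → Fin (n G) → Fin (n G) → Graph
edgeOff G u z = sub G (λ x y → not ((eqᵇ u x ∧ eqᵇ z y) ∨ (eqᵇ u y ∧ eqᵇ z x)))
  (λ x y → cong not (∨-comm (eqᵇ u x ∧ eqᵇ z y) (eqᵇ u y ∧ eqᵇ z x)))

-- Split off `u`, and then `z` inside the link of `u`. What disappears are the cliques through both,
-- with `(2 + a) * suc a` choices for the positions of the two ends.
edge-del : ∀ G u z → adj G u z ≡ true → ∀ a →
  cl (adj G) (2 + a) full ≤ cl (adj (edgeOff G u z)) (2 + a) full + (2 + a) *
    (suc a * cl (adj G) a (adj G u ∩ adj G z))
edge-del G u z uz a = ≤-reflexive (begin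
  cl A (2 + a) full ≡⟨ cl-del sA (suc a) full u ⟩
  cl A (2 + a) (full \\ u) + (2 + a) * (1 * cl A (suc a) (A u)) ≡⟨ cong
    (λ w → cl A (2 + a) (full \\ u) + (2 + a) * (1 * w)) (cl-del sA a (A u) z) ⟩
  cl A (2 + a) (full \\ u) + (2 + a) * (1 * (cl A (suc a) (A u \\ z) + suc a * (b2n (A u z) * cl A a (A u ∩ A z))))
    ≡⟨ cong (λ w → cl A (2 + a) (full \\ u) + (2 + a) * (1 *
      (cl A (suc a) (A u \\ z) + suc a * (b2n w * cl A a (A u ∩ A z))))) uz ⟩
  cl A (2 + a) (full \\ u) + (2 + a) * (1 * (cl A (suc a) (A u \\ z) + suc a * (1 * cl A a (A u ∩ A z))))
    ≡⟨ arith (2 + a) (suc a) (cl A (2 + a) (full \\ u)) (cl A (suc a) (A u \\ z)) (cl A a (A u ∩ A z)) ⟩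
  (cl A (2 + a) (full \\ u) + (2 + a) * (1 * cl A (suc a) (A u \\ z))) + (2 + a) * (suc a * cl A a (A u ∩ A z))
    ≡⟨ cong (_+ (2 + a) * (suc a * cl A a (A u ∩ A z))) (sym eqB) ⟩
  cl B (2 + a) full + (2 + a) * (suc a * cl A a (A u ∩ A z)) ∎)
  where
  open ≡-Reasoning
  A = adj G
  B = adj (edgeOff G u z)
  sA = adj-simple G
  arith : ∀ t a p q w → p + t * (1 * (q + a * (1 * w))) ≡ (p + t * (1 * q)) + t * (a * w)
  arith = solve-∀
  B-off : ∀ x y → eqᵇ u x ≡ false → eqᵇ u y ≡ false → B x y ≡ A x y
  B-off x y p q rewrite p | q = ∧-identityʳ _
  u≠ : ∀ y → A u y ≡ true → eqᵇ u y ≡ false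
  u≠ y p = adj-≠ sA p
  B-row : ∀ y → B u y ≡ (A u \\ z) y
  B-row y rewrite eqᵇ-refl u with A u y in e | eqᵇ z y
  ... | false | _ = refl
  ... | true | true = refl
  ... | true | false rewrite u≠ y e = refl
  eqB : cl B (2 + a) full ≡ cl A (2 + a) (full \\ u) + (2 + a) * (1 * cl A (suc a) (A u \\ z))
  eqB = trans (cl-del (adj-simple (edgeOff G u z)) (suc a) full u)
    (cong₂ (λ p q → p + (2 + a) * (1 * q))
      (cl-congS (2 + a) (λ _ → refl) (λ x y p q → B-off x y (not-true p) (not-true q)))
      (cl-congS (suc a) B-row (λ x y p q → B-off x y (nu x p) (nu y q))))
    where
    nu : ∀ x → B u x ≡ true → eqᵇ u x ≡ false
    nu x p = u≠ x (proj₁ (∧-true p))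

cross-elim : ∀ {k} (A : Rel₂ k) X x y → cross A X x y ≡ true → X x ≡ true × A x y ≡ true × X y ≡ false
cross-elim A X x y p with ∧-true {X x} p
... | xx , q with ∧-true {A x y} q
... | axy , w = xx , axy , not-true w

cross-intro : ∀ {k} (A : Rel₂ k) X x y → X x ≡ true → A x y ≡ true → X y ≡ false → cross A X x y ≡ true
cross-intro A X x y p q w = ∧-intro p (∧-intro q (not-false w))

-- every common neighbour of the ends of a cut edge gives another cut edge
codeg-cut : ∀ G X u z → cross (adj G) X u z ≡ true → suc (# (adj G u ∩ adj G z)) ≤ cutE (adj G) X
codeg-cut G X u z c = begin
  suc (# (A u ∩ A z)) ≡⟨ cong suc (count-⊕ (A u ∩ A z) X) ⟩
  suc (# ((A u ∩ A z) ∩ X) + # ((A u ∩ A z) ∩ (not ∘ X))) ≡⟨ cong suc (+-comm (# ((A u ∩ A z) ∩ X)) _) ⟩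
  suc (# ((A u ∩ A z) ∩ (not ∘ X)) + # ((A u ∩ A z) ∩ X)) ≤⟨ +-mono-≤ rowle (count-mono colsub) ⟩
  # (cross A X u) + # col ≡⟨ cong₂ _+_ (sym (sum-single u (λ _ → # (cross A X u)))) (count-sum col) ⟩
  ∑ (λ x → b2n (eqᵇ u x) * # (cross A X u)) + ∑ (λ x → b2n (col x)) ≡⟨ sym
    (sum-+ (λ x → b2n (eqᵇ u x) * # (cross A X u)) _) ⟩
  ∑ (λ x → b2n (eqᵇ u x) * # (cross A X u) + b2n (col x)) ≤⟨ sum-mono pt ⟩
  cutE A X ∎
  where
  open ≤-Reasoning
  A = adj G
  sA = adj-simple G
  ce = cross-elim A X u z c
  col : BSet (n G)
  col x = cross A X x z ∧ not (eqᵇ u x)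
  rowle : suc (# ((A u ∩ A z) ∩ (not ∘ X))) ≤ # (cross A X u)
  rowle = ≤-trans (s≤s (count-mono sb)) (≤-reflexive (sym (count-∈ (cross A X u) z c)))
    where
    sb : ∀ y → ((A u ∩ A z) ∩ (not ∘ X)) y ≡ true → (cross A X u \\ z) y ≡ true
    sb y p with ∧-true {(A u ∩ A z) y} p
    ... | q , nx with ∧-true {A u y} q
    ... | uy , zy = ∧-intro (cross-intro A X u y (proj₁ ce) uy (not-true nx))
          (not-false (adj-≠ sA zy))
  colsub : ∀ y → ((A u ∩ A z) ∩ X) y ≡ true → col y ≡ true
  colsub y p with ∧-true {(A u ∩ A z) y} p
  ... | q , xy with ∧-true {A u y} q
  ... | uy , zy = ∧-intro (cross-intro A X y z xy (trans (symm sA y z) zy) (proj₂ (proj₂ ce)))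
        (not-false (adj-≠ sA uy))
  pt : ∀ x → b2n (eqᵇ u x) * # (cross A X u) + b2n (col x) ≤ # (cross A X x)
  pt x with eqᵇ u x in e
  ... | true rewrite ∧-zeroʳ (cross A X x z) = ≤-reflexive (trans (+-identityʳ _)
    (trans (+-identityʳ _) (cong (λ w → # (cross A X w)) (eqᵇ-true {i = u} e))))
  ... | false with cross A X x z in e2'
  ... | true  = count-point (cross A X x) z e2'
  ... | false = z≤n

cutE-off : ∀ G X u z → cross (adj G) X u z ≡ true → cutE (adj G) X ≡ suc (cutE (adj (edgeOff G u z)) X)
cutE-off G X u z c = begin
  ∑ (λ x → # (cross A X x)) ≡⟨ sum-cong pt ⟩
  ∑ (λ x → # (cross B X x) + b2n (eqᵇ u x) * 1) ≡⟨ sum-+ (λ x → # (cross B X x)) _ ⟩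
  cutE B X + ∑ (λ x → b2n (eqᵇ u x) * 1) ≡⟨ cong (cutE B X +_) (sum-single u (λ _ → 1)) ⟩
  cutE B X + 1 ≡⟨ +-comm _ 1 ⟩
  suc (cutE B X) ∎
  where
  open ≡-Reasoning
  A = adj G
  B = adj (edgeOff G u z)
  ce = cross-elim A X u z c
  pt : ∀ x → # (cross A X x) ≡ # (cross B X x) + b2n (eqᵇ u x) * 1
  pt x with eqᵇ u x in e
  ... | false = trans (count-cong q) (sym (+-identityʳ _))
    where
    q : ∀ y → cross A X x y ≡ X x ∧ ((A x y ∧ not (false ∨ (eqᵇ u y ∧ eqᵇ z x))) ∧ not (X y))
    q y with X x in ex | A x y | X y
    ... | false | _ | _ = refl
    ... | true | false | _ = refl
    ... | true | true | true = sym (∧-zeroʳ _)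
    ... | true | true | false with eqᵇ z x in ez
    ... | false rewrite ∧-zeroʳ (eqᵇ u y) = refl
    ... | true = ⊥-elim (false≢true (proj₂ (proj₂ ce)) (trans (cong X (eqᵇ-true {i = z} ez)) ex))
  ... | true with eqᵇ-true {i = u} e
  ... | refl = trans (count-split (cross A X u) z) (cong₂ _+_ (count-cong q) (cong b2n c))
    where
    q : ∀ y → cross A X u y ∧ not (eqᵇ z y) ≡ X u ∧ ((A u y ∧ not (eqᵇ z y ∨ (eqᵇ u y ∧ eqᵇ z u))) ∧ not (X y))
    q y rewrite eqᵇ-false {i = z} {u} (λ { refl → false≢true (proj₂ (proj₂ ce)) (proj₁ ce) }) | ∧-zeroʳ (eqᵇ u y)
      with X u | A u y | X y | eqᵇ z y
    ... | false | _ | _ | _ = refl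
    ... | true | false | _ | _ = refl
    ... | true | true | true | true = refl
    ... | true | true | true | false = refl
    ... | true | true | false | true = refl
    ... | true | true | false | false = refl

-- The cut edges are deleted one by one. While `suc E` of them are left, the ends of the next one
-- have at most `E` common neighbours by `codeg-cut`, so its deletion costs at most
-- `(2 + a) * (suc a * ff E a)`; by `ff-pascal` these costs add up to the bound.
cut-cl : ∀ a E G X → cutE (adj G) X ≡ E →
  cl (adj G) (2 + a) full ≤ cl (adj (cutG G X)) (2 + a) full + (2 + a) * ff E (suc a)
cut-cl a zero G X eqE = ≤-trans (≤-reflexive (cl-congS (2 + a) (λ _ → refl) (λ x y _ _ → pt x y))) (m≤m+n _ _)
  where
  nocross : ∀ x y → cross (adj G) X x y ≡ false
  nocross x y = count-zero⁻ _ (n≤0⇒n≡0 (≤-trans (sum-point (λ x → # (cross (adj G) X x)) x) (≤-reflexive eqE))) y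
  pt : ∀ x y → adj G x y ≡ adj G x y ∧ same (X x) (X y)
  pt x y with adj G x y in e | X x in ex | X y in ey
  ... | false | _ | _ = refl
  ... | true | true | true = refl
  ... | true | false | false = refl
  ... | true | true | false = ⊥-elim (false≢true (nocross x y) (cross-intro (adj G) X x y ex e ey))
  ... | true | false | true = ⊥-elim (false≢true (nocross y x)
    (cross-intro (adj G) X y x ey (trans (adj-sym G y x) e) ex))
cut-cl a (suc E) G X eqE with sum-pos _ (subst (0 <_) (sym eqE) (s≤s z≤n))
... | u , p with count-pos _ p
... | z , c = begin
  cl (adj G) (2 + a) full ≤⟨ edge-del G u z (proj₁ (proj₂ (cross-elim (adj G) X u z c))) a ⟩
  cl (adj G₁) (2 + a) full + (2 + a) * (suc a * cl (adj G) a (adj G u ∩ adj G z))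
    ≤⟨ +-mono-≤ (cut-cl a E G₁ X (suc-injective (trans (sym (cutE-off G X u z c)) eqE)))
        (*-monoʳ-≤ (2 + a) (*-monoʳ-≤ (suc a) (≤-trans (cl-≤-ff (adj G) (adj-irrefl G) a _)
          (ff-mono a (≤-pred (≤-trans (codeg-cut G X u z c) (≤-reflexive eqE))))))) ⟩
  cl (adj (cutG G₁ X)) (2 + a) full + (2 + a) * ff E (suc a) + (2 + a) * (suc a * ff E a)
    ≤⟨ +-monoˡ-≤ _ (+-monoˡ-≤ _ (cl-mono {A = adj (cutG G₁ X)} {adj (cutG G X)} (2 + a) (λ _ p → p) cut⊑)) ⟩
  cl (adj (cutG G X)) (2 + a) full + (2 + a) * ff E (suc a) + (2 + a) * (suc a * ff E a)
    ≡⟨ arith (cl (adj (cutG G X)) (2 + a) full) (2 + a) (ff E (suc a)) (suc a * ff E a) ⟩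
  cl (adj (cutG G X)) (2 + a) full + (2 + a) * (ff E (suc a) + suc a * ff E a)
    ≡⟨ cong (λ w → cl (adj (cutG G X)) (2 + a) full + (2 + a) * w) (sym (ff-pascal E a)) ⟩
  cl (adj (cutG G X)) (2 + a) full + (2 + a) * ff (suc E) (suc a) ∎
  where
  open ≤-Reasoning
  G₁ = edgeOff G u z
  cut⊑ : adj (cutG G₁ X) ⊑ adj (cutG G X)
  cut⊑ x y p with ∧-true {adj G₁ x y} p
  ... | q , r = ∧-intro (proj₁ (∧-true {adj G x y} q)) r
  arith : ∀ p t x y → p + t * x + t * y ≡ p + t * (x + y)
  arith = solve-∀

-- The Kruskal–Katona bound

find : ∀ {k} (P : BSet k) → (∃ λ x → P x ≡ true) ⊎ (∀ x → P x ≡ false)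
find P with # P in eq
... | zero  = inj₂ (count-zero⁻ P eq)
... | suc m = inj₁ (count-pos P (subst (0 <_) (sym eq) (s≤s z≤n)))

nz : ℕ → Bool
nz zero    = false
nz (suc _) = true

NI : ∀ {k} → Rel₂ k → BSet k
NI A v = nz (# (A v))

NI-intro : ∀ {k} (A : Rel₂ k) {x y} → A x y ≡ true → NI A x ≡ true
NI-intro A {x} {y} p with # (A x) | count-point (A x) y p
... | suc _ | _ = refl

NI-elim : ∀ {k} (A : Rel₂ k) {x} → NI A x ≡ true → ∃ λ y → A x y ≡ true
NI-elim A {x} p with # (A x) in eq
... | suc m = count-pos (A x) (subst (0 <_) (sym eq) (s≤s z≤n))

NI-false : ∀ {k} (A : Rel₂ k) {x} → NI A x ≡ false → ∀ y → A x y ≡ false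
NI-false A {x} p with # (A x) in eq
... | zero = count-zero⁻ (A x) eq

n₀ : ∀ {k} → Rel₂ k → ℕ
n₀ A = # (NI A)

cl-NI : ∀ {k} {A : Rel₂ k} → Simple A → ∀ a → cl A (2 + a) full ≡ cl A (2 + a) (NI A)
cl-NI {k} {A} sA a = sum-cong pt
  where
  pt : ∀ x → 1 * cl A (suc a) (full ∩ A x) ≡ b2n (NI A x) * cl A (suc a) (NI A ∩ A x)
  pt x with NI A x in eq
  ... | false = trans (+-identityʳ _) (cl-empty A a (A x) (NI-false A eq))
  ... | true  = cong (1 *_) (cl-cong (suc a) q)
    where
    q : ∀ y → A x y ≡ NI A y ∧ A x y
    q y with A x y in e
    ... | false = sym (∧-zeroʳ _)
    ... | true rewrite NI-intro A {y} {x} (trans (symm sA y x) e) = refl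

cl-n₀ : ∀ {k} {A : Rel₂ k} → Simple A → ∀ a → cl A (2 + a) full ≤ ff (n₀ A) (2 + a)
cl-n₀ sA a = ≤-trans (≤-reflexive (cl-NI sA a)) (cl-≤-ff _ (irr sA) (2 + a) _)

sum-set-≤ : ∀ {k} (S : BSet k) (f : Fin k → ℕ) c → (∀ x → S x ≡ true → c ≤ f x) → # S * c ≤ ∑ f
sum-set-≤ S f c h = ≤-trans (≤-reflexive (trans (cong (_* c) (count-sum S)) (sym (sum-*ʳ c (λ x → b2n (S x))))))
  (sum-mono pt)
  where
  pt : ∀ x → b2n (S x) * c ≤ f x
  pt x with S x in e
  ... | false = z≤n
  ... | true  = ≤-trans (≤-reflexive (+-identityʳ c)) (h x e)

cutE-single : ∀ {k} {A : Rel₂ k} → Simple A → ∀ v → cutE A (eqᵇ v) ≡ # (A v)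
cutE-single {A = A} sA v = trans (sum-cong pt) (sum-single v (λ _ → # (A v)))
  where
  pt : ∀ x → # (cross A (eqᵇ v) x) ≡ b2n (eqᵇ v x) * # (A v)
  pt x with eqᵇ v x in e
  ... | false = count-zero _ (λ _ → refl)
  ... | true with eqᵇ-true {i = v} e
  ... | refl = trans (count-cong q) (sym (+-identityʳ _))
    where
    q : ∀ y → A v y ∧ not (eqᵇ v y) ≡ A v y
    q y with eqᵇ v y in e'
    ... | false = ∧-identityʳ _
    ... | true  = trans (∧-zeroʳ _) (sym (trans (cong (A v) (sym (eqᵇ-true {i = v} e'))) (irr sA v)))

halve : ∀ x y E z → 2 * x ≡ y + 2 * E → z + E ≡ x → y ≡ 2 * z
halve x y E z eq eq' = +-cancelʳ-≡ (2 * E) y (2 * z) (trans (sym eq)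
  (trans (cong (2 *_) (sym eq')) (*-distribˡ-+ 2 z E)))

-- Otherwise at least `2 + r` vertices of degree at least `suc r` give at least the degree sum of
-- K_{r+2}, which is more than twice the number of edges.
low-vertex : ∀ {k} (A : Rel₂ k) r s → degSum A ≡ 2 * (tri (suc r) + s) → s ≤ r → suc r < n₀ A →
  ∃ λ v → 1 ≤ # (A v) × # (A v) ≤ r
low-vertex A r s eq s≤r lt with find (λ v → NI A v ∧ (# (A v) ≤ᵇ r))
... | inj₁ (v , p) with ∧-true {NI A v} p
... | q , l = v , pos , ≤ᵇ⇒≤ _ _ (subst T (sym l) _)
  where
  pos : 1 ≤ # (A v)
  pos with NI-elim A q
  ... | y , e = count-point (A v) y e
low-vertex A r s eq s≤r lt | inj₂ none = ⊥-elim (<⇒≱ small big)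
  where
  big : n₀ A * suc r ≤ degSum A
  big = sum-set-≤ (NI A) (λ v → # (A v)) (suc r) (λ x p → ≰⇒> (λ l → false≢true (none x) (∧-intro p (T→ (≤⇒≤ᵇ l)))))
  small : degSum A < n₀ A * suc r
  small = begin-strict
    degSum A ≡⟨ eq ⟩
    2 * (tri (suc r) + s) <⟨ *-monoʳ-< 2 (+-monoʳ-< (tri (suc r)) (s≤s s≤r)) ⟩
    2 * (tri (suc r) + suc r) ≡⟨ cong (2 *_) (+-comm (tri (suc r)) (suc r)) ⟩
    2 * tri (suc (suc r)) ≡⟨ 2tri (suc r) ⟩
    suc (suc r) * suc r ≤⟨ *-monoˡ-≤ (suc r) lt ⟩
    n₀ A * suc r ∎
    where open ≤-Reasoning

-- Induction on the number of edges. On at most `suc r` vertices the trivial bound suffices.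
-- Otherwise there is a vertex of positive degree at most `r`; its edges form a cut, and `window`
-- shows that the bound falls by at least the loss that `cut-cl` allows.
kruskal-katona : ∀ m a (G : Graph) r s → degSum (adj G) ≡ 2 * (tri (suc r) + s) → s ≤ r → tri (suc r) + s ≤ m →
     cl (adj G) (2 + a) full ≤ val (suc a) (suc r) s
kruskal-katona m a G r s eq s≤r le with n₀ (adj G) ≤? suc r
... | yes p = ≤-trans (cl-n₀ (adj-simple G) a) (≤-trans (ff-mono (2 + a) p) (m≤m+n _ _))
... | no ¬p with low-vertex (adj G) r s eq s≤r (≰⇒> ¬p)
... | v , 1≤d , d≤r with window (suc a) (s≤s z≤n) r s (# (adj G v)) s≤r d≤r 1≤d
... | r₂ , s₂ , s₂≤r₂ , _ , eq₂ , vle = go m le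
  where
  E = # (adj G v)
  G' = cutG G (eqᵇ v)
  go : ∀ m → tri (suc r) + s ≤ m → cl (adj G) (2 + a) full ≤ val (suc a) (suc r) s
  go zero le = ⊥-elim (<⇒≱ 1≤d (≤-trans (m≤n+m E _) (≤-trans (≤-reflexive eq₂) le)))
  go (suc m) le = ≤-trans (cut-cl a E G (eqᵇ v) (cutE-single (adj-simple G) v))
    (≤-trans (+-monoˡ-≤ _ (kruskal-katona m a G' r₂ s₂ e' s₂≤r₂
      (≤-pred (≤-trans (≤-trans (≤-reflexive (+-comm 1 _)) (≤-trans (+-monoʳ-≤ _ 1≤d) (≤-reflexive eq₂))) le))))
      (≤-trans (≤-reflexive (+-comm _ ((2 + a) * ff E (suc a)))) vle))
    where
    e' : degSum (adj G') ≡ 2 * (tri (suc r₂) + s₂)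
    e' = halve (tri (suc r) + s) (degSum (adj G')) E (tri (suc r₂) + s₂)
      (trans (sym eq) (trans (cut-degSum G (eqᵇ v)) (cong (λ z → degSum (adj G') + 2 * z)
      (cutE-single (adj-simple G) v)))) eq₂

induced : (G : Graph) → BSet (n G) → Graph
induced G X = sub G (λ u v → X u ∧ X v) (λ u v → ∧-comm (X u) (X v))

cl-induced : ∀ G X a → cl (adj (induced G X)) (2 + a) full ≡ cl (adj G) (2 + a) X
cl-induced G X a = sum-cong pt
  where
  A = adj G
  B = adj (induced G X)
  pt : ∀ x → 1 * cl B (suc a) (full ∩ B x) ≡ b2n (X x) * cl A (suc a) (X ∩ A x)
  pt x with X x in e
  ... | false = trans (+-identityʳ _) (cl-empty B a (λ y → A x y ∧ false) (λ y → ∧-zeroʳ _))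
  ... | true = cong (1 *_) (cl-congS (suc a) (λ y → ∧-comm (A x y) (X y)) agree)
    where
    agree : ∀ y z → (A x y ∧ X y) ≡ true → (A x z ∧ X z) ≡ true → B y z ≡ A y z
    agree y z p q rewrite proj₂ (∧-true {A x y} p) | proj₂ (∧-true {A x z} q) = ∧-identityʳ _

degSum-induced : ∀ G X → degSum (adj (induced G X)) ≡ cl (adj G) 2 X
degSum-induced G X = trans (sym (cl-2 (adj (induced G X)))) (cl-induced G X 0)

NoCross : ∀ {k} → Rel₂ k → BSet k → Set
NoCross A X = ∀ x y → X x ≡ true → A x y ≡ true → X y ≡ true

cl-comp : ∀ {k} {A : Rel₂ k} → Simple A → ∀ X → NoCross A X → ∀ t →
  cl A (suc t) full ≡ cl A (suc t) X + cl A (suc t) (not ∘ X)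
cl-comp {A = A} sA X nc t = trans (sum-cong pt) (sum-+ (λ x → b2n (X x) * cl A t (X ∩ A x)) _)
  where
  pt : ∀ x → 1 * cl A t (full ∩ A x) ≡ b2n (X x) * cl A t (X ∩ A x) + b2n (not (X x)) * cl A t ((not ∘ X) ∩ A x)
  pt x with X x in e
  ... | true  = trans (cong (1 *_) (cl-cong t q)) (sym (+-identityʳ _))
    where
    q : ∀ y → A x y ≡ X y ∧ A x y
    q y with A x y in e'
    ... | false = sym (∧-zeroʳ _)
    ... | true rewrite nc x y e e' = refl
  ... | false = cong (1 *_) (cl-cong t q)
    where
    q : ∀ y → A x y ≡ not (X y) ∧ A x y
    q y with A x y in e'
    ... | false = sym (∧-zeroʳ _)
    ... | true with X y in e''
    ... | false = refl
    ... | true = ⊥-elim (false≢true e (nc y x e'' (trans (symm sA y x) e')))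

starOff : (G : Graph) → Fin (n G) → BSet (n G) → Graph
starOff G v Y = sub G (λ x y → not ((eqᵇ v x ∧ Y y) ∨ (eqᵇ v y ∧ Y x)))
  (λ x y → cong not (∨-comm (eqᵇ v x ∧ Y y) (eqᵇ v y ∧ Y x)))

-- However few edges at `v` are deleted, only cliques through `v` can be lost. This is better than
-- the cut bound at a vertex of large degree that lies in few cliques.
star-cl : ∀ G v Y a → cl (adj G) (suc a) full ≤ cl (adj (starOff G v Y)) (suc a) full + suc a * cl (adj G) a (adj G v)
star-cl G v Y a = ≤-trans (≤-reflexive (trans (cl-del (adj-simple G) a full v)
    (cong₂ (λ p q → p + suc a * q) (cl-congS {B = B} (suc a) (λ _ → refl) agree) (+-identityʳ (cl A a (A v))))))
  (+-monoˡ-≤ (suc a * cl A a (A v)) (cl-mono {A = B} (suc a) {full \\ v} {full} (λ _ _ → refl) (λ _ _ p → p)))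
  where
  A = adj G
  B = adj (starOff G v Y)
  agree : ∀ x y → (full \\ v) x ≡ true → (full \\ v) y ≡ true → A x y ≡ B x y
  agree x y p q rewrite not-true p | not-true q = sym (∧-identityʳ _)

star-degSum : ∀ G v Y → (∀ y → Y y ≡ true → adj G v y ≡ true) → degSum (adj G) ≡ degSum (adj (starOff G v Y)) + 2 *
  # Y
star-degSum G v Y h = trans (degSum-split {D = λ x y → eqᵇ v x ∧ Y y} pt)
  (cong (λ z → degSum (adj (starOff G v Y)) + 2 * z) (trans (sum-cong q) (sum-single v (λ _ → # Y))))
  where
  A = adj G
  q : ∀ x → # (λ y → eqᵇ v x ∧ Y y) ≡ b2n (eqᵇ v x) * # Y
  q x with eqᵇ v x
  ... | true  = sym (+-identityʳ _)
  ... | false = count-zero _ (λ _ → refl)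
  pt : ∀ x y → b2n (A x y) ≡ b2n (A x y ∧ not ((eqᵇ v x ∧ Y y) ∨ (eqᵇ v y ∧ Y x))) +
    (b2n (eqᵇ v x ∧ Y y) + b2n (eqᵇ v y ∧ Y x))
  pt x y with eqᵇ v x ∧ Y y in e1 | eqᵇ v y ∧ Y x in e2'
  ... | false | false = sym (trans (+-identityʳ _) (cong b2n (∧-identityʳ (A x y))))
  ... | true | false with ∧-true {eqᵇ v x} e1
  ... | p , yy with eqᵇ-true {i = v} p
  ... | refl rewrite h y yy = refl
  pt x y | false | true with ∧-true {eqᵇ v y} e2'
  ... | p , yx with eqᵇ-true {i = v} p
  ... | refl rewrite adj-sym G x v | h x yx = refl
  pt x y | true | true with ∧-true {eqᵇ v x} e1 | ∧-true {eqᵇ v y} e2'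
  ... | p , yy | p' , yx with eqᵇ-true {i = v} p | eqᵇ-true {i = v} p'
  ... | refl | refl = ⊥-elim (false≢true (adj-irrefl G v) (h v yy))

subset-of-size : ∀ c {k} (P : BSet k) m → # P ≡ c → m ≤ c → ∃ λ Q → (∀ x → Q x ≡ true → P x ≡ true) × # Q ≡ m
subset-of-size zero P .0 eq z≤n = P , (λ _ p → p) , eq
subset-of-size (suc c) P m eq le with m ≟ suc c
... | yes refl = P , (λ _ p → p) , eq
... | no m≢ with count-pos P (subst (0 <_) (sym eq) (s≤s z≤n))
... | x , px with subset-of-size c (P \\ x) m (suc-injective (trans (sym (count-∈ P x px)) eq)) (≤-pred (≤∧≢⇒< le m≢))
... | Q , sb , c' = Q , (λ y q → proj₁ (∧-true (sb y q))) , c'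

-- Chase's inequality

allFin-elim : ∀ {k} {P : BSet k} → allFin P ≡ true → ∀ i → P i ≡ true
allFin-elim {suc k} {P} h fz     = proj₁ (∧-true {P fz} h)
allFin-elim {suc k} {P} h (fs i) = allFin-elim (proj₂ (∧-true {P fz} h)) i

allFin-intro : ∀ {k} {P : BSet k} → (∀ i → P i ≡ true) → allFin P ≡ true
allFin-intro {zero}  h = refl
allFin-intro {suc k} h = ∧-intro (h fz) (allFin-intro (h ∘ fs))

allFin-fail : ∀ {k} {P : BSet k} → allFin P ≡ false → ∃ λ i → P i ≡ false
allFin-fail {suc k} {P} h with P fz in eq
... | false = fz , eq
... | true with allFin-fail {k} h
... | i , p = fs i , p

tsum : ∀ {k} t → (Vec (Fin k) t → ℕ) → ℕ
tsum zero    f = f []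
tsum (suc t) f = ∑ (λ x → tsum t (λ xs → f (x ∷ xs)))

tsum-cong : ∀ {k} t {f g : Vec (Fin k) t → ℕ} → (∀ y → f y ≡ g y) → tsum t f ≡ tsum t g
tsum-cong zero    h = h []
tsum-cong (suc t) h = sum-cong (λ x → tsum-cong t (λ xs → h (x ∷ xs)))

tsum-mono : ∀ {k} t {f g : Vec (Fin k) t → ℕ} → (∀ y → f y ≤ g y) → tsum t f ≤ tsum t g
tsum-mono zero    h = h []
tsum-mono (suc t) h = sum-mono (λ x → tsum-mono t (λ xs → h (x ∷ xs)))

tsum-+ : ∀ {k} t (f g : Vec (Fin k) t → ℕ) → tsum t (λ y → f y + g y) ≡ tsum t f + tsum t g
tsum-+ zero    f g = refl
tsum-+ (suc t) f g = trans (sum-cong (λ x → tsum-+ t (λ xs → f (x ∷ xs)) (λ xs → g (x ∷ xs))))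
  (sum-+ (λ x → tsum t (λ xs → f (x ∷ xs))) _)

tsum-*ˡ : ∀ {k} t c (f : Vec (Fin k) t → ℕ) → tsum t (λ y → c * f y) ≡ c * tsum t f
tsum-*ˡ zero    c f = refl
tsum-*ˡ (suc t) c f = trans (sum-cong (λ x → tsum-*ˡ t c (λ xs → f (x ∷ xs))))
  (sum-*ˡ c (λ x → tsum t (λ xs → f (x ∷ xs))))

tsum-∑ : ∀ {k} t {m} (f : Fin m → Vec (Fin k) t → ℕ) → tsum t (λ y → ∑ (λ i → f i y)) ≡ ∑ (λ i → tsum t (f i))
tsum-∑ zero    f = refl
tsum-∑ (suc t) f = trans (sum-cong (λ x → tsum-∑ t (λ i xs → f i (x ∷ xs))))
  (sum-swap (λ x i → tsum t (λ xs → f i (x ∷ xs))))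

exch : ∀ {k t} → Fin t → Vec (Fin k) (suc t) → Vec (Fin k) (suc t)
exch i (x ∷ xs) = lookup xs i ∷ (xs [ i ]≔ x)

tsum-exch : ∀ {k} t (i : Fin t) (f : Vec (Fin k) (suc t) → ℕ) → tsum (suc t) f ≡ tsum (suc t) (f ∘ exch i)
tsum-exch (suc t) fz     f = sum-swap (λ x x' → tsum t (λ xs → f (x ∷ x' ∷ xs)))
tsum-exch {k} (suc t) (fs i) f = trans (sum-swap (λ x x' → tsum t (λ xs → f (x ∷ x' ∷ xs))))
  (trans (sum-cong (λ x' → tsum-exch t i (g x'))) (sum-swap (λ x' x → tsum t
    (λ xs → f (lookup xs i ∷ x' ∷ (xs [ i ]≔ x))))))
  where
  g : Fin k → Vec (Fin k) (suc t) → ℕ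
  g x' (x ∷ xs) = f (x ∷ x' ∷ xs)

transp : ∀ {t} → Fin t → Fin (suc t) → Fin (suc t)
transp i fz = fs i
transp i (fs j) with i ≟F j
... | yes _ = fz
... | no _  = fs j

transp-invol : ∀ {t} (i : Fin t) j → transp i (transp i j) ≡ j
transp-invol i fz with i ≟F i
... | yes _ = refl
... | no ¬p = ⊥-elim (¬p refl)
transp-invol i (fs j) with i ≟F j
... | yes refl = refl
... | no ¬p with i ≟F j
... | yes p = ⊥-elim (¬p p)
... | no _ = refl

lookup-exch : ∀ {k t} (i : Fin t) (y : Vec (Fin k) (suc t)) j → lookup (exch i y) j ≡ lookup y (transp i j)
lookup-exch i (x ∷ xs) fz = refl
lookup-exch i (x ∷ xs) (fs j) with i ≟F j
... | yes refl = lookup∘update i xs x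
... | no i≢j = lookup∘update′ (i≢j ∘ sym) xs x

allFin-reindex : ∀ {k} (σ : Fin k → Fin k) → (∀ j → σ (σ j) ≡ j) → (P : BSet k) → allFin P ≡ allFin (P ∘ σ)
allFin-reindex σ inv P = bool-ext (λ h → allFin-intro (λ i → allFin-elim h (σ i)))
  (λ h → allFin-intro (λ i → trans (cong P (sym (inv i))) (allFin-elim h (σ i))))

allFin-cong : ∀ {k} {P Q : BSet k} → (∀ i → P i ≡ Q i) → allFin P ≡ allFin Q
allFin-cong {zero}  h = refl
allFin-cong {suc k} h = cong₂ _∧_ (h fz) (allFin-cong (h ∘ fs))

module Positions {k} (A : Rel₂ k) where

  cliqueOff freshAt avoidAt fullAt : ∀ {m} → (Fin m → Fin k) → Fin m → Bool
  cliqueOff p i = allFin (λ j → allFin (λ l → (eqᵇ i j ∨ eqᵇ i l) ∨ (eqᵇ j l ∨ A (p j) (p l))))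
  freshAt p i = allFin (λ j → eqᵇ i j ∨ not (eqᵇ (p i) (p j)))
  avoidAt p i = allFin (λ j → eqᵇ i j ∨ not (A (p i) (p j)))
  fullAt p i = allFin (λ j → eqᵇ i j ∨ A (p i) (p j))

  distinct : ∀ {m} → (Fin m → Fin k) → Bool
  distinct p = allFin (λ j → allFin (λ l → eqᵇ j l ∨ not (eqᵇ (p j) (p l))))

  fullAt-elim : ∀ {m} (p : Fin m → Fin k) i → fullAt p i ≡ true → ∀ j → (eqᵇ i j ∨ A (p i) (p j)) ≡ true
  fullAt-elim p i h j = allFin-elim h j

  avoidAt-elim : ∀ {m} (p : Fin m → Fin k) i → avoidAt p i ≡ true → ∀ j → (eqᵇ i j ∨ not (A (p i) (p j))) ≡ true
  avoidAt-elim p i h j = allFin-elim h j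

  distinct-elim : ∀ {m} (p : Fin m → Fin k) → distinct p ≡ true → ∀ j l → (eqᵇ j l ∨ not (eqᵇ (p j) (p l))) ≡ true
  distinct-elim p h j l = allFin-elim (allFin-elim h j) l

  -- `touch p i`: the other entries form a clique, and `p i` lies outside it but has a neighbour in
  -- it. `dom p i`: the other entries are distinct neighbours of `p i`. Counted over all tuples at
  -- one position, these are the two quantities to be compared. Tuples are functions here so that
  -- positions can be permuted by composition.
  touch dom : ∀ {m} → (Fin m → Fin k) → Fin m → Bool
  touch p i = cliqueOff p i ∧ (freshAt p i ∧ not (avoidAt p i))
  dom p i = fullAt p i ∧ distinct p

  module _ {m} (σ : Fin m → Fin m) (inv : ∀ j → σ (σ j) ≡ j) (p q : Fin m → Fin k) (h : ∀ j → q j ≡ p (σ j)) where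

    eqσ : ∀ i j → eqᵇ (σ i) (σ j) ≡ eqᵇ i j
    eqσ i j = bool-ext
      (λ e → trans (cong (eqᵇ i) (trans (sym (inv j)) (trans (cong σ (sym (eqᵇ-true {i = σ i} e))) (inv i))))
        (eqᵇ-refl i))
      (λ e → trans (cong (λ z → eqᵇ (σ i) (σ z)) (sym (eqᵇ-true {i = i} e))) (eqᵇ-refl (σ i)))

    touch-σ : ∀ i → touch p (σ i) ≡ touch q i
    touch-σ i = cong₂ _∧_ (trans (allFin-reindex σ inv _) (allFin-cong
      (λ j → trans (allFin-reindex σ inv _) (allFin-cong (λ l → c₁ j l)))))
      (cong₂ _∧_ (trans (allFin-reindex σ inv _) (allFin-cong
        (λ j → cong₂ _∨_ (eqσ i j) (cong not (cong₂ eqᵇ (sym (h i)) (sym (h j)))))))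
        (cong not (trans (allFin-reindex σ inv _) (allFin-cong
          (λ j → cong₂ _∨_ (eqσ i j) (cong not (cong₂ A (sym (h i)) (sym (h j)))))))))
      where
      c₁ : ∀ j l → (eqᵇ (σ i) (σ j) ∨ eqᵇ (σ i) (σ l)) ∨ (eqᵇ (σ j) (σ l) ∨ A (p (σ j)) (p (σ l)))
                 ≡ (eqᵇ i j ∨ eqᵇ i l) ∨ (eqᵇ j l ∨ A (q j) (q l))
      c₁ j l = cong₂ _∨_ (cong₂ _∨_ (eqσ i j) (eqσ i l)) (cong₂ _∨_ (eqσ j l) (cong₂ A (sym (h j)) (sym (h l))))

    dom-σ : ∀ i → dom p (σ i) ≡ dom q i
    dom-σ i = cong₂ _∧_ (trans (allFin-reindex σ inv _) (allFin-cong
      (λ j → cong₂ _∨_ (eqσ i j) (cong₂ A (sym (h i)) (sym (h j))))))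
      (trans (allFin-reindex σ inv _) (allFin-cong (λ j → trans (allFin-reindex σ inv _)
        (allFin-cong (λ l → cong₂ _∨_ (eqσ j l) (cong not (cong₂ eqᵇ (sym (h j)) (sym (h l)))))))))

  ∨-elimʳ : ∀ {a b} → a ∨ b ≡ true → a ≡ false → b ≡ true
  ∨-elimʳ h refl = h

  -- If deleting either of two positions i ≠ i' leaves a clique, then only the pair i, i' can be non-adjacent.
  module _ (sA : Simple A) {m} (p : Fin m → Fin k) where

    touch-clique : ∀ {i} → touch p i ≡ true → ∀ j l → i ≢ j → i ≢ l → j ≢ l → A (p j) (p l) ≡ true
    touch-clique {i} t j l ij il jl = ∨-elimʳ {eqᵇ j l} (∨-elimʳ {eqᵇ i j ∨ eqᵇ i l}
      (allFin-elim (allFin-elim (proj₁ (∧-true {cliqueOff p i} t)) j) l)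
      (cong₂ _∨_ (eqᵇ-false ij) (eqᵇ-false il))) (eqᵇ-false jl)

    touch-adj : ∀ {i} → touch p i ≡ true → ∃ λ j → i ≢ j × A (p i) (p j) ≡ true
    touch-adj {i} t with allFin-fail (not-true (proj₂ (∧-true {freshAt p i} (proj₂ (∧-true {cliqueOff p i} t)))))
    ... | j , e with eqᵇ i j in eij | A (p i) (p j) in ea
    ... | false | true = j , eqᵇ-≢ eij , ea

    touch-fresh : ∀ {i} → touch p i ≡ true → ∀ j → i ≢ j → p i ≢ p j
    touch-fresh {i} t j ij e with ∨-elimʳ {eqᵇ i j} (allFin-elim
      (proj₁ (∧-true {freshAt p i} (proj₂ (∧-true {cliqueOff p i} t)))) j) (eqᵇ-false ij)
    ... | w = false≢true (not-true w) (trans (cong (eqᵇ (p i)) (sym e)) (eqᵇ-refl (p i)))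

    touch-distinct : ∀ {i} → touch p i ≡ true → distinct p ≡ true
    touch-distinct {i} t = allFin-intro (λ j → allFin-intro (λ l → go j l))
      where
      go : ∀ j l → (eqᵇ j l ∨ not (eqᵇ (p j) (p l))) ≡ true
      go j l with j ≟F l
      ... | yes _ = refl
      ... | no jl = not-false (eqᵇ-false (λ e → ne j l jl e))
        where
        ne : ∀ j l → j ≢ l → p j ≢ p l
        ne j l jl e with i ≟F j | i ≟F l
        ... | yes refl | yes refl = jl refl
        ... | yes refl | no il = touch-fresh t l il e
        ... | no ij | yes refl = touch-fresh t j ij (sym e)
        ... | no ij | no il = false≢true (irr sA (p l)) (trans (cong (λ z → A z (p l)) (sym e))
          (touch-clique t j l ij il jl))

    dom-intro : ∀ {i} → distinct p ≡ true → (∀ j → i ≢ j → A (p i) (p j) ≡ true) → dom p i ≡ true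
    dom-intro {i} d h = ∧-intro (allFin-intro go) d
      where
      go : ∀ j → (eqᵇ i j ∨ A (p i) (p j)) ≡ true
      go j with i ≟F j
      ... | yes _ = refl
      ... | no ij = h j ij

    touch-dom : ∀ {i j} → touch p i ≡ true → i ≢ j → A (p i) (p j) ≡ true → dom p j ≡ true
    touch-dom {i} {j} t ij a = dom-intro (touch-distinct t) go
      where
      go : ∀ l → j ≢ l → A (p j) (p l) ≡ true
      go l jl with i ≟F l
      ... | yes refl = trans (symm sA (p j) (p i)) a
      ... | no il = touch-clique t j l ij il jl

    touch≤dom : 4 ≤ m → # (touch p) ≤ # (dom p)
    touch≤dom 4≤m with find (touch p)
    ... | inj₂ none = ≤-trans (≤-reflexive (count-zero _ none)) z≤n
    ... | inj₁ (i , ti) with find (touch p \\ i)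
    -- With a single touching position, a neighbour of `p i` in the clique is adjacent to all other
    -- entries.
    ... | inj₂ none = ≤-trans (≤-reflexive one) (count-point (dom p) (proj₁ adj₁)
      (touch-dom ti (proj₁ (proj₂ adj₁)) (proj₂ (proj₂ adj₁))))
      where
      adj₁ = touch-adj ti
      one : # (touch p) ≡ 1
      one = trans (count-split (touch p) i) (cong₂ _+_ (count-zero _ none) (cong b2n ti))
    ... | inj₁ (i' , ti₁) with ∧-true {touch p i'} ti₁
    ... | ti' , ne with A (p i) (p i') in eA
    -- The two touching vertices are adjacent, so the whole tuple is a clique and every position
    -- dominates.
    ... | true = count-mono (λ j _ → dom-intro (touch-distinct ti) (λ l jl → all j l jl))
      where
      i≢ : i ≢ i'
      i≢ = eqᵇ-≢ (not-true ne)
      all : ∀ j l → j ≢ l → A (p j) (p l) ≡ true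
      all j l jl with i ≟F j | i ≟F l
      ... | no a | no b = touch-clique ti j l a b jl
      ... | yes refl | yes refl = ⊥-elim (jl refl)
      ... | yes refl | no b with i' ≟F l
      ... | yes refl = eA
      ... | no c = touch-clique ti' i l (i≢ ∘ sym) c jl
      all j l jl | no a | yes refl with i' ≟F j
      ... | yes refl = trans (symm sA (p i') (p i)) eA
      ... | no c = touch-clique ti' j i c (i≢ ∘ sym) jl
    -- Only `i` and `i'` touch here, while all other positions dominate, and there are at least two
    -- of these because `4 ≤ m`.
    ... | false = ≤-trans (≤-trans (count-mono only) (≤-reflexive two))
      (≤-trans ge2 (count-mono {P = (full \\ i) \\ i'} rest))
      where
      i≢ : i ≢ i'
      i≢ = eqᵇ-≢ (not-true ne)
      pair : BSet m
      pair x = eqᵇ i x ∨ eqᵇ i' x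
      only : ∀ j → touch p j ≡ true → pair j ≡ true
      only j tj with i ≟F j | i' ≟F j
      ... | yes _ | _ = refl
      ... | no _ | yes _ = refl
      ... | no a | no b = ⊥-elim (false≢true eA (touch-clique tj i i' (a ∘ sym) (b ∘ sym) i≢))
      cnt-eq : ∀ (x : Fin m) → # (eqᵇ x) ≡ 1
      cnt-eq x = trans (count-split (eqᵇ x) x) (cong₂ _+_ (count-zero _ z) (cong b2n (eqᵇ-refl x)))
        where
        z : ∀ y → (eqᵇ x \\ x) y ≡ false
        z y with eqᵇ x y
        ... | true = refl
        ... | false = refl
      two : # pair ≡ 2
      two = trans (count-split pair i) (cong₂ _+_ (trans (count-cong q) (cnt-eq i'))
        (cong b2n (cong (_∨ eqᵇ i' i) (eqᵇ-refl i))))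
        where
        q : ∀ x → (pair \\ i) x ≡ eqᵇ i' x
        q x with i ≟F x | i' ≟F x
        ... | yes refl | yes refl = ⊥-elim (i≢ refl)
        ... | yes _ | no _ = refl
        ... | no _ | yes _ = refl
        ... | no _ | no _ = refl
      ge2 : 2 ≤ # ((full \\ i) \\ i')
      ge2 = +-cancelʳ-≤ 2 2 _ (≤-trans 4≤m (≤-reflexive (begin
        m ≡⟨ sym (trans (#-def (full {m})) (count-full' m)) ⟩
        # (full {m}) ≡⟨ count-split full i ⟩
        # (full \\ i) + 1 ≡⟨ cong (_+ 1) (count-split (full \\ i) i') ⟩
        # ((full \\ i) \\ i') + b2n ((full \\ i) i') + 1 ≡⟨ cong (λ z → # ((full \\ i) \\ i') + b2n z + 1) ne ⟩
        # ((full \\ i) \\ i') + 1 + 1 ≡⟨ +-assoc _ 1 1 ⟩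
        # ((full \\ i) \\ i') + 2 ∎)))
        where
        open ≡-Reasoning
        count-full' : ∀ m → countFin (full {m}) ≡ m
        count-full' m = trans (sym (#-def (full {m}))) (count-full m)
      rest : ∀ j → ((full \\ i) \\ i') j ≡ true → dom p j ≡ true
      rest j h with ∧-true {(full \\ i) j} h
      ... | hi , hi' = dom-intro (touch-distinct ti) (λ l jl → go l jl)
        where
        i≢j : i ≢ j
        i≢j = eqᵇ-≢ (not-true hi)
        i'≢j : i' ≢ j
        i'≢j = eqᵇ-≢ (not-true hi')
        go : ∀ l → j ≢ l → A (p j) (p l) ≡ true
        go l jl with i ≟F l
        ... | no b = touch-clique ti j l i≢j b jl
        ... | yes refl = touch-clique ti' j i i'≢j (i≢ ∘ sym) jl

allIn : ∀ {k t} → BSet k → Vec (Fin k) t → Bool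
allIn S []       = true
allIn S (x ∷ xs) = S x ∧ allIn S xs

pairwise : ∀ {k t} → Rel₂ k → Vec (Fin k) t → Bool
pairwise B []       = true
pairwise B (x ∷ xs) = allIn (B x) xs ∧ pairwise B xs

allIn-elim : ∀ {k t} {S : BSet k} (xs : Vec (Fin k) t) → allIn S xs ≡ true → ∀ i → S (lookup xs i) ≡ true
allIn-elim {S = S} (x ∷ xs) h fz     = proj₁ (∧-true {S x} h)
allIn-elim {S = S} (x ∷ xs) h (fs i) = allIn-elim xs (proj₂ (∧-true {S x} h)) i

allIn-intro : ∀ {k t} {S : BSet k} (xs : Vec (Fin k) t) → (∀ i → S (lookup xs i) ≡ true) → allIn S xs ≡ true
allIn-intro []       h = refl
allIn-intro (x ∷ xs) h = ∧-intro (h fz) (allIn-intro xs (h ∘ fs))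

pairwise-elim : ∀ {k t} {B : Rel₂ k} → (∀ x y → B x y ≡ B y x) → (xs : Vec (Fin k) t) → pairwise B xs ≡ true →
  ∀ i j → i ≢ j → B (lookup xs i) (lookup xs j) ≡ true
pairwise-elim {B = B} sB (x ∷ xs) h fz     fz     ne = ⊥-elim (ne refl)
pairwise-elim {B = B} sB (x ∷ xs) h fz     (fs j) ne = allIn-elim xs (proj₁ (∧-true {allIn (B x) xs} h)) j
pairwise-elim {B = B} sB (x ∷ xs) h (fs i) fz     ne = trans (sB _ x)
  (allIn-elim xs (proj₁ (∧-true {allIn (B x) xs} h)) i)
pairwise-elim {B = B} sB (x ∷ xs) h (fs i) (fs j) ne = pairwise-elim sB xs (proj₂ (∧-true {allIn (B x) xs} h)) i j
  (λ e → ne (cong fs e))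

pairwise-intro : ∀ {k t} {B : Rel₂ k} (xs : Vec (Fin k) t) → (∀ i j → i ≢ j → B (lookup xs i) (lookup xs j) ≡ true)
  → pairwise B xs ≡ true
pairwise-intro []       h = refl
pairwise-intro (x ∷ xs) h = ∧-intro (allIn-intro xs (λ i → h fz (fs i) (λ ())))
  (pairwise-intro xs (λ i j ne → h (fs i) (fs j) (λ { refl → ne refl })))

allIn-∩ : ∀ {k t} (S R : BSet k) (xs : Vec (Fin k) t) → allIn (S ∩ R) xs ≡ allIn S xs ∧ allIn R xs
allIn-∩ S R []       = refl
allIn-∩ S R (x ∷ xs) rewrite allIn-∩ S R xs with S x | R x
... | true  | true  = refl
... | true  | false = sym (∧-zeroʳ _)
... | false | _     = refl

cl-tuples : ∀ {k} (B : Rel₂ k) t S → cl B t S ≡ tsum t (λ xs → b2n (pairwise B xs ∧ allIn S xs))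
cl-tuples B zero    S = refl
cl-tuples B (suc t) S = sum-cong (λ x → trans (cong (b2n (S x) *_) (cl-tuples B t (S ∩ B x)))
  (trans (sym (tsum-*ˡ t (b2n (S x)) (λ xs → b2n (pairwise B xs ∧ allIn (S ∩ B x) xs)))) (tsum-cong t (pt x))))
  where
  pt : ∀ x xs → b2n (S x) * b2n (pairwise B xs ∧ allIn (S ∩ B x) xs) ≡ b2n
    ((allIn (B x) xs ∧ pairwise B xs) ∧ (S x ∧ allIn S xs))
  pt x xs rewrite allIn-∩ S (B x) xs with S x | pairwise B xs | allIn (B x) xs | allIn S xs
  ... | false | false | false | _ = refl
  ... | false | false | true  | _ = refl
  ... | false | true  | false | _ = refl
  ... | false | true  | true  | _ = refl
  ... | true | false | false | _ = refl
  ... | true | false | true  | _ = refl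
  ... | true | true  | false | false = refl
  ... | true | true  | false | true = refl
  ... | true | true  | true  | false = refl
  ... | true | true  | true  | true = refl

off : ∀ {k} → Rel₂ k → Fin k → BSet k
off A v x = not (eqᵇ v x) ∧ not (A v x)

neq : ∀ {k} → Rel₂ k
neq x y = not (eqᵇ x y)

module _ {k} {A : Rel₂ k} (sA : Simple A) where
  open Positions A

  private
    touchAt domAt : ∀ t → Fin (suc t) → Vec (Fin k) (suc t) → ℕ
    touchAt t i y = b2n (touch (lookup y) i)
    domAt t i y = b2n (dom (lookup y) i)

    touch-pos : ∀ t i → tsum (suc t) (touchAt t i) ≡ tsum (suc t) (touchAt t fz)
    touch-pos t fz     = refl
    touch-pos t (fs i) = sym (trans (tsum-exch t i (touchAt t fz)) (tsum-cong (suc t)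
      (λ y → cong b2n (sym (touch-σ (transp i) (transp-invol i) (lookup y) (lookup (exch i y)) (lookup-exch i y)
        fz)))))

    dom-pos : ∀ t i → tsum (suc t) (domAt t i) ≡ tsum (suc t) (domAt t fz)
    dom-pos t fz     = refl
    dom-pos t (fs i) = sym (trans (tsum-exch t i (domAt t fz)) (tsum-cong (suc t)
      (λ y → cong b2n (sym (dom-σ (transp i) (transp-invol i) (lookup y) (lookup (exch i y)) (lookup-exch i y) fz)))))

    all-pos : ∀ {m} t (F : Fin (suc t) → Vec (Fin m) (suc t) → ℕ) → (∀ i → tsum (suc t) (F i) ≡ tsum (suc t) (F fz)) →
      tsum (suc t) (λ y → ∑ (λ i → F i y)) ≡ suc t * tsum (suc t) (F fz)
    all-pos t F h = trans (tsum-∑ (suc t) F) (trans (sum-cong (λ i → trans (h i) (sym (+-identityʳ _))))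
      (trans (sum-*ʳ (tsum (suc t) (F fz)) (λ _ → 1)) (cong (_* tsum (suc t) (F fz))
        (trans (sym (count-sum full)) (count-full (suc t))))))

    -- All positions contribute equally, so `suc t` times either side counts positions over all
    -- tuples, and there `touch≤dom` compares tuple by tuple.
    core : ∀ t → 3 ≤ t → tsum (suc t) (touchAt t fz) ≤ tsum (suc t) (domAt t fz)
    core t 3≤t = *-cancelˡ-≤ (suc t) (≤-trans (≤-reflexive (sym (all-pos t (touchAt t) (touch-pos t))))
      (≤-trans (tsum-mono (suc t) pt) (≤-reflexive (all-pos t (domAt t) (dom-pos t)))))
      where
      pt : ∀ y → ∑ (λ i → touchAt t i y) ≤ ∑ (λ i → domAt t i y)
      pt y = subst₂ _≤_ (count-sum (touch (lookup y))) (count-sum (dom (lookup y)))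
        (touch≤dom sA (lookup y) (s≤s 3≤t))

    -- A clique avoiding `v` either avoids the neighbours of `v` too, or becomes a touching tuple
    -- when `v` is put in front.
    split-touch : ∀ t v → cl A t (full \\ v) ≤ cl A t (off A v) + tsum t (λ xs → touchAt t fz (v ∷ xs))
    split-touch t v = ≤-trans (≤-reflexive (cl-tuples A t (full \\ v))) (≤-trans (tsum-mono t pt)
      (≤-reflexive (trans (tsum-+ t (λ xs → b2n (pairwise A xs ∧ allIn (off A v) xs)) _)
        (cong (_+ tsum t (λ xs → touchAt t fz (v ∷ xs))) (sym (cl-tuples A t (off A v)))))))
      where
      pt : ∀ xs → b2n (pairwise A xs ∧ allIn (full \\ v) xs) ≤ b2n (pairwise A xs ∧ allIn (off A v) xs) + touchAt t
        fz (v ∷ xs)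
      pt xs with pairwise A xs in ep | allIn (full \\ v) xs in ei
      ... | false | _ = z≤n
      ... | true | false = z≤n
      ... | true | true with allIn (off A v) xs in eo
      ... | true = s≤s z≤n
      ... | false = ≤-reflexive (sym (cong b2n tt))
        where
        ne : ∀ j → eqᵇ v (lookup xs j) ≡ false
        ne j = not-true (allIn-elim xs ei j)
        cq : ∀ j l → ((eqᵇ {suc t} fz j ∨ eqᵇ fz l) ∨ (eqᵇ j l ∨ A (lookup (v ∷ xs) j) (lookup (v ∷ xs) l))) ≡ true
        cq fz l = refl
        cq (fs j) fz = refl
        cq (fs j) (fs l) with eqᵇ (fs j) (fs l) in e
        ... | true = refl
        ... | false = pairwise-elim (symm sA) xs ep j l (λ { refl → eqᵇ-≢ {i = fs j} e refl })
        fr : ∀ j → (eqᵇ {suc t} fz j ∨ not (eqᵇ v (lookup (v ∷ xs) j))) ≡ true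
        fr fz = refl
        fr (fs j) = not-false (ne j)
        av : avoidAt (lookup (v ∷ xs)) fz ≡ false
        av = ¬true (λ h → false≢true eo (allIn-intro xs (λ i → ∧-intro (not-false (ne i))
          (avoidAt-elim (lookup (v ∷ xs)) fz h (fs i)))))
        tt : touch (lookup (v ∷ xs)) fz ≡ true
        tt = ∧-intro (allFin-intro (λ j → allFin-intro (cq j))) (∧-intro (allFin-intro fr) (not-false av))

    dom-ff : ∀ t u → tsum t (λ xs → domAt t fz (u ∷ xs)) ≤ ff (# (A u)) t
    dom-ff t u = ≤-trans (tsum-mono t (λ xs → b2n-mono (pt xs))) (≤-trans (≤-reflexive (sym (cl-tuples neq t (A u))))
      (cl-≤-ff neq (λ v → cong not (eqᵇ-refl v)) t (A u)))
      where
      pt : ∀ xs → dom (lookup (u ∷ xs)) fz ≡ true → (pairwise neq xs ∧ allIn (A u) xs) ≡ true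
      pt xs h = ∧-intro (pairwise-intro xs (λ i j ij → ∨-elimʳ {eqᵇ (fs i) (fs j)}
        (distinct-elim (lookup (u ∷ xs)) (proj₂ (∧-true {fullAt (lookup (u ∷ xs)) fz} h)) (fs i) (fs j))
        (eqᵇ-false (λ { refl → ij refl }))))
                        (allIn-intro xs (λ i → fullAt-elim (lookup (u ∷ xs)) fz
                          (proj₁ (∧-true {fullAt (lookup (u ∷ xs)) fz} h)) (fs i)))

  -- For an average `v` this bounds what is destroyed when `N[v]` is turned into a complete
  -- component: the cliques that touch `N[v]` without containing `v` are paid for by the new cliques
  -- among the neighbours of `v`.
  touching-cliques : ∀ t → 3 ≤ t →
    ∑ (λ v → cl A t (full \\ v)) ≤ ∑ (λ v → cl A t (off A v) + ff (# (A v)) t)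
  touching-cliques t 3≤t = ≤-trans (sum-mono (split-touch t))
    (≤-trans (≤-reflexive (sum-+ (λ v → cl A t (off A v)) _))
    (≤-trans (+-monoʳ-≤ (∑ (λ v → cl A t (off A v))) (≤-trans (core t 3≤t) (sum-mono (dom-ff t))))
      (≤-reflexive (sym (sum-+ (λ v → cl A t (off A v)) _)))))

  -- After deletion of `x`, its link in `S` misses `z` as well, so the second term of `ff-pascal` is
  -- not attained.
  nonclique-< : ∀ a S x z → S x ≡ true → S z ≡ true → x ≢ z → A x z ≡ false → 2 + a ≤ # S → cl A (2 + a) S < ff
    (# S) (2 + a)
  nonclique-< a S x z sx sz ne nadj le with # (S \\ x) in e1 | count-∈ S x sx
  ... | d | eqd rewrite eqd = begin-strict
    cl A (2 + a) S ≡⟨ cl-del sA (suc a) S x ⟩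
    cl A (2 + a) (S \\ x) + (2 + a) * (b2n (S x) * cl A (suc a) (S ∩ A x)) ≡⟨ cong
      (λ w → cl A (2 + a) (S \\ x) + (2 + a) * w) (trans (cong (λ w → b2n w * cl A (suc a) (S ∩ A x)) sx)
      (+-identityʳ _)) ⟩
    cl A (2 + a) (S \\ x) + (2 + a) * cl A (suc a) (S ∩ A x) <⟨ +-mono-≤-<
      (≤-trans (cl-≤-ff A (irr sA) (2 + a) (S \\ x)) (≤-reflexive (cong (λ w → ff w (2 + a)) e1)))
        (*-monoʳ-< (2 + a) (≤-<-trans (cl-≤-ff A (irr sA) (suc a) (S ∩ A x)) (ff-< small (s≤s z≤n) (≤-pred le)))) ⟩
    ff d (2 + a) + (2 + a) * ff d (suc a) ≡⟨ sym (ff-pascal d (suc a)) ⟩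
    ff (suc d) (2 + a) ∎
    where
    open ≤-Reasoning
    small : # (S ∩ A x) < d
    small = ≤-trans (s≤s (count-mono sb)) (≤-reflexive (trans (sym (count-∈ (S \\ x) z zin)) e1))
      where
      zin : (S \\ x) z ≡ true
      zin = ∧-intro sz (not-false (eqᵇ-false ne))
      sb : ∀ y → (S ∩ A x) y ≡ true → ((S \\ x) \\ z) y ≡ true
      sb y h with ∧-true {S y} h
      ... | sy , axy = ∧-intro (∧-intro sy (not-false (adj-≠ sA axy)))
            (not-false (¬true (λ w → false≢true nadj (trans (cong (A x) (eqᵇ-true {i = z} w)) axy))))

subset-eq : ∀ {k} (P Q : BSet k) → (∀ x → P x ≡ true → Q x ≡ true) → # Q ≤ # P → ∀ x → Q x ≡ true → P x ≡ true
subset-eq P Q h le x qx with P x in px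
... | true  = refl
... | false = ⊥-elim (<-irrefl refl (≤-trans (≤-trans (≤-reflexive (sym (count-∈ Q x qx))) le) (count-mono sb)))
  where
  sb : ∀ y → P y ≡ true → (Q \\ x) y ≡ true
  sb y py = ∧-intro (h y py) (not-false (eqᵇ-false (λ { refl → false≢true px py })))

sum-tight : ∀ {k} (f g : Fin k → ℕ) → (∀ i → g i ≤ f i) → ∑ f ≤ ∑ g → ∀ i → f i ≤ g i
sum-tight f g h le i = m∸n≡0⇒m≤n (n≤0⇒n≡0 (≤-trans (sum-point (λ j → f j ∸ g j) i) (≤-reflexive e)))
  where
  e : ∑ (λ j → f j ∸ g j) ≡ 0
  e = n≤0⇒n≡0 (+-cancelˡ-≤ (∑ g) _ 0 (≤-trans (≤-reflexive (trans (sym (sum-+ g _))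
    (sum-cong (λ j → m+[n∸m]≡n (h j))))) (≤-trans le (≤-reflexive (sym (+-identityʳ _))))))

MaxDeg : ∀ {k} → Rel₂ k → ℕ → Set
MaxDeg A Δ = ∀ v → # (A v) ≤ Δ

-- for maximum degree Δ: no component is a complete graph on Δ + 1 vertices
NoFull : ∀ {k} → Rel₂ k → ℕ → Set
NoFull A Δ = ∀ v → # (A v) ≡ Δ → ∃ λ x → ∃ λ z → A v x ≡ true × A v z ≡ true × x ≢ z × A x z ≡ false

MaxDeg-⊑ : ∀ {k} {A B : Rel₂ k} {Δ} → B ⊑ A → MaxDeg A Δ → MaxDeg B Δ
MaxDeg-⊑ s md v = ≤-trans (count-mono (s v)) (md v)

-- A vertex that still has degree Δ in the subgraph has kept its whole neighbourhood, since Δ is the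
-- maximum degree; its non-adjacent pair of neighbours survives. So edge deletions never create a
-- component K_{Δ+1}.
NoFull-⊑ : ∀ {k} {A B : Rel₂ k} {Δ} → B ⊑ A → MaxDeg A Δ → NoFull A Δ → NoFull B Δ
NoFull-⊑ {A = A} {B} s md nf v eq with nf v (≤-antisym (md v) (≤-trans (≤-reflexive (sym eq)) (count-mono (s v))))
... | x , z , vx , vz , ne , nadj = x , z , back x vx , back z vz , ne , ¬true (λ h → false≢true nadj (s x z h))
  where
  back = subset-eq (B v) (A v) (s v) (≤-trans (md v) (≤-reflexive (sym eq)))

Clique : ∀ {k} → Rel₂ k → BSet k → Set
Clique A X = ∀ x y → X x ≡ true → X y ≡ true → x ≢ y → A x y ≡ true

N[_,_] : ∀ {k} → Rel₂ k → Fin k → BSet k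
N[ A , v ] x = eqᵇ v x ∨ A v x

#-N[] : ∀ {k} {A : Rel₂ k} → Simple A → ∀ v → # N[ A , v ] ≡ suc (# (A v))
#-N[] {A = A} sA v = trans (count-split N[ A , v ] v)
  (trans (cong₂ _+_ (count-cong q) (cong b2n (cong (_∨ A v v) (eqᵇ-refl v)))) (+-comm (# (A v)) 1))
  where
  q : ∀ x → (N[ A , v ] \\ v) x ≡ A v x
  q x with eqᵇ v x in e
  ... | true = sym (trans (cong (A v) (sym (eqᵇ-true {i = v} e))) (irr sA v))
  ... | false = ∧-identityʳ _

Clique-N[] : ∀ {k} {A : Rel₂ k} → Simple A → ∀ {v} → Clique A (A v) → Clique A N[ A , v ]
Clique-N[] {A = A} sA {v} cq x y px py ne with eqᵇ v x in ex | eqᵇ v y in ey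
... | true | true = ⊥-elim (ne (trans (sym (eqᵇ-true ex)) (eqᵇ-true ey)))
... | true | false = trans (cong (λ z → A z y) (sym (eqᵇ-true ex))) py
... | false | true = trans (symm sA x y) (trans (cong (λ z → A z x) (sym (eqᵇ-true ey))) px)
... | false | false = cq x y px py ne

n₀-off : ∀ (G : Graph) v → NI (adj G) v ≡ true → n₀ (adj (induced G (off (adj G) v))) + suc (# (adj G v)) ≤ n₀ (adj G)
n₀-off G v ni = ≤-trans (+-mono-≤ (count-mono s₁) (≤-trans (≤-reflexive (sym (#-N[] (adj-simple G) v)))
  (count-mono s₂))) (≤-reflexive (sym (count-⊕ (NI A) (off A v))))
  where
  A = adj G
  B = adj (induced G (off A v))
  s₁ : ∀ x → NI B x ≡ true → (NI A ∩ off A v) x ≡ true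
  s₁ x p with NI-elim B p
  ... | y , b with ∧-true {A x y} b
  ... | axy , o = ∧-intro (NI-intro A axy) (proj₁ (∧-true {off A v x} o))
  s₂ : ∀ x → N[ A , v ] x ≡ true → (NI A ∩ (not ∘ off A v)) x ≡ true
  s₂ x p with eqᵇ v x in e
  ... | true = ∧-intro (trans (cong (NI A) (sym (eqᵇ-true {i = v} e))) ni) refl
  ... | false = ∧-intro (NI-intro A {x} {v} (trans (adj-sym G x v) p)) (cong (λ w → not (not w)) p)

module _ (G : Graph) (a : ℕ) where
  private
    A = adj G
    sA = adj-simple G
    κ = cl A (3 + a) full
    d : Fin (n G) → ℕ
    d v = # (A v)
    rest h : Fin (n G) → ℕ
    rest v = cl A (3 + a) (off A v)
    h v = rest v + ff (suc (d v)) (3 + a)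

  -- `h v` is the number of cliques after `N[v]` has been made a complete component. By
  -- `touching-cliques` the sum of `κ` is at most that of `g`, and `g ≤ h` pointwise. If `h` never
  -- exceeds `κ`, all these are equalities at every vertex, and `g v = h v` forces the link of `v`
  -- to have the maximum number of cliques.
  good-vertex : (∃ λ v → NI A v ≡ true × κ < h v) ⊎ (∀ v → κ ≤ h v × ff (d v) (2 + a) ≤ cl A (2 + a) (A v))
  good-vertex with find (λ v → NI A v ∧ (κ <ᵇ h v))
  ... | inj₁ (v , p) with ∧-true {NI A v} p
  ... | q , l = inj₁ (v , q , <ᵇ⇒< _ _ (subst T (sym l) _))
  good-vertex | inj₂ none = inj₂ (λ v → ≤-trans (κ≤g v) (g≤h v) , *-cancelˡ-≤ (3 + a)
    (+-cancelˡ-≤ (rest v + ff (d v) (3 + a)) _ _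
      (≤-trans (≤-reflexive (trans (+-assoc (rest v) _ _) (cong (rest v +_) (sym (ff-pascal (d v) (2 + a))))))
        (≤-trans (h≤κ v) (κ≤g v)))))
    where
    g : Fin (n G) → ℕ
    g v = rest v + ff (d v) (3 + a) + (3 + a) * cl A (2 + a) (A v)
    h≤κ : ∀ v → h v ≤ κ
    h≤κ v with NI A v in e
    ... | true = ≮⇒≥ (λ l → false≢true (none v) (∧-intro e (T→ (<⇒<ᵇ l))))
    -- At an isolated vertex the new component has one vertex and `ff 1 (3 + a)` is 0.
    ... | false rewrite count-zero (A v) (NI-false A e) = ≤-trans (≤-reflexive (+-identityʳ _))
      (cl-mono {A = A} (3 + a) {off A v} {full} (λ _ _ → refl) (λ _ _ p → p))
    g≤h : ∀ v → g v ≤ h v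
    g≤h v = ≤-trans (≤-reflexive (+-assoc (rest v) _ _)) (+-monoʳ-≤ (rest v)
      (≤-trans (+-monoʳ-≤ (ff (d v) (3 + a)) (*-monoʳ-≤ (3 + a) (cl-≤-ff A (irr sA) (2 + a) (A v))))
      (≤-reflexive (sym (ff-pascal (d v) (2 + a))))))
    ∑κ≤∑g : ∑ (λ (v : Fin (n G)) → κ) ≤ ∑ g
    ∑κ≤∑g = begin
      ∑ (λ (v : Fin (n G)) → κ) ≡⟨ sum-cong (λ v → trans (cl-del sA (2 + a) full v)
        (cong (λ w → cl A (3 + a) (full \\ v) + (3 + a) * w) (+-identityʳ (cl A (2 + a) (A v))))) ⟩
      ∑ (λ v → cl A (3 + a) (full \\ v) + (3 + a) * cl A (2 + a) (A v)) ≡⟨ sum-+ (λ v → cl A (3 + a) (full \\ v)) _ ⟩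
      ∑ (λ v → cl A (3 + a) (full \\ v)) + ∑ (λ v → (3 + a) * cl A (2 + a) (A v)) ≤⟨ +-monoˡ-≤ _
        (touching-cliques sA (3 + a) (s≤s (s≤s (s≤s z≤n)))) ⟩
      ∑ (λ v → rest v + ff (d v) (3 + a)) + ∑ (λ v → (3 + a) * cl A (2 + a) (A v)) ≡⟨ sym
        (sum-+ (λ v → rest v + ff (d v) (3 + a)) _) ⟩
      ∑ g ∎
      where open ≤-Reasoning
    κ≤g : ∀ v → κ ≤ g v
    κ≤g = λ v → sum-tight (λ _ → κ) g (λ i → ≤-trans (g≤h i) (h≤κ i)) ∑κ≤∑g v

  -- In the equality case a vertex of degree Δ would have a complete link, against `NoFull`; hence
  -- the given `w` has smaller degree. The final alternative is the source of strictness in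
  -- `few-vertices`.
  good-vertex' : ∀ Δ → 2 + a ≤ Δ → MaxDeg A Δ → NoFull A Δ → ∀ w → NI A w ≡ true →
    ∃ λ v → NI A v ≡ true × κ ≤ h v × (κ < h v ⊎ d v < Δ)
  good-vertex' Δ a≤Δ md nf w niw with good-vertex
  ... | inj₁ (v , ni , l) = v , ni , <⇒≤ l , inj₁ l
  ... | inj₂ all with d w ≟ Δ
  ... | no ne = w , niw , proj₁ (all w) , inj₂ (≤∧≢⇒< (md w) ne)
  ... | yes eq with nf w eq
  ... | x , z , wx , wz , ne , nadj = ⊥-elim (<⇒≱ (nonclique-< sA a (A w) x z wx wz ne nadj
    (≤-trans a≤Δ (≤-reflexive (sym eq)))) (proj₂ (all w)))

-- Chase's theorem (the number of vertices is fixed instead of the number of edges), strict without K_{Δ+1} components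
few-vertices : ∀ fuel a Δ (G : Graph) q r → 2 + a ≤ Δ → MaxDeg (adj G) Δ → NoFull (adj G) Δ →
  n₀ (adj G) ≤ fuel → n₀ (adj G) ≤ suc q * suc Δ + r → r ≤ Δ →
  cl (adj G) (3 + a) full < suc q * ff (suc Δ) (3 + a) + ff r (3 + a)
few-vertices fuel a Δ G q r a≤Δ md nf lf ln r≤Δ with find (NI (adj G))
... | inj₂ none = ≤-<-trans (≤-trans (cl-n₀ (adj-simple G) (suc a))
  (≤-reflexive (cong (λ w → ff w (3 + a)) (count-zero (NI (adj G)) none))))
      (≤-trans (ff-pos (s≤s a≤Δ)) (≤-trans (m≤m+n _ (q * ff (suc Δ) (3 + a))) (m≤m+n _ _)))
... | inj₁ (w , niw) with good-vertex' G a Δ a≤Δ md nf w niw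
few-vertices zero a Δ G q r a≤Δ md nf lf ln r≤Δ | inj₁ (w , niw) | v , ni , _ = ⊥-elim
  (<⇒≱ (count-point (NI (adj G)) v ni) lf)
few-vertices (suc fuel) a Δ G q r a≤Δ md nf lf ln r≤Δ | inj₁ (w , niw) | v , ni , κ≤ , strict = main
  where
  A = adj G
  t = 3 + a
  F = ff (suc Δ) t
  κ = cl A t full
  d = # (A v)
  G' = induced G (off A v)
  A' = adj G'
  nle : n₀ A' + suc d ≤ n₀ A
  nle = n₀-off G v ni
  nf' = NoFull-⊑ {A = A} {A'} (λ x y p → proj₁ (∧-true p)) md nf
  rest = cl A t (off A v)
  κ' : cl A' t full ≡ rest
  κ' = cl-induced G (off A v) (suc a)
  lf' : n₀ A' ≤ fuel
  lf' = ≤-pred (≤-trans (≤-trans (≤-trans (≤-reflexive (+-comm 1 _)) (+-monoʳ-≤ (n₀ A') (s≤s z≤n))) nle) lf)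
  IH : ∀ q r → n₀ A' ≤ suc q * suc Δ + r → r ≤ Δ → rest < suc q * F + ff r t
  IH q r l r≤ = subst (_< suc q * F + ff r t) κ' (few-vertices fuel a Δ G' q r a≤Δ
    (λ u → ≤-trans (count-mono (λ y p → proj₁ (∧-true p))) (md u)) nf' lf' l r≤)
  g = Δ ∸ d
  d+g : d + g ≡ Δ
  d+g = m+[n∸m]≡n (md v)
  main : κ < suc q * F + ff r t
  main with suc d ≤? r
  -- `N[v]` is taken out of the remainder, and the two parts of the remainder are joined again by
  -- `ff-super`.
  ... | yes sd≤r = ≤-<-trans κ≤ (<-≤-trans (+-monoˡ-< (ff (suc d) t)
    (IH q (r ∸ suc d) l (≤-trans (m∸n≤m r (suc d)) r≤Δ)))
        (≤-trans (≤-reflexive (+-assoc (suc q * F) _ _)) (+-monoʳ-≤ (suc q * F)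
          (≤-trans (ff-super (r ∸ suc d) (suc d) (s≤s z≤n)) (≤-reflexive (cong (λ z → ff z t) (m∸n+n≡m sd≤r)))))))
    where
    l : n₀ A' ≤ suc q * suc Δ + (r ∸ suc d)
    l = +-cancelʳ-≤ (suc d) _ _ (≤-trans (≤-trans nle ln) (≤-reflexive
      (trans (cong (suc q * suc Δ +_) (sym (m∸n+n≡m sd≤r))) (sym (+-assoc (suc q * suc Δ) _ _)))))
  -- `N[v]` is larger than the remainder, so a block of `suc Δ` vertices is broken up and the new
  -- remainder is `r + g`. Convexity favours the distribution `r`, `suc Δ` over `r + g`, `suc d`.
  ... | no sd≰r = go q refl
    where
    r≤d : r ≤ d
    r≤d = ≤-pred (≰⇒> sd≰r)
    l : n₀ A' ≤ q * suc Δ + (r + g)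
    l = +-cancelʳ-≤ (suc d) _ _ (≤-trans (≤-trans nle ln) (≤-reflexive
      (trans (cong (λ z → suc z + q * suc Δ + r) (sym d+g)) (arith d g (q * suc Δ) r))))
      where
      arith : ∀ d g x r → suc (d + g) + x + r ≡ x + (r + g) + suc d
      arith = solve-∀
    r+g≤Δ : r + g ≤ Δ
    r+g≤Δ = ≤-trans (+-monoˡ-≤ g r≤d) (≤-reflexive d+g)
    cv : ff (r + g) t + ff (suc d) t ≤ ff r t + F
    cv = subst (λ z → ff (r + g) t + ff (suc d) t ≤ ff r t + ff (suc z) t) d+g (ff-conv t g (≤-trans r≤d (n≤1+n d)))
    go : ∀ q' → q ≡ q' → κ < suc q * F + ff r t
    go (suc q') refl = ≤-<-trans κ≤ (<-≤-trans (+-monoˡ-< (ff (suc d) t) (IH q' (r + g) l r+g≤Δ))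
        (≤-trans (≤-reflexive (+-assoc (suc q' * F) _ _)) (≤-trans (+-monoʳ-≤ (suc q' * F) cv)
          (≤-reflexive (arith (suc q' * F) (ff r t) F)))))
      where
      arith : ∀ x y z → x + (y + z) ≡ z + x + y
      arith = solve-∀
    -- The only block is broken up. For the rest there is merely the trivial bound on `r + g`
    -- vertices, so strictness has to come from the choice of `v`.
    go zero refl = fin strict
      where
      rest≤ : rest ≤ ff (r + g) t
      rest≤ = ≤-trans (≤-trans (≤-reflexive (sym κ')) (cl-n₀ (adj-simple G') (suc a))) (ff-mono t l)
      h≤ : rest + ff (suc d) t ≤ suc zero * F + ff r t
      h≤ = ≤-trans (+-monoˡ-≤ _ rest≤) (≤-trans cv (≤-reflexive (arith F (ff r t))))
        where
        arith : ∀ f x → x + f ≡ (f + 0) + x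
        arith = solve-∀
      fin : (κ < rest + ff (suc d) t ⊎ d < Δ) → κ < suc zero * F + ff r t
      fin (inj₁ s) = <-≤-trans s h≤
      fin (inj₂ d<Δ) = ≤-<-trans κ≤ (≤-<-trans (+-monoˡ-≤ _ rest≤) (<-≤-trans st (≤-reflexive (arith F (ff r t)))))
        where
        arith : ∀ f x → x + f ≡ (f + 0) + x
        arith = solve-∀
        g' = Δ ∸ suc d
        sdg : suc d + g' ≡ Δ
        sdg = m+[n∸m]≡n d<Δ
        g≡ : g ≡ suc g'
        g≡ = +-cancelˡ-≡ d g (suc g') (trans d+g (trans (sym sdg) (sym (+-suc d g'))))
        st : ff (r + g) t + ff (suc d) t < ff r t + F
        st = subst (λ z → ff (r + z) t + ff (suc d) t < ff r t + F) (sym g≡)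
              (subst (λ z → ff (r + suc g') t + ff (suc d) t < ff r t + ff z t)
                (trans (+-suc (suc d) g') (cong suc sdg))
                (ff-conv< (2 + a) g' (s≤s r≤d) (s≤s z≤n) (≤-trans a≤Δ (≤-reflexive (sym sdg)))))

-- Non-edges in neighbourhoods and the final count

2tri-sq : ∀ d → 2 * tri d + d ≡ d * d
2tri-sq zero    = refl
2tri-sq (suc d) = trans (cong (_+ suc d) (2tri d)) (arith d)
  where
  arith : ∀ d → suc d * d + suc d ≡ suc d * suc d
  arith = solve-∀

ff-≤* : ∀ σ ρ a → σ ≤ suc ρ → ff σ (suc a) ≤ σ * ff ρ a
ff-≤* zero    ρ a _ = z≤n
ff-≤* (suc σ) ρ a (s≤s p) = *-monoʳ-≤ (suc σ) (ff-mono a p)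

-- Fill up the colex graph with `p` more edges to a clique on `d` vertices. In each row the added
-- edges gain at least `(2 + a) * ff ρ a` on average: for the rest of the row begun this is `ff-≤*`,
-- and a later row of length `top` gains `(2 + a) * ff top (suc a)` in total.
val-chord : ∀ a r ρ σ d p → r ≤ ρ → σ ≤ ρ → tri (suc ρ) + σ + p ≡ tri d →
  val (suc a) (suc ρ) σ + (2 + a) * (ff r a * p) ≤ ff d (2 + a)
val-chord a r ρ σ d p r≤ρ σ≤ρ eq with suc (suc ρ) ≤? d
... | yes le = subst₂ (λ z p → val (suc a) (suc ρ) σ + (2 + a) * (ff r a * p) ≤ ff z (2 + a)) (m∸n+n≡m le) (sym peq)
  (rows (d ∸ suc (suc ρ)))
  where
  y = ff r a
  V = val (suc a) (suc ρ) σ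
  -- `pj j` is the number of edges missing to a clique on `j + suc (suc ρ)` vertices.
  pj : ℕ → ℕ
  pj zero    = suc ρ ∸ σ
  pj (suc j) = pj j + (j + suc (suc ρ))
  pj-eq : ∀ j → tri (suc ρ) + σ + pj j ≡ tri (j + suc (suc ρ))
  pj-eq zero = trans (+-assoc (tri (suc ρ)) σ _) (trans (cong (tri (suc ρ) +_) (m+[n∸m]≡n (≤-trans σ≤ρ (n≤1+n ρ))))
    (+-comm (tri (suc ρ)) (suc ρ)))
  pj-eq (suc j) = trans (sym (+-assoc (tri (suc ρ) + σ) (pj j) _))
    (trans (cong (_+ (j + suc (suc ρ))) (pj-eq j)) (+-comm (tri (j + suc (suc ρ))) _))
  peq : p ≡ pj (d ∸ suc (suc ρ))
  peq = +-cancelˡ-≡ (tri (suc ρ) + σ) p _ (trans eq (trans (cong tri (sym (m∸n+n≡m le)))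
    (sym (pj-eq (d ∸ suc (suc ρ))))))
  rows : ∀ j → V + (2 + a) * (y * pj j) ≤ ff (j + suc (suc ρ)) (2 + a)
  rows zero = begin
    ff (suc ρ) (2 + a) + (2 + a) * ff σ (suc a) + (2 + a) * (y * (suc ρ ∸ σ)) ≡⟨ arith (ff (suc ρ) (2 + a)) (2 + a)
      (ff σ (suc a)) (y * (suc ρ ∸ σ)) ⟩
    ff (suc ρ) (2 + a) + (2 + a) * (ff σ (suc a) + y * (suc ρ ∸ σ)) ≤⟨ +-monoʳ-≤ (ff (suc ρ) (2 + a))
      (*-monoʳ-≤ (2 + a)
        (+-mono-≤ (ff-≤* σ ρ a (≤-trans σ≤ρ (n≤1+n ρ))) (*-monoˡ-≤ (suc ρ ∸ σ) (ff-mono a r≤ρ)))) ⟩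
    ff (suc ρ) (2 + a) + (2 + a) * (σ * ff ρ a + ff ρ a * (suc ρ ∸ σ)) ≡⟨ cong
      (λ z → ff (suc ρ) (2 + a) + (2 + a) * z) (trans (arith2 σ (ff ρ a) (suc ρ ∸ σ))
      (cong (_* ff ρ a) (m+[n∸m]≡n (≤-trans σ≤ρ (n≤1+n ρ))))) ⟩
    ff (suc ρ) (2 + a) + (2 + a) * ff (suc ρ) (suc a) ≡⟨ sym (ff-pascal (suc ρ) (suc a)) ⟩
    ff (suc (suc ρ)) (2 + a) ∎
    where
    open ≤-Reasoning
    arith : ∀ x a u v → x + a * u + a * v ≡ x + a * (u + v)
    arith = solve-∀
    arith2 : ∀ s f w → s * f + f * w ≡ (s + w) * f
    arith2 = solve-∀
  rows (suc j) = begin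
    V + (2 + a) * (y * (pj j + top)) ≡⟨ arith V (2 + a) y (pj j) top ⟩
    V + (2 + a) * (y * pj j) + (2 + a) * (top * y) ≤⟨ +-mono-≤ (rows j) (*-monoʳ-≤ (2 + a) inc) ⟩
    ff top (2 + a) + (2 + a) * ff top (suc a) ≡⟨ sym (ff-pascal top (suc a)) ⟩
    ff (suc top) (2 + a) ∎
    where
    open ≤-Reasoning
    top = j + suc (suc ρ)
    inc : top * y ≤ ff top (suc a)
    inc rewrite +-suc j (suc ρ) = *-monoʳ-≤ (suc (j + suc ρ))
      (ff-mono a (≤-trans r≤ρ (≤-trans (n≤1+n ρ) (m≤n+m (suc ρ) j))))
    arith : ∀ v a y p j → v + a * (y * (p + j)) ≡ v + a * (y * p) + a * (j * y)
    arith = solve-∀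
-- Here `d ≤ suc ρ`. This leaves `d = suc ρ` with `σ = p = 0`, and, because `tri 0 = tri 1`, the
-- case where `d`, `ρ` and `p` are all 0.
... | no ¬le = small d (≤-pred (≰⇒> ¬le)) eq
  where
  small : ∀ d → d ≤ suc ρ → tri (suc ρ) + σ + p ≡ tri d → val (suc a) (suc ρ) σ + (2 + a) * (ff r a * p) ≤ ff d
    (2 + a)
  small d d≤ e with m≤n⇒m<n∨m≡n d≤
  ... | inj₂ refl = ≤-reflexive (trans (cong₂ (λ u v → ff (suc ρ) (2 + a) + (2 + a) * ff u (suc a) + (2 + a) *
    (ff r a * v)) σ0 p0) (arith (ff (suc ρ) (2 + a)) (2 + a) (ff r a)))
    where
    sp : σ + p ≡ 0
    sp = +-cancelˡ-≡ (tri (suc ρ)) (σ + p) 0 (trans (sym (+-assoc (tri (suc ρ)) σ p)) (trans e (sym (+-identityʳ _))))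
    σ0 = m+n≡0⇒m≡0 σ sp
    p0 = m+n≡0⇒n≡0 σ sp
    arith : ∀ f a y → f + a * 0 + a * (y * 0) ≡ f
    arith = solve-∀
  ... | inj₁ (s≤s d≤ρ) = subst (λ z → val (suc a) (suc ρ) σ + (2 + a) * (ff r a * p) ≤ ff z (2 + a)) (sym d0)
        (≤-reflexive (trans (cong₂ (λ u v → ff (suc u) (2 + a) + (2 + a) * ff σ (suc a) + (2 + a) * (ff r a * v)) ρ0
          p0)
          (trans (cong (λ u → ff 1 (2 + a) + (2 + a) * ff u (suc a) + (2 + a) * (ff r a * 0))
            (n≤0⇒n≡0 (subst (σ ≤_) ρ0 σ≤ρ))) (arith (2 + a) (ff r a)))))
    where
    tot : d + (ρ ∸ d) + p ≡ 0 × d + (ρ ∸ d) ≡ ρ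
    tot = n≤0⇒n≡0 (+-cancelˡ-≤ (tri d) _ 0 (≤-trans (≤-trans
      (≤-reflexive (trans (sym (+-assoc (tri d) _ p)) (cong (_+ p)
      (trans (cong (tri d +_) (m+[n∸m]≡n d≤ρ)) (+-comm (tri d) ρ)))))
            (+-monoˡ-≤ p (≤-trans (+-monoʳ-≤ ρ (tri-mono d≤ρ)) (m≤m+n (tri (suc ρ)) σ))))
              (≤-trans (≤-reflexive e) (≤-reflexive (sym (+-identityʳ _))))))
        , m+[n∸m]≡n d≤ρ
    ρ0 : ρ ≡ 0
    ρ0 = trans (sym (proj₂ tot)) (m+n≡0⇒m≡0 (d + (ρ ∸ d)) (proj₁ tot))
    p0 : p ≡ 0
    p0 = m+n≡0⇒n≡0 (d + (ρ ∸ d)) (proj₁ tot)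
    d0 : d ≡ 0
    d0 = n≤0⇒n≡0 (subst (d ≤_) ρ0 d≤ρ)
    arith : ∀ a y → 0 + a * 0 + a * (y * 0) ≡ 0
    arith = solve-∀

-- Ordered pairs, hence twice the number of non-edges in the link of `u`.
nonadj : ∀ {k} → Rel₂ k → Fin k → ℕ
nonadj A u = ∑ (λ x → b2n (A u x) * # (A u ∩ off A x))

-- The edges leaving the closed neighbourhood of `v`, counted from their inner end, which is never
-- `v` itself.
ends : ∀ {k} → Rel₂ k → Fin k → ℕ
ends A v = ∑ (λ x → b2n (A v x) * # (A x ∩ off A v))

count-off : ∀ {k} {A : Rel₂ k} → Simple A → ∀ S x → # S ≡ # (S ∩ A x) + # (S ∩ off A x) + b2n (S x)
count-off {A = A} sA S x = trans (count-split S x) (cong (_+ b2n (S x))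
  (trans (count-⊕ (S \\ x) (A x)) (cong₂ _+_ (count-cong q₁) (count-cong q₂))))
  where
  q₁ : ∀ y → (S y ∧ not (eqᵇ x y)) ∧ A x y ≡ S y ∧ A x y
  q₁ y with eqᵇ x y in e
  ... | false = cong (_∧ A x y) (∧-identityʳ (S y))
  ... | true rewrite trans (cong (A x) (sym (eqᵇ-true {i = x} e))) (irr sA x) = trans (∧-zeroʳ _)
    (sym (∧-zeroʳ (S y)))
  q₂ : ∀ y → (S y ∧ not (eqᵇ x y)) ∧ not (A x y) ≡ S y ∧ (not (eqᵇ x y) ∧ not (A x y))
  q₂ y with S y
  ... | true  = refl
  ... | false = refl

nonadj-eq : ∀ {k} {A : Rel₂ k} → Simple A → ∀ u → cl A 2 (A u) + nonadj A u ≡ 2 * tri (# (A u))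
nonadj-eq {A = A} sA u = +-cancelʳ-≡ d _ _ (begin
  cl A 2 (A u) + nonadj A u + d ≡⟨ cong₂ _+_ (sym (sum-+ (λ x → b2n (A u x) * cl A 1 (A u ∩ A x)) _))
    (count-sum (A u)) ⟩
  ∑ (λ x → b2n (A u x) * cl A 1 (A u ∩ A x) + b2n (A u x) * # (A u ∩ off A x)) + ∑ (λ x → b2n (A u x)) ≡⟨ sym
    (sum-+ (λ x → b2n (A u x) * cl A 1 (A u ∩ A x) + b2n (A u x) * # (A u ∩ off A x)) _) ⟩
  ∑ (λ x → b2n (A u x) * cl A 1 (A u ∩ A x) + b2n (A u x) * # (A u ∩ off A x) + b2n (A u x)) ≡⟨ sum-cong pt ⟩
  ∑ (λ x → b2n (A u x) * d) ≡⟨ trans (sum-*ʳ d (λ x → b2n (A u x))) (cong (_* d) (sym (count-sum (A u)))) ⟩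
  d * d ≡⟨ sym (2tri-sq d) ⟩
  2 * tri d + d ∎)
  where
  open ≡-Reasoning
  d = # (A u)
  pt : ∀ x → b2n (A u x) * cl A 1 (A u ∩ A x) + b2n (A u x) * # (A u ∩ off A x) + b2n (A u x) ≡ b2n (A u x) * d
  pt x with A u x in e
  ... | false = refl
  ... | true = trans (cong₂ (λ p q → p + q + 1) (trans (+-identityʳ _) (cl-1 A _)) (+-identityʳ _))
        (trans (sym (trans (count-off sA (A u) x) (cong (λ w → # (A u ∩ A x) + # (A u ∩ off A x) + b2n w) e)))
          (sym (+-identityʳ _)))

-- Both sides count paths v, x, y with v and y distinct and non-adjacent, once by the end v and once
-- by the middle x.
sum-ends : ∀ {k} {A : Rel₂ k} → Simple A → ∑ (ends A) ≡ ∑ (nonadj A)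
sum-ends {A = A} sA = trans (sum-swap (λ v x → b2n (A v x) * # (A x ∩ off A v)))
  (sum-cong (λ x → sum-cong (λ v → cong (λ z → b2n z * # (A x ∩ off A v)) (symm sA v x))))

closed : ∀ {k} → Rel₂ k → Fin k → BSet k
closed A v x = not (off A v x)

not-not : ∀ b → not (not b) ≡ b
not-not true  = refl
not-not false = refl

cutE-closed : ∀ {k} {A : Rel₂ k} → Simple A → ∀ v → cutE A (closed A v) ≡ ends A v
cutE-closed {A = A} sA v = sum-cong pt
  where
  pt : ∀ x → # (cross A (closed A v) x) ≡ b2n (A v x) * # (A x ∩ off A v)
  pt x with A v x in e | eqᵇ v x in e'
  ... | true | true  = trans (count-cong q) (sym (+-identityʳ _))
    where
    q : ∀ y → A x y ∧ not (not (off A v y)) ≡ A x y ∧ off A v y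
    q y rewrite not-not (off A v y) = refl
  ... | true | false = trans (count-cong q) (sym (+-identityʳ _))
    where
    q : ∀ y → A x y ∧ not (not (off A v y)) ≡ A x y ∧ off A v y
    q y rewrite not-not (off A v y) = refl
  ... | false | false = count-zero _ (λ _ → refl)
  ... | false | true with eqᵇ-true {i = v} e'
  ... | refl = count-zero _ q
    where
    q : ∀ y → A v y ∧ not (not (off A v y)) ≡ false
    q y with A v y
    ... | false = refl
    ... | true rewrite ∧-zeroʳ (not (eqᵇ v y)) = refl

-- Kruskal-Katona bounds the link by a colex graph with as many edges. The hypothesis forces `ρ ≥ r`
-- in that graph, so by `val-chord` every edge missing in the link costs at least
-- `(2 + a) * ff r a`. The factors 2 come from the ordered pairs in `nonadj`.
link-bound : ∀ (G : Graph) a r v → ff (suc r) (2 + a) < cl (adj G) (2 + a) (adj G v) →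
  2 * cl (adj G) (2 + a) (adj G v) + (2 + a) * ff r a * nonadj (adj G) v ≤ 2 * ff (# (adj G v)) (2 + a)
link-bound G a r v lt with rep (edges (induced G (adj G v)))
... | ρ , σ , σ≤ρ , eq = begin
  2 * τ + (2 + a) * ff r a * P ≡⟨ cong (λ z → 2 * τ + (2 + a) * ff r a * z) P≡ ⟩
  2 * τ + (2 + a) * ff r a * (2 * p) ≡⟨ arith τ (2 + a) (ff r a) p ⟩
  2 * (τ + (2 + a) * (ff r a * p)) ≤⟨ *-monoʳ-≤ 2 (+-monoˡ-≤ _ τ≤) ⟩
  2 * (val (suc a) (suc ρ) σ + (2 + a) * (ff r a * p)) ≤⟨ *-monoʳ-≤ 2 (val-chord a r ρ σ d p r≤ρ σ≤ρ psum) ⟩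
  2 * ff d (2 + a) ∎
  where
  open ≤-Reasoning
  A = adj G
  d = # (A v)
  τ = cl A (2 + a) (A v)
  P = nonadj A v
  H = induced G (A v)
  e₂ : cl A 2 (A v) ≡ 2 * (tri (suc ρ) + σ)
  e₂ = trans (sym (degSum-induced G (A v))) (trans (handshake H) (cong (2 *_) eq))
  τ≤ : τ ≤ val (suc a) (suc ρ) σ
  τ≤ = subst (_≤ val (suc a) (suc ρ) σ) (cl-induced G (A v) a)
    (kruskal-katona (tri (suc ρ) + σ) a H ρ σ (trans (degSum-induced G (A v)) e₂) σ≤ρ ≤-refl)
  r≤ρ : r ≤ ρ
  r≤ρ = ≮⇒≥ (λ ρ<r → <⇒≱ lt (≤-trans τ≤ (≤-trans (+-monoʳ-≤ (ff (suc ρ) (2 + a))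
    (*-monoʳ-≤ (2 + a) (ff-mono (suc a) (≤-trans σ≤ρ (n≤1+n ρ)))))
          (≤-trans (≤-reflexive (val-row (suc a) (suc ρ))) (ff-mono (2 + a) (s≤s ρ<r))))))
  e≤ : tri (suc ρ) + σ ≤ tri d
  e≤ = *-cancelˡ-≤ 2 (≤-trans (≤-reflexive (sym e₂)) (≤-trans (m≤m+n _ P) (≤-reflexive (nonadj-eq (adj-simple G) v))))
  p = tri d ∸ (tri (suc ρ) + σ)
  psum : tri (suc ρ) + σ + p ≡ tri d
  psum = m+[n∸m]≡n e≤
  P≡ : P ≡ 2 * p
  P≡ = +-cancelˡ-≡ (2 * (tri (suc ρ) + σ)) P (2 * p) (trans (cong (_+ P) (sym e₂))
    (trans (nonadj-eq (adj-simple G) v) (trans (cong (2 *_) (sym psum)) (*-distribˡ-+ 2 (tri (suc ρ) + σ) p))))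
  arith : ∀ t a y p → 2 * t + a * y * (2 * p) ≡ 2 * (t + a * (y * p))
  arith = solve-∀

ff-up : ∀ k x j → ff x (suc k) + j * (suc k * ff x k) ≤ ff (x + j) (suc k)
ff-up k x zero rewrite +-identityʳ x = ≤-reflexive (+-identityʳ _)
ff-up k x (suc j) rewrite +-suc x j | ff-pascal (x + j) k =
  ≤-trans (≤-reflexive (arith (ff x (suc k)) (suc k * ff x k) j))
    (+-mono-≤ (ff-up k x j) (*-monoʳ-≤ (suc k) (ff-mono k (m≤m+n x j))))
  where
  arith : ∀ f w j → f + suc j * w ≡ f + j * w + w
  arith = solve-∀

ff-low : ∀ k x i z → x + i ≤ suc z → ff (x + i) (suc k) ≤ ff x (suc k) + i * (suc k * ff z k)
ff-low k x zero z _ rewrite +-identityʳ x = m≤m+n _ _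
ff-low k x (suc i) z le rewrite +-suc x i | ff-pascal (x + i) k =
  ≤-trans (+-mono-≤ (ff-low k x i z (≤-trans (n≤1+n _) le)) (*-monoʳ-≤ (suc k) (ff-mono k (≤-pred le))))
    (≤-reflexive (arith (ff x (suc k)) (suc k * ff z k) i))
  where
  arith : ∀ f w i → f + i * w + w ≡ f + suc i * w
  arith = solve-∀

-- Both differences are compared with the slope `I` at the inner point `r + i`: on the left the
-- increments are at most `I` (`ff-low`), on the right at least `I` (`ff-up`).
ff-chord : ∀ k r i j → (i + j) * ff (r + i) (suc k) ≤ j * ff r (suc k) + i * ff (r + i + j) (suc k)
ff-chord k r i j = +-cancelʳ-≤ (i * (j * I)) _ _ (begin
  (i + j) * f + i * (j * I) ≡⟨ arith₁ i j f I ⟩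
  j * f + i * (f + j * I) ≤⟨ +-mono-≤ (*-monoʳ-≤ j (ff-low k r i (r + i) (n≤1+n _)))
    (*-monoʳ-≤ i (ff-up k (r + i) j)) ⟩
  j * (ff r (suc k) + i * I) + i * ff (r + i + j) (suc k) ≡⟨ arith₂ i j (ff r (suc k)) I (ff (r + i + j) (suc k)) ⟩
  j * ff r (suc k) + i * ff (r + i + j) (suc k) + i * (j * I) ∎)
  where
  open ≤-Reasoning
  f = ff (r + i) (suc k)
  I = suc k * ff (r + i) k
  arith₁ : ∀ i j f w → (i + j) * f + i * (j * w) ≡ j * f + i * (f + j * w)
  arith₁ = solve-∀
  arith₂ : ∀ i j f w h → j * (f + i * w) + i * h ≡ j * f + i * h + i * (j * w)
  arith₂ = solve-∀

-- the previous inequality with all terms moved so that no subtraction occurs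
ff-chord' : ∀ k r g d → r ≤ d → d ≤ r + g →
  g * ff d (suc k) + d * ff r (suc k) + r * ff (r + g) (suc k) ≤ (r + g) * ff r (suc k) + d * ff (r + g) (suc k)
ff-chord' k r g d r≤d d≤ with m≤n⇒∃[o]m+o≡n r≤d
... | i , refl with m≤n⇒∃[o]m+o≡n (+-cancelˡ-≤ r i g d≤)
... | j , refl rewrite sym (+-assoc r i j) =
  ≤-trans (+-monoˡ-≤ _ (+-monoˡ-≤ _ (ff-chord k r i j))) (≤-reflexive
    (arith r i j (ff r (suc k)) (ff (r + i + j) (suc k))))
  where
  arith : ∀ r i j x y → j * x + i * y + (r + i) * x + r * y ≡ (r + i + j) * x + (r + i) * y
  arith = solve-∀

-- `ff-chord'` at every non-isolated vertex, between the degrees `r` and `r + g`. Isolated vertices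
-- add 0 to both sides, so `n₀` takes the place of the number of all vertices.
degree-chord : ∀ {n} {A : Rel₂ n} → ∀ k r g → MaxDeg A (r + g) → (∀ v → NI A v ≡ true → r ≤ # (A v)) →
  g * ∑ (λ v → ff (# (A v)) (suc k)) + degSum A * ff r (suc k) + n₀ A * (r * ff (r + g) (suc k))
    ≤ n₀ A * ((r + g) * ff r (suc k)) + degSum A * ff (r + g) (suc k)
degree-chord {n} {A} k r g md mn = begin
  g * ∑ (λ v → ff (d v) (suc k)) + degSum A * X + n₀ A * (r * Y) ≡⟨ cong₂ _+_
    (cong₂ _+_ (sym (sum-*ˡ g (λ v → ff (d v) (suc k)))) (sym (sum-*ʳ X d)))
    (trans (cong (_* (r * Y)) (count-sum (NI A))) (sym (sum-*ʳ (r * Y) ni))) ⟩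
  ∑ (λ v → g * ff (d v) (suc k)) + ∑ (λ v → d v * X) + ∑ (λ v → ni v * (r * Y)) ≡⟨ trans
    (cong (_+ ∑ (λ v → ni v * (r * Y))) (sym (sum-+ (λ v → g * ff (d v) (suc k)) _)))
    (sym (sum-+ (λ v → g * ff (d v) (suc k) + d v * X) _)) ⟩
  ∑ (λ v → g * ff (d v) (suc k) + d v * X + ni v * (r * Y)) ≤⟨ sum-mono pt ⟩
  ∑ (λ v → ni v * ((r + g) * X) + d v * Y) ≡⟨ sum-+ (λ v → ni v * ((r + g) * X)) _ ⟩
  ∑ (λ v → ni v * ((r + g) * X)) + ∑ (λ v → d v * Y) ≡⟨ cong₂ _+_
    (trans (sum-*ʳ ((r + g) * X) ni) (cong (_* ((r + g) * X)) (sym (count-sum (NI A))))) (sum-*ʳ Y d) ⟩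
  n₀ A * ((r + g) * X) + degSum A * Y ∎
  where
  open ≤-Reasoning
  X = ff r (suc k)
  Y = ff (r + g) (suc k)
  d ni : Fin n → ℕ
  d v = # (A v)
  ni v = b2n (NI A v)
  pt : ∀ v → g * ff (d v) (suc k) + d v * X + ni v * (r * Y) ≤ ni v * ((r + g) * X) + d v * Y
  pt v with NI A v in e
  ... | false rewrite count-zero (A v) (NI-false A e) = ≤-reflexive
    (trans (+-identityʳ _) (trans (+-identityʳ _) (*-zeroʳ g)))
  ... | true = ≤-trans (≤-reflexive (cong (g * ff (d v) (suc k) + d v * X +_) (+-identityʳ (r * Y))))
    (≤-trans (ff-chord' k r g (d v) (mn v e) (md v)) (≤-reflexive (cong (_+ d v * Y) (sym (+-identityʳ _)))))

-- X = ff r, Y = ff Δ, Δ = r + g, S = g · Σ ff (degree), M = Σ degree, and there are q (Δ + 1) + r + 1 + e vertices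
balance : ∀ S M q r s w g e X Y → s + w ≡ r → M ≡ q * (suc (r + g) * (r + g)) + 2 * (tri r + s) →
  (r + g) * X ≤ r * Y →
  S + M * X + (q * suc (r + g) + suc r + e) * (r * Y) ≤ (q * suc (r + g) + suc r + e) * ((r + g) * X) + M * Y →
  S + 2 * w * Y ≤ g * (suc r * X + q * (suc (r + g) * Y)) + 2 * w * X
balance S M q r s w g e X Y sw eqM mono h = +-cancelʳ-≤ (M' * X + n₁ * (r * Y) + e * (r * Y)) _ _ (begin
  S + 2 * w * Y + (M' * X + n₁ * (r * Y) + e * (r * Y)) ≡⟨ cong
    (λ z → S + 2 * w * Y + (z * X + n₁ * (r * Y) + e * (r * Y))) (sym M+) ⟩
  S + 2 * w * Y + ((M + 2 * w) * X + n₁ * (r * Y) + e * (r * Y)) ≡⟨ arith₁ S w X Y M n₁ e (r * Y) ⟩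
  S + M * X + (n₁ + e) * (r * Y) + (2 * w * X + 2 * w * Y) ≤⟨ +-monoˡ-≤ _ h ⟩
  (n₁ + e) * ((r + g) * X) + M * Y + (2 * w * X + 2 * w * Y) ≡⟨ arith₂ w X Y M n₁ e ((r + g) * X) ⟩
  n₁ * ((r + g) * X) + (M + 2 * w) * Y + 2 * w * X + e * ((r + g) * X) ≤⟨ +-monoʳ-≤
    (n₁ * ((r + g) * X) + (M + 2 * w) * Y + 2 * w * X) (*-monoʳ-≤ e mono) ⟩
  n₁ * ((r + g) * X) + (M + 2 * w) * Y + 2 * w * X + e * (r * Y) ≡⟨ cong
    (λ z → n₁ * ((r + g) * X) + z * Y + 2 * w * X + e * (r * Y)) M+ ⟩
  n₁ * ((r + g) * X) + M' * Y + 2 * w * X + e * (r * Y) ≡⟨ arith₃ q r g w e X Y ⟩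
  g * (suc r * X + q * (suc (r + g) * Y)) + 2 * w * X + (M' * X + n₁ * (r * Y) + e * (r * Y)) ∎)
  where
  open ≤-Reasoning
  -- The vertex number and the degree sum of `q` copies of K_{Δ+1} with one K_{r+1}, on which the
  -- chord is exact; the actual degree sum is smaller by `2 * w`.
  n₁ = q * suc (r + g) + suc r
  M' = q * (suc (r + g) * (r + g)) + (r * r + r)
  M+ : M + 2 * w ≡ M'
  M+ = trans (cong (_+ 2 * w) eqM) (trans (ar (q * (suc (r + g) * (r + g))) (tri r) s w)
    (cong (q * (suc (r + g) * (r + g)) +_) (trans (cong (λ z → 2 * tri r + 2 * z) sw)
    (trans (ar2 (tri r) r) (cong (_+ r) (2tri-sq r))))))
    where
    ar : ∀ x t s w → x + 2 * (t + s) + 2 * w ≡ x + (2 * t + 2 * (s + w))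
    ar = solve-∀
    ar2 : ∀ t r → 2 * t + 2 * r ≡ 2 * t + r + r
    ar2 = solve-∀
  arith₁ : ∀ S w X Y M n e z → S + 2 * w * Y + ((M + 2 * w) * X + n * z + e * z) ≡ S + M * X + (n + e) * z +
    (2 * w * X + 2 * w * Y)
  arith₁ = solve-∀
  arith₂ : ∀ w X Y M n e z → (n + e) * z + M * Y + (2 * w * X + 2 * w * Y) ≡ n * z + (M + 2 * w) * Y + 2 * w * X + e
    * z
  arith₂ = solve-∀
  arith₃ : ∀ q r g w e X Y → (q * suc (r + g) + suc r) * ((r + g) * X) + (q * (suc (r + g) * (r + g)) + (r * r + r))
    * Y + 2 * w * X + e * (r * Y)
    ≡ g * (suc r * X + q * (suc (r + g) * Y)) + 2 * w * X + ((q * (suc (r + g) * (r + g)) + (r * r + r)) * X +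
      (q * suc (r + g) + suc r) * (r * Y) + e * (r * Y))
  arith₃ = solve-∀

-- The quotient of `ff x (suc k)` by `x` is `ff (x - 1) k`, which increases with `x`. In `balance`
-- this makes the surplus of `e` vertices harmless.
ff-ratio : ∀ k r g → (r + g) * ff r (suc k) ≤ r * ff (r + g) (suc k)
ff-ratio k zero    g = ≤-reflexive (*-zeroʳ g)
ff-ratio k (suc r) g = ≤-trans (≤-reflexive (arith (suc r + g) (suc r) (ff r k)))
  (*-monoʳ-≤ (suc r) (*-monoʳ-≤ (suc r + g) (ff-mono k (m≤m+n r g))))
  where
  arith : ∀ d r f → d * (r * f) ≡ r * (d * f)
  arith = solve-∀

-- With clique size `2 + r`, the savings on the right come from the non-adjacent pairs and from the
-- `w` missing edges; the last term is the contribution of the last row. If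
-- `suc r < 2 * (2 + a) * (1 + w)`, the two savings suffice. Otherwise `w` is so small that `ff s`
-- is close to `ff (2 + r)`, and the first saving covers the difference.
key-number : ∀ a r s w → s + w ≡ 2 + r → a ≤ r →
  (3 + a) * ff (2 + r) (2 + a) < (2 + a) * ff r a * ((2 + r) * (3 + r)) + 2 * (w * ((2 + a) * ff (2 + r) (suc a))) +
    (3 + a) * ff s (2 + a)
key-number a r s w sw a≤r with suc r <? 2 * (2 + a) + 2 * (w * (2 + a))
... | yes lt = ≤-trans (begin-strict
  (3 + a) * (R * (suc r * y)) ≡⟨ ar₁ a r y ⟩
  ((2 + a) * suc r + suc r) * (R * y) <⟨ *-monoˡ-< (R * y) {{>-nonZero pos}} (+-monoʳ-< ((2 + a) * suc r) lt) ⟩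
  ((2 + a) * suc r + (2 * (2 + a) + 2 * (w * (2 + a)))) * (R * y) ≡⟨ ar₂ a r w y ⟩
  (2 + a) * y * (R * (3 + r)) + 2 * (w * ((2 + a) * (R * y))) ≤⟨ +-monoʳ-≤ ((2 + a) * y * (R * (3 + r)))
    (*-monoʳ-≤ 2 (*-monoʳ-≤ w (*-monoʳ-≤ (2 + a) (*-monoʳ-≤ R (ff-suc-mono r a))))) ⟩
  (2 + a) * y * (R * (3 + r)) + 2 * (w * ((2 + a) * ff R (suc a))) ∎) (m≤m+n _ _)
  where
  open ≤-Reasoning
  R = 2 + r
  y = ff r a
  pos : 0 < R * y
  pos = ≤-trans (ff-pos a≤r) (m≤m+n y _)
  ar₁ : ∀ a r y → (3 + a) * ((2 + r) * (suc r * y)) ≡ ((2 + a) * suc r + suc r) * ((2 + r) * y)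
  ar₁ = solve-∀
  ar₂ : ∀ a r w y → ((2 + a) * suc r + (2 * (2 + a) + 2 * (w * (2 + a)))) * ((2 + r) * y) ≡ (2 + a) * y *
    ((2 + r) * (3 + r)) + 2 * (w * ((2 + a) * ((2 + r) * y)))
  ar₂ = solve-∀
... | no ¬lt = begin-strict
  (3 + a) * ff (2 + r) (2 + a) ≤⟨ *-monoʳ-≤ (3 + a) (≤-trans (≤-reflexive (cong (λ z → ff z (2 + a)) (sym sw)))
    (ff-low (suc a) s w (suc r) (≤-reflexive sw))) ⟩
  (3 + a) * (ff s (2 + a) + w * ((2 + a) * (suc r * y))) ≡⟨ ar₁ a r w y (ff s (2 + a)) ⟩
  (3 + a) * w * suc r * ((2 + a) * y) + (3 + a) * ff s (2 + a) <⟨ +-monoˡ-< _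
    (*-monoˡ-< ((2 + a) * y) {{>-nonZero pos}} small) ⟩
  (2 + r) * (3 + r) * ((2 + a) * y) + (3 + a) * ff s (2 + a) ≡⟨ cong (_+ (3 + a) * ff s (2 + a))
    (*-comm ((2 + r) * (3 + r)) ((2 + a) * y)) ⟩
  (2 + a) * y * ((2 + r) * (3 + r)) + (3 + a) * ff s (2 + a) ≤⟨ +-monoˡ-≤ ((3 + a) * ff s (2 + a))
    (m≤m+n ((2 + a) * y * ((2 + r) * (3 + r))) (2 * (w * ((2 + a) * ff (2 + r) (suc a))))) ⟩
  (2 + a) * y * ((2 + r) * (3 + r)) + 2 * (w * ((2 + a) * ff (2 + r) (suc a))) + (3 + a) * ff s (2 + a) ∎
  where
  open ≤-Reasoning
  y = ff r a
  pos : 0 < (2 + a) * y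
  pos = ≤-trans (ff-pos a≤r) (m≤m+n y _)
  tw : (3 + a) * w ≤ suc r
  tw = ≤-trans (≤-trans (≤-trans (≤-trans (m≤m+n ((3 + a) * w) (suc a * w)) (≤-reflexive (ar₃ a w)))
    (m≤n+m (2 * (w * (2 + a))) (2 * (2 + a)))) (≮⇒≥ ¬lt)) ≤-refl
    where
    ar₃ : ∀ a w → (3 + a) * w + suc a * w ≡ 2 * (w * (2 + a))
    ar₃ = solve-∀
  small : (3 + a) * w * suc r < (2 + r) * (3 + r)
  small = ≤-<-trans (*-monoˡ-≤ (suc r) tw) (≤-<-trans (*-monoˡ-≤ (suc r) (n≤1+n (suc r)))
    (*-monoʳ-< (2 + r) (s≤s (n≤1+n (suc r)))))
  ar₁ : ∀ a r w y f → (3 + a) * (f + w * ((2 + a) * (suc r * y))) ≡ (3 + a) * w * suc r * ((2 + a) * y) + (3 + a) * f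
  ar₁ = solve-∀

-- `κ` is the sum of the link counts `τ`. For `r < 2 + a` the value `X` vanishes and the term
-- `2 * w * Y` in `bal` already makes the estimate strict. Otherwise `link-bound` is summed as well,
-- and `key-number` closes the gap between the clique sizes `r` and `suc r`.
final-count : ∀ (G : Graph) a q r s w g → s + w ≡ r → 1 ≤ w → 1 ≤ g → 2 + a ≤ r + g →
  MaxDeg (adj G) (r + g) → degSum (adj G) ≡ suc q * (suc (r + g) * (r + g)) + 2 * (tri r + s) →
  (∀ v → NI (adj G) v ≡ true → r ≤ # (adj G v)) →
  suc q * suc (r + g) + suc r ≤ n₀ (adj G) →
  (r < 2 + a ⊎ (∃ λ r₂ → r ≡ 2 + r₂ × a ≤ r₂ × (∀ v → NI (adj G) v ≡ true → ff (suc r₂) (2 + a) < cl (adj G) (2 + a)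
    (adj G v))
      × (∀ v → NI (adj G) v ≡ true → r ≤ ends (adj G) v))) →
  cl (adj G) (3 + a) full < suc q * ff (suc (r + g)) (3 + a) + val (2 + a) r s
final-count G a q r s w g sw 1≤w 1≤g a≤Δ md eqM mn ln extra = go extra
  where
  A = adj G
  Δ = r + g
  t = 3 + a
  X = ff r (2 + a)
  Y = ff Δ (2 + a)
  κ = cl A t full
  τ : Fin (n G) → ℕ
  τ v = cl A (2 + a) (A v)
  Σf = ∑ (λ v → ff (# (A v)) (2 + a))
  κ≡ : κ ≡ ∑ τ
  κ≡ = sum-cong (λ v → +-identityʳ (τ v))
  κ≤Σ : κ ≤ Σf
  κ≤Σ = ≤-trans (≤-reflexive κ≡) (sum-mono (λ v → cl-≤-ff A (adj-irrefl G) (2 + a) (A v)))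
  bal : g * Σf + 2 * w * Y ≤ g * (suc r * X + suc q * (suc Δ * Y)) + 2 * w * X
  bal with m≤n⇒∃[o]m+o≡n ln
  ... | e , eqn = balance (g * Σf) (degSum A) (suc q) r s w g e X Y sw eqM (ff-ratio (suc a) r g)
        (subst (λ z → g * Σf + degSum A * X + z * (r * Y) ≤ z * (Δ * X) + degSum A * Y) (sym eqn)
          (degree-chord (suc a) r g md mn))
  QF = suc q * ff (suc Δ) t
  go : _ → κ < QF + val (2 + a) r s
  go (inj₁ r<) = ≤-<-trans κ≤Σ (<-≤-trans st (m≤m+n QF _))
    where
    X0 : X ≡ 0
    X0 = ff-zero r<
    st : Σf < QF
    st = *-cancelˡ-< g Σf QF (<-≤-trans (≤-trans (≤-reflexive (+-comm 1 _))
      (+-monoʳ-≤ (g * Σf) (≤-trans (*-mono-≤ {1} {2 * w} (≤-trans 1≤w (m≤m+n w _)) (ff-pos a≤Δ)) ≤-refl)))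
        (≤-trans bal (≤-reflexive (trans (cong (λ x → g * (suc r * x + suc q * (suc Δ * Y)) + 2 * w * x) X0)
          (ar g (suc r) QF (2 * w))))))
      where
      ar : ∀ g r f w → g * (r * 0 + f) + w * 0 ≡ g * f
      ar = solve-∀
  go (inj₂ (r₂ , refl , a≤r₂ , tb , eb)) = *-cancelˡ-< 2 κ _ (+-cancelʳ-< (2 * (t * X)) _ _ (begin-strict
    2 * κ + 2 * (t * X) <⟨ +-monoʳ-< (2 * κ) (*-monoʳ-< 2 (key-number a r₂ s w sw a≤r₂)) ⟩
    2 * κ + 2 * (c * (r * suc r) + 2 * (w * I) + t * ff s (2 + a)) ≡⟨ ar₁ κ c (r * suc r) w I (t * ff s (2 + a)) ⟩
    2 * κ + c * (2 * (r * suc r)) + 2 * (2 * w * I) + 2 * (t * ff s (2 + a)) ≤⟨ +-monoˡ-≤ _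
      (+-monoˡ-≤ _ (≤-trans (+-monoʳ-≤ (2 * κ) (*-monoʳ-≤ c Pge)) Ksum)) ⟩
    2 * Σf + 2 * (2 * w * I) + 2 * (t * ff s (2 + a)) ≡⟨ cong (_+ 2 * (t * ff s (2 + a)))
      (sym (*-distribˡ-+ 2 Σf _)) ⟩
    2 * (Σf + 2 * w * I) + 2 * (t * ff s (2 + a)) ≤⟨ +-monoˡ-≤ _ (*-monoʳ-≤ 2 Σf≤) ⟩
    2 * (ff (suc r) t + QF) + 2 * (t * ff s (2 + a)) ≡⟨ cong (λ z → 2 * (z + QF) + 2 * (t * ff s (2 + a)))
      (ff-pascal r (2 + a)) ⟩
    2 * (ff r t + t * X + QF) + 2 * (t * ff s (2 + a)) ≡⟨ ar₂ (ff r t) (t * X) QF (t * ff s (2 + a)) ⟩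
    2 * (QF + val (2 + a) r s) + 2 * (t * X) ∎))
    where
    open ≤-Reasoning
    c = (2 + a) * ff r₂ a
    I = (2 + a) * ff r (suc a)
    ar₁ : ∀ k c r w i f → 2 * k + 2 * (c * r + 2 * (w * i) + f) ≡ 2 * k + c * (2 * r) + 2 * (2 * w * i) + 2 * f
    ar₁ = solve-∀
    ar₂ : ∀ f x q s → 2 * (f + x + q) + 2 * s ≡ 2 * (q + (f + s)) + 2 * x
    ar₂ = solve-∀
    -- At least one block of `suc Δ ≥ suc r` vertices is counted in `ln`, besides the further
    -- `suc r`, so there are at least `2 * suc r` non-isolated vertices, each with `r` edges leaving
    -- its closed neighbourhood.
    Pge : 2 * (r * suc r) ≤ ∑ (nonadj A)
    Pge = ≤-trans (≤-reflexive (ar r)) (≤-trans (*-monoˡ-≤ r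
      (≤-trans (≤-trans (+-monoˡ-≤ (suc r) (≤-trans (s≤s (m≤m+n r g)) (m≤m+n (suc Δ) (q * suc Δ)))) ln) ≤-refl))
        (≤-trans (sum-set-≤ (NI A) (ends A) r eb) (≤-reflexive (sum-ends (adj-simple G)))))
      where
      ar : ∀ r → 2 * (r * suc r) ≡ (suc r + suc r) * r
      ar = solve-∀
    Ksum : 2 * κ + c * ∑ (nonadj A) ≤ 2 * Σf
    Ksum = begin
      2 * κ + c * ∑ (nonadj A) ≡⟨ cong₂ _+_ (trans (cong (2 *_) κ≡) (sym (sum-*ˡ 2 τ))) (sym (sum-*ˡ c (nonadj A))) ⟩
      ∑ (λ v → 2 * τ v) + ∑ (λ v → c * nonadj A v) ≡⟨ sym (sum-+ (λ v → 2 * τ v) _) ⟩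
      ∑ (λ v → 2 * τ v + c * nonadj A v) ≤⟨ sum-mono pt ⟩
      ∑ (λ v → 2 * ff (# (A v)) (2 + a)) ≡⟨ sum-*ˡ 2 (λ v → ff (# (A v)) (2 + a)) ⟩
      2 * Σf ∎
      where
      pt : ∀ v → 2 * τ v + c * nonadj A v ≤ 2 * ff (# (A v)) (2 + a)
      pt v with NI A v in e
      ... | true = link-bound G a r₂ v (tb v e)
      ... | false = ≤-trans (≤-reflexive (trans (cong₂ (λ x y → 2 * x + c * y)
        (cl-empty A (suc a) (A v) (NI-false A e)) (sum-zero {f = λ x → b2n (A v x) * # (A v ∩ off A x)}
        (λ x → cong (λ z → b2n z * # (A v ∩ off A x)) (NI-false A e x)))) (*-zeroʳ c))) z≤n
    -- The chord has slope at least `I`, as `Y ≥ X + g * I`; this allows cancelling `g`.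
    Σf≤ : Σf + 2 * w * I ≤ ff (suc r) t + QF
    Σf≤ = *-cancelˡ-≤ g {{>-nonZero 1≤g}} (+-cancelʳ-≤ (2 * w * X) _ _ (begin
      g * (Σf + 2 * w * I) + 2 * w * X ≡⟨ ar g Σf w I X ⟩
      g * Σf + 2 * w * (X + g * I) ≤⟨ +-monoʳ-≤ (g * Σf) (*-monoʳ-≤ (2 * w) (ff-up (suc a) r g)) ⟩
      g * Σf + 2 * w * Y ≤⟨ bal ⟩
      g * (suc r * X + suc q * (suc Δ * Y)) + 2 * w * X ∎))
      where
      ar : ∀ g f w i x → g * (f + 2 * w * i) + 2 * w * x ≡ g * f + 2 * w * (x + g * i)
      ar = solve-∀

-- Superadditivity of the bound

-- Addition without and with a carry into a further copy of K_{Δ+1}. Only a carry has to gain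
-- strictly: without one, the rest of the graph is still compared with at least one copy and the
-- induction hypothesis for it is strict.
Sum≤ Sum< : ℕ → ℕ → ℕ → ℕ → Set
Sum≤ a Δ m x = ∃ λ R → ∃ λ s → s < R × R ≤ Δ × m ≡ tri R + s × x ≤ val (2 + a) R s
Sum< a Δ m x = ∃ λ R → ∃ λ s → s < R × R ≤ Δ × m ≡ tri (suc Δ) + (tri R + s) × x < ff (suc Δ) (3 + a) + val (2 + a)
  R s

Sum-transport : ∀ {a Δ m m' x x'} → m' ≡ m → x ≤ x' → Sum≤ a Δ m' x' ⊎ Sum< a Δ m' x' → Sum≤ a Δ m x ⊎ Sum< a Δ m x
Sum-transport e l (inj₁ (R , s , p , q , e' , v)) = inj₁ (R , s , p , q , trans (sym e) e' , ≤-trans l v)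
Sum-transport e l (inj₂ (R , s , p , q , e' , v)) = inj₂ (R , s , p , q , trans (sym e) e' , ≤-<-trans l v)

-- rows of the smaller colex graph are moved one after another to the end of the larger one
superadd : ∀ a Δ R₁ s₁ R₂ s₂ → 2 + a ≤ Δ → s₁ < R₁ → R₁ ≤ Δ → s₂ ≤ R₂ → R₂ ≤ R₁ → s₂ < Δ →
  Sum≤ a Δ (tri R₁ + s₁ + (tri R₂ + s₂)) (val (2 + a) R₁ s₁ + val (2 + a) R₂ s₂)
  ⊎ Sum< a Δ (tri R₁ + s₁ + (tri R₂ + s₂)) (val (2 + a) R₁ s₁ + val (2 + a) R₂ s₂)
superadd a Δ R₁ s₁ zero .zero a≤Δ l₁ R₁≤ z≤n _ l₂ = inj₁ (R₁ , s₁ , l₁ , R₁≤ , +-identityʳ _ ,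
  ≤-reflexive (trans (cong (val (2 + a) R₁ s₁ +_) (*-zeroʳ (3 + a))) (+-identityʳ _)))
superadd a Δ R₁ s₁ (suc R₂) s₂ a≤Δ l₁ R₁≤ le₂ RR l₂ with s₁ + s₂ <? R₁
-- The last row of the smaller graph fits into that of the larger one. The clique on `suc R₂`
-- vertices that remains is read as `R₂` with a full last row, which is why `s₂ ≤ R₂` is the weak
-- inequality.
... | yes lt = Sum-transport meq vle (superadd a Δ R₁ (s₁ + s₂) R₂ R₂ a≤Δ lt R₁≤ ≤-refl (≤-trans (n≤1+n R₂) RR)
  (≤-trans RR R₁≤))
  where
  t = 3 + a
  α = 2 + a
  meq : tri R₁ + (s₁ + s₂) + (tri R₂ + R₂) ≡ tri R₁ + s₁ + (tri (suc R₂) + s₂)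
  meq = ar (tri R₁) s₁ s₂ (tri R₂) R₂
    where
    ar : ∀ x s u y r → x + (s + u) + (y + r) ≡ x + s + (r + y + u)
    ar = solve-∀
  vle : val α R₁ s₁ + val α (suc R₂) s₂ ≤ val α R₁ (s₁ + s₂) + val α R₂ R₂
  vle = ≤-trans (≤-reflexive (ar (ff R₁ t) t (ff s₁ α) (ff (suc R₂) t) (ff s₂ α)))
    (≤-trans (+-monoˡ-≤ (ff (suc R₂) t) (+-monoʳ-≤ (ff R₁ t) (*-monoʳ-≤ t (ff-super s₁ s₂ (s≤s z≤n)))))
      (≤-reflexive (cong (val α R₁ (s₁ + s₂) +_) (sym (val-row α R₂)))))
    where
    ar : ∀ x t u y v → x + t * u + (y + t * v) ≡ x + t * (u + v) + y
    ar = solve-∀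
... | no nlt = more (R₁ <? Δ)
  where
  t = 3 + a
  α = 2 + a
  x = s₁ + s₂ ∸ R₁
  R+x : R₁ + x ≡ s₁ + s₂
  R+x = m+[n∸m]≡n (≮⇒≥ nlt)
  x<s₂ : x < s₂
  x<s₂ = +-cancelˡ-< R₁ x s₂ (≤-<-trans (≤-reflexive R+x) (+-monoˡ-< s₂ l₁))
  s₂≤R₁ : s₂ ≤ R₁
  s₂≤R₁ = ≤-trans le₂ RR
  h = R₁ ∸ s₂
  s₂+h : s₂ + h ≡ R₁
  s₂+h = m+[n∸m]≡n s₂≤R₁
  x+h : x + h ≡ s₁
  x+h = +-cancelˡ-≡ s₂ (x + h) s₁ (trans (ar s₂ x h) (trans (cong (_+ x) s₂+h) (trans R+x (+-comm s₁ s₂))))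
    where
    ar : ∀ s x h → s + (x + h) ≡ s + h + x
    ar = solve-∀
  cv : ff s₁ α + ff s₂ α ≤ ff x α + ff R₁ α
  cv = subst₂ (λ u v → ff u α + ff s₂ α ≤ ff x α + ff v α) x+h s₂+h (ff-conv α h (<⇒≤ x<s₂))
  more : _ → _
  -- The last row of the larger graph becomes full, and the overflow `x` opens a new one.
  more (yes R₁<Δ) = Sum-transport meq vle (superadd a Δ (suc R₁) x R₂ R₂ a≤Δ (s≤s (≤-trans (<⇒≤ x<s₂) s₂≤R₁)) R₁<Δ
    ≤-refl (≤-trans (≤-trans (n≤1+n R₂) RR) (n≤1+n R₁)) (≤-trans RR R₁≤))
    where
    meq : tri (suc R₁) + x + (tri R₂ + R₂) ≡ tri R₁ + s₁ + (tri (suc R₂) + s₂)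
    meq = trans (ar₁ R₁ (tri R₁) x (tri R₂) R₂) (trans (cong (λ z → z + tri R₁ + (tri R₂ + R₂)) R+x)
      (ar₂ (tri R₁) s₁ s₂ (tri R₂) R₂))
      where
      ar₁ : ∀ r y x z w → r + y + x + (z + w) ≡ r + x + y + (z + w)
      ar₁ = solve-∀
      ar₂ : ∀ y s u z w → s + u + y + (z + w) ≡ y + s + (w + z + u)
      ar₂ = solve-∀
    vle : val α R₁ s₁ + val α (suc R₂) s₂ ≤ val α (suc R₁) x + val α R₂ R₂
    vle = ≤-trans (≤-reflexive (ar (ff R₁ t) t (ff s₁ α) (ff (suc R₂) t) (ff s₂ α)))
      (≤-trans (+-monoˡ-≤ (ff (suc R₂) t) (+-monoʳ-≤ (ff R₁ t) (*-monoʳ-≤ t cv)))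
       (≤-reflexive (cong₂ _+_ (trans (ar' (ff R₁ t) t (ff x α) (ff R₁ α))
         (cong (_+ t * ff x α) (sym (ff-pascal R₁ α)))) (sym (val-row α R₂)))))
      where
      ar : ∀ x t u y v → x + t * u + (y + t * v) ≡ x + t * (u + v) + y
      ar = solve-∀
      ar' : ∀ f t u v → f + t * (u + v) ≡ f + t * v + t * u
      ar' = solve-∀
  -- The full row completes a K_{Δ+1}, and the overflow `x` goes back to the smaller graph.
  more (no nΔ) = inj₂ (suc R₂ , x , ≤-trans x<s₂ le₂ , ≤-trans RR R₁≤ , meq , v<)
    where
    R₁≡Δ : R₁ ≡ Δ
    R₁≡Δ = ≤-antisym R₁≤ (≮⇒≥ nΔ)
    meq : tri R₁ + s₁ + (tri (suc R₂) + s₂) ≡ tri (suc Δ) + (tri (suc R₂) + x)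
    meq = trans (trans (ar₁ (tri R₁) s₁ (tri (suc R₂)) s₂) (cong (λ z → tri R₁ + z + tri (suc R₂)) (sym R+x)))
      (trans (ar₂ R₁ (tri R₁) x (tri (suc R₂))) (cong (λ z → tri (suc z) + (tri (suc R₂) + x)) R₁≡Δ))
      where
      ar₁ : ∀ y s z u → y + s + (z + u) ≡ y + (s + u) + z
      ar₁ = solve-∀
      ar₂ : ∀ r y x z → y + (r + x) + z ≡ r + y + (z + x)
      ar₂ = solve-∀
    h' = Δ ∸ suc s₂
    sh' : s₂ + suc h' ≡ Δ
    sh' = trans (+-suc s₂ h') (m+[n∸m]≡n l₂)
    h≡ : h ≡ suc h'
    h≡ = +-cancelˡ-≡ s₂ h (suc h') (trans s₂+h (trans R₁≡Δ (sym sh')))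
    cv< : ff s₁ α + ff s₂ α < ff x α + ff Δ α
    cv< = subst₂ (λ u v → ff u α + ff s₂ α < ff x α + ff v α) (trans (cong (x +_) (sym h≡)) x+h) sh'
      (ff-conv< (suc a) h' x<s₂ (s≤s z≤n) (≤-pred (≤-trans a≤Δ (≤-reflexive (trans (sym sh') (+-suc s₂ h'))))))
    v< : val α R₁ s₁ + val α (suc R₂) s₂ < ff (suc Δ) t + val α (suc R₂) x
    v< = ≤-<-trans (≤-reflexive (ar (ff R₁ t) t (ff s₁ α) (ff (suc R₂) t) (ff s₂ α)))
      (<-≤-trans (+-monoˡ-< (ff (suc R₂) t) (+-monoʳ-< (ff R₁ t) (*-monoʳ-< t cv<)))
       (≤-reflexive (trans (ar' (ff R₁ t) t (ff x α) (ff Δ α) (ff (suc R₂) t))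
         (cong (_+ val α (suc R₂) x) (trans (cong (λ z → ff z t + t * ff Δ α) R₁≡Δ) (sym (ff-pascal Δ α)))))))
      where
      ar : ∀ x t u y v → x + t * u + (y + t * v) ≡ x + t * (u + v) + y
      ar = solve-∀
      ar' : ∀ f t u v y → f + t * (u + v) + y ≡ f + t * v + (y + t * u)
      ar' = solve-∀

divide : ∀ N m → 1 ≤ N → ∃ λ q → ∃ λ b → m ≡ q * N + b × b < N
divide N zero    p = 0 , 0 , refl , p
divide N (suc m) p with divide N m p
... | q , b , e , l with suc b <? N
... | yes l' = q , suc b , trans (cong suc e) (sym (+-suc _ b)) , l'
... | no ¬l = suc q , 0 , trans (cong suc e) (trans (sym (+-suc _ b))
  (trans (cong (q * N +_) (≤-antisym l (≮⇒≥ ¬l))) (trans (+-comm (q * N) N) (sym (+-identityʳ _))))) , p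

divide-unique : ∀ N q q' b b' → q * N + b ≡ q' * N + b' → b < N → b' < N → q ≡ q' × b ≡ b'
divide-unique N zero    zero     b b' e l l' = refl , e
divide-unique N zero    (suc q') b b' e l l' = ⊥-elim (<⇒≱ l
  (≤-trans (≤-trans (m≤m+n N (q' * N)) (m≤m+n _ b')) (≤-reflexive (sym e))))
divide-unique N (suc q) zero     b b' e l l' = ⊥-elim (<⇒≱ l'
  (≤-trans (≤-trans (m≤m+n N (q * N)) (m≤m+n _ b)) (≤-reflexive e)))
divide-unique N (suc q) (suc q') b b' e l l' with divide-unique N q q' b b'
  (+-cancelˡ-≡ N _ _ (trans (sym (+-assoc N _ b)) (trans e (+-assoc N _ b')))) l l'
... | p , r = cong suc p , r

tri-< : ∀ {R s Δ} → s < R → R ≤ Δ → tri R + s < tri (suc Δ)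
tri-< {R} {s} l R≤ = <-≤-trans (+-monoʳ-< (tri R) l) (≤-trans (≤-reflexive (+-comm (tri R) R)) (tri-mono (s≤s R≤)))

tri-<⁻ : ∀ {R s Δ} → tri R + s < tri (suc Δ) → R ≤ Δ
tri-<⁻ {R} {s} {Δ} l = ≮⇒≥ (λ Δ<R → <⇒≱ l (≤-trans (tri-mono Δ<R) (m≤m+n (tri R) s)))

tri-unique : ∀ {R s R' s'} → s < R → s' < R' → tri R + s ≡ tri R' + s' → R ≡ R' × s ≡ s'
tri-unique {suc R} {s} {suc R'} (s≤s p) (s≤s p') e with rep-unique p p' e
... | refl , q = refl , q

-- The strict inequality without complete components

edges-drop : ∀ G H m E z → degSum (adj G) ≡ 2 * m → degSum (adj G) ≡ degSum (adj H) + 2 * E → z + E ≡ m → degSum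
  (adj H) ≡ 2 * z
edges-drop G H m E z eG eH ez = halve m (degSum (adj H)) E z (trans (sym eG) eH) ez

shift : ∀ N x y E m → x + E ≡ y → N + y ≡ m → N + x + E ≡ m
shift N x y E m p q = trans (+-assoc N x E) (trans (cong (N +_) p) q)

-- `fuel` bounds the number of edges `m` and carries the induction; `suc q` says that the comparison
-- graph has at least one K_{Δ+1}.
Strict : ℕ → ℕ → ℕ → Set
Strict fuel a Δ = ∀ (G : Graph) q R s → MaxDeg (adj G) Δ → NoFull (adj G) Δ →
  s < R → R ≤ Δ → ∀ m → m ≤ fuel → suc q * tri (suc Δ) + (tri R + s) ≡ m → degSum (adj G) ≡ 2 * m →
  cl (adj G) (3 + a) full < suc q * ff (suc Δ) (3 + a) + val (2 + a) R s

-- By `window`, the removal of `E ≤ r` edges lowers the bound by at least the permitted loss and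
-- affects only the remainder, so the same `suc q` serves for `H`.
drop-edges : ∀ fuel a Δ → Strict fuel a Δ → ∀ (G H : Graph) q r s E →
  MaxDeg (adj H) Δ → NoFull (adj H) Δ → s ≤ r → suc r ≤ Δ → 1 ≤ E → E ≤ r →
  ∀ m → m ≤ suc fuel → suc q * tri (suc Δ) + (tri (suc r) + s) ≡ m → degSum (adj G) ≡ 2 * m →
  degSum (adj G) ≡ degSum (adj H) + 2 * E →
  cl (adj G) (3 + a) full ≤ cl (adj H) (3 + a) full + (3 + a) * ff E (2 + a) →
  cl (adj G) (3 + a) full < suc q * ff (suc Δ) (3 + a) + val (2 + a) (suc r) s
drop-edges fuel a Δ IH G H q r s E md nf s≤r r<Δ 1≤E E≤r m m≤ em eG eH le
  with window (2 + a) (s≤s z≤n) r s E s≤r E≤r 1≤E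
... | r₂ , s₂ , s₂≤r₂ , r₂≤r , e₂ , vle = ≤-<-trans le (<-≤-trans (+-monoˡ-< _ ih)
  (≤-trans (≤-reflexive (+-assoc QF (val (2 + a) (suc r₂) s₂) _))
    (+-monoʳ-≤ QF (≤-trans (≤-reflexive (+-comm (val (2 + a) (suc r₂) s₂) _)) vle))))
  where
  QF = suc q * ff (suc Δ) (3 + a)
  z = suc q * tri (suc Δ) + (tri (suc r₂) + s₂)
  ze : z + E ≡ m
  ze = shift (suc q * tri (suc Δ)) (tri (suc r₂) + s₂) _ E m e₂ em
  z≤ : z ≤ fuel
  z≤ = ≤-pred (≤-trans (≤-trans (≤-reflexive (+-comm 1 z)) (≤-trans (+-monoʳ-≤ z 1≤E) (≤-reflexive ze))) m≤)
  ih : cl (adj H) (3 + a) full < QF + val (2 + a) (suc r₂) s₂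
  ih = IH H q (suc r₂) s₂ md nf (s≤s s₂≤r₂) (≤-trans (s≤s r₂≤r) r<Δ) z z≤ refl (edges-drop G H m E z eG eH ze)

-- With no edge leaving it, `N[v]` is a component, and it has fewer than `tri (suc Δ)` edges since
-- it is not K_{Δ+1}. Kruskal-Katona bounds this component, the induction hypothesis (or
-- Kruskal-Katona, if fewer than `N` edges remain) bounds the rest, and `superadd` joins the two
-- bounds.
split-component : ∀ fuel a Δ → 2 + a ≤ Δ → Strict fuel a Δ → ∀ (G : Graph) q R s v →
  MaxDeg (adj G) Δ → NoFull (adj G) Δ → s < R → R ≤ Δ → NI (adj G) v ≡ true → ends (adj G) v ≡ 0 →
  ∀ m → m ≤ suc fuel → suc q * tri (suc Δ) + (tri R + s) ≡ m → degSum (adj G) ≡ 2 * m →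
  cl (adj G) (3 + a) full < suc q * ff (suc Δ) (3 + a) + val (2 + a) R s
split-component fuel a Δ a≤Δ IH G q R s v md nf s<R R≤Δ niv ev m m≤ em eG = main
  where
  A = adj G
  sA = adj-simple G
  t = 3 + a
  N = tri (suc Δ)
  X : BSet (n G)
  X = closed A v
  M = induced G X
  H = induced G (not ∘ X)
  nocross : NoCross A X
  nocross x y xx axy with X y in e
  ... | true = refl
  ... | false = ⊥-elim (false≢true (count-zero⁻ _ (n≤0⇒n≡0 (≤-trans (sum-point (λ x → # (cross A X x)) x)
    (≤-reflexive (trans (cutE-closed sA v) ev)))) y) (cross-intro A X x y xx axy e))
  κ≡ : cl A t full ≡ cl (adj M) t full + cl (adj H) t full
  κ≡ = trans (cl-comp sA X nocross (2 + a)) (cong₂ _+_ (sym (cl-induced G X (suc a)))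
    (sym (cl-induced G (not ∘ X) (suc a))))
  e2≡ : degSum A ≡ degSum (adj M) + degSum (adj H)
  e2≡ = trans (sym (cl-2 A)) (trans (cl-comp sA X nocross 1)
    (cong₂ _+_ (sym (degSum-induced G X)) (sym (degSum-induced G (not ∘ X)))))
  ec = edges M
  eh = edges H
  sumE : ec + eh ≡ m
  sumE = *-cancelˡ-≡ (ec + eh) m 2 (trans (*-distribˡ-+ 2 ec eh)
    (trans (cong₂ _+_ (sym (handshake M)) (sym (handshake H))) (trans (sym e2≡) eG)))
  d = # (A v)
  size : # X ≡ suc d
  size = trans (count-split X v) (trans (cong₂ _+_ (count-cong q₁) (cong b2n xv)) (+-comm d 1))
    where
    xv : X v ≡ true
    xv rewrite eqᵇ-refl v = refl
    q₁ : ∀ x → (X \\ v) x ≡ A v x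
    q₁ x with eqᵇ v x in e
    ... | true = trans refl (sym (trans (cong (A v) (sym (eqᵇ-true {i = v} e))) (irr sA v)))
    ... | false = trans (∧-identityʳ _) (not-not (A v x))
  A⊂X : ∀ x → A v x ≡ true → X x ≡ true
  A⊂X x p rewrite p | ∧-zeroʳ (not (eqᵇ v x)) = refl
  2ec : 2 * ec ≡ cl A 2 X
  2ec = trans (sym (handshake M)) (degSum-induced G X)
  ec<N : ec < N
  ec<N = *-cancelˡ-< 2 ec N (subst₂ _<_ (sym 2ec) (sym (2tri Δ)) lt)
    where
    bound : cl A 2 X ≤ suc d * d
    bound = ≤-trans (cl-≤-ff A (irr sA) 2 X) (≤-reflexive (trans (cong (λ z → ff z 2) size)
      (cong (suc d *_) (ff-1 d))))
    lt : cl A 2 X < suc Δ * Δ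
    lt with d ≟ Δ
    ... | no ne = ≤-<-trans bound (*-mono-< (s≤s (≤∧≢⇒< (md v) ne)) (≤∧≢⇒< (md v) ne))
    ... | yes eq with nf v eq
    ... | x , z , vx , vz , ne , nadj = <-≤-trans (nonclique-< sA 0 X x z (A⊂X x vx) (A⊂X z vz) ne nadj
      (≤-trans (≤-trans (s≤s (s≤s z≤n)) (≤-trans a≤Δ (n≤1+n Δ)))
      (≤-reflexive (trans (cong suc (sym eq)) (sym size)))))
          (≤-reflexive (trans (cong (λ z → ff z 2) (trans size (cong suc eq))) (cong (suc Δ *_) (ff-1 Δ))))
  1≤ec : 1 ≤ ec
  1≤ec with NI-elim A niv
  ... | y , vy = *-cancelˡ-< 2 0 ec (≤-trans (≤-trans (count-point (adj M v) y cvy)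
    (sum-point (λ x → # (adj M x)) v)) (≤-reflexive (handshake M)))
    where
    cvy : adj M v y ≡ true
    cvy = ∧-intro vy (∧-intro (cong not (cong (_∧ not (A v v)) (cong not (eqᵇ-refl v)))) (A⊂X y vy))
  H⊑ : adj H ⊑ A
  H⊑ x y p = proj₁ (∧-true p)
  main : cl A t full < suc q * ff (suc Δ) t + val (2 + a) R s
  main with divide N eh (≤-trans (s≤s z≤n) ec<N) | rep ec
  ... | q' , b' , eq' , b'<N | ρ , σ , σ≤ρ , ecr with rep b'
  ... | ρ' , σ' , σ'≤ρ' , br = fin sumcase
    where
    F = ff (suc Δ) t
    v₁ = val (2 + a) (suc ρ) σ
    v₂ = val (2 + a) (suc ρ') σ'
    ρ<Δ : suc ρ ≤ Δ
    ρ<Δ = tri-<⁻ {suc ρ} {σ} (subst (_< N) ecr ec<N)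
    ρ'<Δ : suc ρ' ≤ Δ
    ρ'<Δ = tri-<⁻ {suc ρ'} {σ'} (subst (_< N) br b'<N)
    kN : cl (adj M) t full ≤ v₁
    kN = kruskal-katona ec (suc a) M ρ σ (trans (handshake M) (cong (2 *_) ecr)) σ≤ρ (≤-reflexive (sym ecr))
    kH : ∀ q'' → q' ≡ q'' → cl (adj H) t full ≤ q'' * F + v₂
    kH< : ∀ q'' → q' ≡ suc q'' → cl (adj H) t full < suc q'' * F + v₂
    kH< q'' refl = IH H q'' (suc ρ') σ' (MaxDeg-⊑ {A = A} {adj H} H⊑ md) (NoFull-⊑ {A = A} {adj H} H⊑ md nf)
      (s≤s σ'≤ρ') ρ'<Δ eh
      (≤-pred (≤-trans (≤-trans (+-monoˡ-≤ eh 1≤ec) (≤-reflexive sumE)) m≤))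
      (trans (cong (suc q'' * N +_) (sym br)) (sym eq')) (handshake H)
    kH zero refl = kruskal-katona eh (suc a) H ρ' σ' (trans (handshake H) (cong (2 *_) (trans eq' br))) σ'≤ρ'
      (≤-reflexive (sym (trans eq' br)))
    kH (suc q'') e = <⇒≤ (kH< q'' e)
    b = tri R + s
    total : q' * N + (ec + b') ≡ suc q * N + b
    total = trans (ar (q' * N) ec b') (trans (cong (ec +_) (sym eq')) (trans sumE (sym em)))
      where
      ar : ∀ x y z → x + (y + z) ≡ y + (x + z)
      ar = solve-∀
    sumcase : Sum≤ a Δ (ec + b') (v₁ + v₂) ⊎ Sum< a Δ (ec + b') (v₁ + v₂)
    sumcase with suc ρ' ≤? suc ρ
    ... | yes le = subst (λ z → Sum≤ a Δ z (v₁ + v₂) ⊎ Sum< a Δ z (v₁ + v₂)) (sym (cong₂ _+_ ecr br))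
          (superadd a Δ (suc ρ) σ (suc ρ') σ' a≤Δ (s≤s σ≤ρ) ρ<Δ (≤-trans σ'≤ρ' (n≤1+n ρ')) le
            (≤-trans (s≤s σ'≤ρ') ρ'<Δ))
    ... | no nle = subst₂ (λ z u → Sum≤ a Δ z u ⊎ Sum< a Δ z u)
      (trans (cong₂ _+_ (sym br) (sym ecr)) (+-comm b' ec)) (+-comm v₂ v₁)
          (superadd a Δ (suc ρ') σ' (suc ρ) σ a≤Δ (s≤s σ'≤ρ') ρ'<Δ (≤-trans σ≤ρ (n≤1+n ρ)) (<⇒≤ (≰⇒> nle))
            (≤-trans (s≤s σ≤ρ) ρ<Δ))
    fin : Sum≤ a Δ (ec + b') (v₁ + v₂) ⊎ Sum< a Δ (ec + b') (v₁ + v₂) → cl A t full < suc q * F + val (2 + a) R s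
    -- No carry: then `q' = suc q`, and the rest satisfies the strict induction hypothesis.
    fin (inj₁ (R₃ , s₃ , s₃< , R₃≤ , e₃ , vle)) with divide-unique N q' (suc q) (tri R₃ + s₃) b
      (trans (cong (q' * N +_) (sym e₃)) total) (tri-< s₃< R₃≤) (tri-< s<R R≤Δ)
    ... | qe , be with tri-unique s₃< s<R be
    ... | refl , refl = ≤-<-trans (≤-reflexive κ≡) (<-≤-trans (+-mono-≤-< kN (kH< q qe))
      (≤-trans (≤-reflexive (ar v₁ (suc q * F) v₂)) (+-monoʳ-≤ (suc q * F) vle)))
      where
      ar : ∀ x y z → x + (y + z) ≡ y + (x + z)
      ar = solve-∀
    -- A carry: then `q' = q` may be 0, and strictness comes from `superadd`.
    fin (inj₂ (R₃ , s₃ , s₃< , R₃≤ , e₃ , v<)) with divide-unique N (suc q') (suc q) (tri R₃ + s₃) b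
          (trans (ar' N (q' * N) (tri R₃ + s₃)) (trans (cong (q' * N +_) (sym e₃)) total)) (tri-< s₃< R₃≤)
            (tri-< s<R R≤Δ)
      where
      ar' : ∀ n x y → n + x + y ≡ x + (n + y)
      ar' = solve-∀
    ... | qe , be with tri-unique s₃< s<R be
    ... | refl , refl = ≤-<-trans (≤-trans (≤-reflexive κ≡) (+-mono-≤ kN (kH q (suc-injective qe))))
      (≤-<-trans (≤-reflexive (ar v₁ (q * F) v₂)) (<-≤-trans (+-monoʳ-< (q * F) v<)
      (≤-reflexive (ar₂ F (q * F) (val (2 + a) R s)))))
      where
      ar : ∀ x y z → x + (y + z) ≡ y + (x + z)
      ar = solve-∀
      ar₂ : ∀ f x y → x + (f + y) ≡ f + x + y
      ar₂ = solve-∀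

strict : ∀ fuel a Δ → 2 + a ≤ Δ → Strict fuel a Δ
strict zero a Δ a≤Δ G q R s md nf s<R R≤Δ m m≤ em eG =
  ⊥-elim (<⇒≱ (≤-trans (≤-trans (s≤s z≤n) (≤-trans a≤Δ (m≤m+n Δ (tri Δ))))
    (≤-trans (m≤m+n (tri (suc Δ)) (q * tri (suc Δ))) (≤-trans (m≤m+n _ (tri R + s)) (≤-reflexive em)))) m≤)
strict (suc fuel) a Δ a≤Δ G q (suc r) s md nf (s≤s s≤r) R≤Δ m m≤ em eG = step₁
  where
  A = adj G
  sA = adj-simple G
  t = 3 + a
  F = ff (suc Δ) t
  Goal = cl A t full < suc q * F + val (2 + a) (suc r) s
  IH : Strict fuel a Δ
  IH = strict fuel a Δ a≤Δ
  d : Fin (n G) → ℕ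
  d v = # (A v)
  by-cut : ∀ X E → cutE A X ≡ E → 1 ≤ E → E ≤ r → Goal
  by-cut X E eE 1≤E E≤r = drop-edges fuel a Δ IH G (cutG G X) q r s E
    (MaxDeg-⊑ {A = A} {adj (cutG G X)} (λ x y p → proj₁ (∧-true p)) md)
    (NoFull-⊑ {A = A} {adj (cutG G X)} (λ x y p → proj₁ (∧-true p)) md nf) s≤r R≤Δ 1≤E E≤r m m≤ em eG
    (trans (cut-degSum G X) (cong (λ z → degSum (adj (cutG G X)) + 2 * z) eE)) (cut-cl (suc a) E G X eE)
  -- Exactly `r` edges at `v` are deleted, the largest number that `window` admits, and all cliques
  -- through `v` are given up in exchange.
  by-star : ∀ v → 1 ≤ r → suc r ≤ d v → cl A (2 + a) (A v) ≤ ff r (2 + a) → Goal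
  by-star v 1≤r r<d τ≤ with subset-of-size (d v) (A v) r refl (<⇒≤ r<d)
  ... | Y , Y⊂ , #Y = drop-edges fuel a Δ IH G H q r s r (MaxDeg-⊑ {A = A} {adj H} (λ x y p → proj₁ (∧-true p)) md)
    (NoFull-⊑ {A = A} {adj H} (λ x y p → proj₁ (∧-true p)) md nf) s≤r R≤Δ 1≤r ≤-refl m m≤ em eG
    (trans (star-degSum G v Y Y⊂) (cong (λ z → degSum (adj H) + 2 * z) #Y))
    (≤-trans (star-cl G v Y (2 + a)) (+-monoʳ-≤ (cl (adj H) t full) (*-monoʳ-≤ t τ≤)))
    where H = starOff G v Y
  eM : degSum A ≡ suc q * (suc Δ * Δ) + 2 * (tri (suc r) + s)
  eM = trans eG (trans (cong (2 *_) (sym em)) (trans (*-distribˡ-+ 2 (suc q * tri (suc Δ)) _)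
    (cong (_+ 2 * (tri (suc r) + s)) (trans (ar (suc q) (tri (suc Δ))) (cong (suc q *_) (2tri Δ))))))
    where
    ar : ∀ q x → 2 * (q * x) ≡ q * (2 * x)
    ar = solve-∀
  step₄ : (∀ v → NI A v ≡ true → suc r ≤ d v) → (∀ v → NI A v ≡ true → suc r ≤ ends A v) → suc q * suc Δ + suc
    (suc r) ≤ n₀ A → Goal
  step₄ dR eR nl with suc r <? Δ
  -- For `suc r = Δ` the chord degenerates, but the many vertices of degree at least Δ already
  -- exceed the degree sum.
  ... | no nlt = ⊥-elim (<⇒≱ small big)
    where
    R≡Δ : suc r ≡ Δ
    R≡Δ = ≤-antisym R≤Δ (≮⇒≥ nlt)
    big : (suc q * suc Δ + suc Δ) * Δ ≤ degSum A
    big = ≤-trans (*-mono-≤ (≤-trans (+-monoʳ-≤ (suc q * suc Δ) (≤-reflexive (cong suc (sym R≡Δ)))) nl)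
      (≤-reflexive (sym R≡Δ))) (sum-set-≤ (NI A) d (suc r) dR)
    small : degSum A < (suc q * suc Δ + suc Δ) * Δ
    small = begin-strict
      degSum A ≡⟨ eM ⟩
      suc q * (suc Δ * Δ) + 2 * (tri (suc r) + s) <⟨ +-monoʳ-< (suc q * (suc Δ * Δ))
        (*-monoʳ-< 2 (tri-< {suc r} {s} (s≤s s≤r) R≤Δ)) ⟩
      suc q * (suc Δ * Δ) + 2 * tri (suc Δ) ≡⟨ cong (suc q * (suc Δ * Δ) +_) (2tri Δ) ⟩
      suc q * (suc Δ * Δ) + suc Δ * Δ ≡⟨ ar (suc q) (suc Δ) Δ ⟩
      (suc q * suc Δ + suc Δ) * Δ ∎
      where
      open ≤-Reasoning
      ar : ∀ q x y → q * (x * y) + x * y ≡ (q * x + x) * y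
      ar = solve-∀
  ... | yes R<Δ with m≤n⇒∃[o]m+o≡n R≤Δ
  ... | g , refl = fin (suc r <? 2 + a)
    where
    w = suc r ∸ s
    sw : s + w ≡ suc r
    sw = m+[n∸m]≡n (≤-trans s≤r (n≤1+n r))
    1≤w : 1 ≤ w
    1≤w = m<n⇒0<n∸m (s≤s s≤r)
    1≤g : 1 ≤ g
    1≤g = +-cancelˡ-≤ (suc r) 1 g (≤-trans (≤-reflexive (+-comm (suc r) 1)) R<Δ)
    count : _ → Goal
    count = final-count G a q (suc r) s w g sw 1≤w 1≤g a≤Δ md eM dR nl
    fin : _ → Goal
    fin (yes l) = count (inj₁ l)
    fin (no nl') = big-r r refl
      where
      big-r : ∀ r' → r ≡ r' → Goal
      big-r zero refl = ⊥-elim (nl' (s≤s (s≤s z≤n)))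
      big-r (suc r₂) refl with any? (λ v → (NI A v Data.Bool.≟ true) ×-dec (cl A (2 + a) (A v) ≤? ff r (2 + a)))
      ... | yes (v , ni , τ≤) = by-star v (s≤s z≤n) (dR v ni) τ≤
      ... | no none = count (inj₂ (r₂ , refl , ≤-pred (≤-pred (≮⇒≥ nl')) , (λ v ni → ≰⇒> (λ l → none (v , ni , l)))
        , eR))
  step₃ : (∀ v → NI A v ≡ true → suc r ≤ d v) → (∀ v → NI A v ≡ true → suc r ≤ ends A v) → Goal
  step₃ dR eR with n₀ A ≤? suc q * suc Δ + suc r
  ... | yes l = <-≤-trans (few-vertices (n₀ A) a Δ G q (suc r) a≤Δ md nf ≤-refl l R≤Δ)
    (+-monoʳ-≤ (suc q * F) (m≤m+n _ _))
  ... | no nl = step₄ dR eR (≤-trans (≤-reflexive (+-suc (suc q * suc Δ) (suc r))) (≰⇒> nl))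
  step₂ : (∀ v → NI A v ≡ true → suc r ≤ d v) → Goal
  step₂ dR with any? (λ v → (NI A v Data.Bool.≟ true) ×-dec (ends A v ≤? r))
  ... | no none = step₃ dR (λ v ni → ≰⇒> (λ l → none (v , ni , l)))
  ... | yes (v , ni , l) with ends A v in ev
  ... | zero = split-component fuel a Δ a≤Δ IH G q (suc r) s v md nf (s≤s s≤r) R≤Δ ni ev m m≤ em eG
  ... | suc e = by-cut (closed A v) (suc e) (trans (cutE-closed sA v) ev) (s≤s z≤n) l
  step₁ : Goal
  step₁ with any? (λ v → (NI A v Data.Bool.≟ true) ×-dec (d v ≤? r))
  ... | no none = step₂ (λ v ni → ≰⇒> (λ l → none (v , ni , l)))
  ... | yes (v , ni , l) = by-cut (eqᵇ v) (d v) (cutE-single sA v)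
    (count-point (A v) (proj₁ (NI-elim A ni)) (proj₂ (NI-elim A ni))) l

-- Unordered cliques, isomorphism and disjoint unions

fact : ℕ → ℕ
fact zero    = 1
fact (suc t) = suc t * fact t

fact-pos : ∀ t → 1 ≤ fact t
fact-pos zero    = ≤-refl
fact-pos (suc t) = ≤-trans (fact-pos t) (m≤m+n _ _)

-- Unordered cliques, split by whether they contain the first vertex. This follows the recursion of
-- `countSubsets` and links it to the ordered count.
ucl : ∀ {k} → Rel₂ k → ℕ → BSet k → ℕ
ucl {zero}  A zero    R = 1
ucl {zero}  A (suc t) R = 0
ucl {suc k} A zero    R = 1
ucl {suc k} A (suc t) R = b2n (R fz) * ucl A⁻ t (λ i → R (fs i) ∧ A fz (fs i)) + ucl A⁻ (suc t) (R ∘ fs)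
  where
  A⁻ : Rel₂ k
  A⁻ i j = A (fs i) (fs j)

sum-suc : ∀ {k} (f : Fin (suc k) → ℕ) → ∑ f ≡ f fz + ∑ (f ∘ fs)
sum-suc f = trans (∑-def f) (cong (f fz +_) (sym (∑-def (f ∘ fs))))

cl-tail : ∀ {k} (A : Rel₂ (suc k)) t S → S fz ≡ false → cl A t S ≡ cl (λ i j → A (fs i) (fs j)) t (S ∘ fs)
cl-tail A zero    S h = refl
cl-tail A (suc t) S h = trans (sum-suc (λ x → b2n (S x) * cl A t (S ∩ A x)))
  (trans (cong (λ b → b2n b * cl A t (S ∩ A fz) + ∑ (λ x → b2n (S (fs x)) * cl A t (S ∩ A (fs x)))) h)
    (sum-cong (λ x → cong (b2n (S (fs x)) *_) (cl-tail A t (S ∩ A (fs x)) (cong (_∧ A (fs x) fz) h)))))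

tail-simple : ∀ {k} {A : Rel₂ (suc k)} → Simple A → Simple (λ i j → A (fs i) (fs j))
tail-simple sA = simple (λ u v → symm sA (fs u) (fs v)) (λ v → irr sA (fs v))

-- `cl-del` at the first vertex has the same shape as the recursion of `ucl`; its factor `suc t`
-- turns t! into (t+1)!.
ucl-cl : ∀ {k} {A : Rel₂ k} → Simple A → ∀ t R → fact t * ucl A t R ≡ cl A t R
ucl-cl {zero}  sA zero    R = refl
ucl-cl {zero} {A} sA (suc t) R = trans (*-zeroʳ (fact (suc t))) (sym (cl-empty A t R (λ ())))
ucl-cl {suc k} sA zero    R = refl
ucl-cl {suc k} {A} sA (suc t) R = begin
  fact (suc t) * (b2n (R fz) * U₁ + U₂) ≡⟨ arith (suc t) (fact t) (b2n (R fz)) U₁ U₂ ⟩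
  fact (suc t) * U₂ + suc t * (b2n (R fz) * (fact t * U₁)) ≡⟨ cong₂ (λ p q → p + suc t * (b2n (R fz) * q))
    (ucl-cl (tail-simple sA) (suc t) (R ∘ fs)) (ucl-cl (tail-simple sA) t (λ i → R (fs i) ∧ A fz (fs i))) ⟩
  cl A⁻ (suc t) (R ∘ fs) + suc t * (b2n (R fz) * cl A⁻ t (λ i → R (fs i) ∧ A fz (fs i)))
    ≡⟨ cong₂ (λ p q → p + suc t * (b2n (R fz) * q)) (sym (trans (cl-tail A (suc t) (R \\ fz) (∧-zeroʳ (R fz)))
      (cl-cong (suc t) (λ i → ∧-identityʳ (R (fs i))))))
        (sym (cl-tail A t (R ∩ A fz) (trans (cong (R fz ∧_) (irr sA fz)) (∧-zeroʳ (R fz))))) ⟩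
  cl A (suc t) (R \\ fz) + suc t * (b2n (R fz) * cl A t (R ∩ A fz)) ≡⟨ sym (cl-del sA t R fz) ⟩
  cl A (suc t) R ∎
  where
  open ≡-Reasoning
  A⁻ : Rel₂ k
  A⁻ i j = A (fs i) (fs j)
  U₁ = ucl A⁻ t (λ i → R (fs i) ∧ A fz (fs i))
  U₂ = ucl A⁻ (suc t) (R ∘ fs)
  arith : ∀ t f b u w → t * f * (b * u + w) ≡ t * f * w + t * (b * (f * u))
  arith = solve-∀

countSubsets-cong : ∀ {k} {P Q : BSet k → Bool} → (∀ S → P S ≡ Q S) → countSubsets P ≡ countSubsets Q
countSubsets-cong {zero}  h = cong b2n (h _)
countSubsets-cong {suc k} h = cong₂ _+_ (countSubsets-cong {k} (λ S → h _)) (countSubsets-cong {k} (λ S → h _))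

countSubsets-∧ : ∀ {k} b (Q : BSet k → Bool) → countSubsets (λ S → b ∧ Q S) ≡ b2n b * countSubsets Q
countSubsets-∧ {k} true Q = sym (+-identityʳ _)
countSubsets-∧ {zero} false Q = refl
countSubsets-∧ {suc k} false Q = cong₂ _+_ (countSubsets-∧ {k} false (λ _ → true))
  (countSubsets-∧ {k} false (λ _ → true))

ext : ∀ {k} → Bool → BSet k → BSet (suc k)
ext b S fz     = b
ext b S (fs i) = S i

-- The extension of a subset inside `countSubsets` agrees with `ext` only pointwise, so `P` has to
-- respect pointwise equality.
countSubsets-suc : ∀ {k} (P : BSet (suc k) → Bool) → (∀ {S T} → (∀ i → S i ≡ T i) → P S ≡ P T) →
  countSubsets P ≡ countSubsets (λ S → P (ext true S)) + countSubsets (λ S → P (ext false S))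
countSubsets-suc {k} P e = cong₂ _+_ (countSubsets-cong {k} (λ S → e (λ { fz → refl ; (fs i) → refl })))
  (countSubsets-cong {k} (λ S → e (λ { fz → refl ; (fs i) → refl })))

cliqueB : ∀ {k} → Rel₂ k → BSet k → Bool
cliqueB A S = allFin (λ i → allFin (λ j → not (S i ∧ S j ∧ not (eqᵇ i j)) ∨ A i j))

subB : ∀ {k} → BSet k → BSet k → Bool
subB S R = allFin (λ i → not (S i) ∨ R i)

cliqueB-elim : ∀ {k} (A : Rel₂ k) S → cliqueB A S ≡ true → ∀ i j → S i ≡ true → S j ≡ true → i ≢ j → A i j ≡ true
cliqueB-elim A S h i j si sj ne with allFin-elim (allFin-elim h i) j
... | w rewrite si | sj | eqᵇ-false ne = w

cliqueB-intro : ∀ {k} (A : Rel₂ k) S → (∀ i j → S i ≡ true → S j ≡ true → i ≢ j → A i j ≡ true) → cliqueB A S ≡ true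
cliqueB-intro A S h = allFin-intro (λ i → allFin-intro (λ j → go i j))
  where
  go : ∀ i j → (not (S i ∧ S j ∧ not (eqᵇ i j)) ∨ A i j) ≡ true
  go i j with S i in ei | S j in ej | eqᵇ i j in e
  ... | false | _ | _ = refl
  ... | true | false | _ = refl
  ... | true | true | true = refl
  ... | true | true | false = h i j ei ej (eqᵇ-≢ e)

subB-elim : ∀ {k} (S R : BSet k) → subB S R ≡ true → ∀ i → S i ≡ true → R i ≡ true
subB-elim S R h i si with allFin-elim h i
... | w rewrite si = w

subB-intro : ∀ {k} (S R : BSet k) → (∀ i → S i ≡ true → R i ≡ true) → subB S R ≡ true
subB-intro S R h = allFin-intro go
  where
  go : ∀ i → (not (S i) ∨ R i) ≡ true
  go i with S i in e
  ... | false = refl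
  ... | true = h i e

cliqueB-cong : ∀ {k} (A : Rel₂ k) {S T : BSet k} → (∀ i → S i ≡ T i) → cliqueB A S ≡ cliqueB A T
cliqueB-cong A h = allFin-cong (λ i → allFin-cong (λ j → cong₂ (λ p q → not (p ∧ q ∧ not (eqᵇ i j)) ∨ A i j) (h i)
  (h j)))

isIn : ∀ {k} → Rel₂ k → ℕ → BSet k → BSet k → Bool
isIn A t R S = subB S R ∧ (cliqueB A S ∧ (# S ≡ᵇ t))

isIn-cong : ∀ {k} (A : Rel₂ k) t R {S T : BSet k} → (∀ i → S i ≡ T i) → isIn A t R S ≡ isIn A t R T
isIn-cong A t R h = cong₂ _∧_ (allFin-cong (λ i → cong (λ p → not p ∨ R i) (h i)))
  (cong₂ _∧_ (cliqueB-cong A h) (cong (_≡ᵇ t) (count-cong h)))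

count-suc : ∀ {k} (P : BSet (suc k)) → # P ≡ b2n (P fz) + # (P ∘ fs)
count-suc P = trans (#-def P) (cong (b2n (P fz) +_) (sym (#-def (P ∘ fs))))

ucl-zero : ∀ {k} (A : Rel₂ k) R → ucl A 0 R ≡ 1
ucl-zero {zero}  A R = refl
ucl-zero {suc k} A R = refl

count-cliques : ∀ {k} {A : Rel₂ k} → Simple A → ∀ t R → countSubsets (isIn A t R) ≡ ucl A t R
count-cliques {zero} {A} sA zero    R = cong (λ z → b2n (z ≡ᵇ 0)) (#-def {0} (λ ()))
count-cliques {zero} {A} sA (suc t) R = cong (λ z → b2n (z ≡ᵇ suc t)) (#-def {0} (λ ()))
count-cliques {suc k} {A} sA t R = trans (countSubsets-suc (isIn A t R) (isIn-cong A t R)) (both t)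
  where
  A⁻ : Rel₂ k
  A⁻ i j = A (fs i) (fs j)
  sA⁻ : Simple A⁻
  sA⁻ = tail-simple sA
  cl-false : ∀ S → cliqueB A (ext false S) ≡ cliqueB A⁻ S
  cl-false S = bool-ext (λ h → cliqueB-intro A⁻ S (λ i j si sj ne → cliqueB-elim A (ext false S) h (fs i) (fs j) si
    sj (λ { refl → ne refl })))
    (λ h → cliqueB-intro A (ext false S) (λ { (fs i) (fs j) si sj ne → cliqueB-elim A⁻ S h i j si sj
      (λ e → ne (cong fs e)) }))
  false-part : ∀ t → countSubsets (λ S → isIn A t R (ext false S)) ≡ ucl A⁻ t (R ∘ fs)
  false-part t = trans (countSubsets-cong {k} (λ S → cong (subB S (R ∘ fs) ∧_)
    (cong₂ _∧_ (cl-false S) (cong (_≡ᵇ t) (count-suc (ext false S)))))) (count-cliques sA⁻ t (R ∘ fs))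
  both : ∀ t → countSubsets (λ S → isIn A t R (ext true S)) + countSubsets (λ S → isIn A t R (ext false S)) ≡ ucl A
    t R
  both zero = trans (cong₂ _+_ (trans (countSubsets-cong {k} {Q = λ S → false ∧ false} (λ S → none S))
    (countSubsets-∧ {k} false (λ _ → false))) (trans (false-part 0) (ucl-zero A⁻ (R ∘ fs)))) refl
    where
    none : ∀ S → isIn A 0 R (ext true S) ≡ false
    none S rewrite count-suc (ext true S) = trans (cong (subB (ext true S) R ∧_) (∧-zeroʳ _)) (∧-zeroʳ _)
  both (suc t) = cong₂ _+_ (trans (countSubsets-cong {k} pt)
    (trans (countSubsets-∧ (R fz) (isIn A⁻ t R')) (cong (b2n (R fz) *_) (count-cliques sA⁻ t R'))))
    (false-part (suc t))
    where
    R' : BSet k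
    R' i = R (fs i) ∧ A fz (fs i)
    pt : ∀ S → isIn A (suc t) R (ext true S) ≡ R fz ∧ isIn A⁻ t R' S
    pt S = bool-ext to from
      where
      sz : (# (ext true S) ≡ᵇ suc t) ≡ (# S ≡ᵇ t)
      sz = cong (_≡ᵇ suc t) (count-suc (ext true S))
      to : isIn A (suc t) R (ext true S) ≡ true → R fz ∧ isIn A⁻ t R' S ≡ true
      to h with ∧-true {subB (ext true S) R} h
      ... | h₁ , h₂ with ∧-true {cliqueB A (ext true S)} h₂
      ... | h₃ , h₄ = ∧-intro (subB-elim (ext true S) R h₁ fz refl)
        (∧-intro (subB-intro S R' (λ i si → ∧-intro (subB-elim (ext true S) R h₁ (fs i) si)
          (cliqueB-elim A (ext true S) h₃ fz (fs i) refl si (λ ()))))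
          (∧-intro (cliqueB-intro A⁻ S (λ i j si sj ne → cliqueB-elim A (ext true S) h₃ (fs i) (fs j) si sj
            (λ { refl → ne refl }))) (trans (sym sz) h₄)))
      from : R fz ∧ isIn A⁻ t R' S ≡ true → isIn A (suc t) R (ext true S) ≡ true
      from h with ∧-true {R fz} h
      ... | rz , h' with ∧-true {subB S R'} h'
      ... | h₁ , h₂ with ∧-true {cliqueB A⁻ S} h₂
      ... | h₃ , h₄ = ∧-intro (subB-intro (ext true S) R (λ { fz _ → rz ; (fs i) si → proj₁
        (∧-true {R (fs i)} (subB-elim S R' h₁ i si)) }))
        (∧-intro (cliqueB-intro A (ext true S) cq) (trans sz h₄))
        where
        nb : ∀ i → S i ≡ true → A fz (fs i) ≡ true
        nb i si = proj₂ (∧-true {R (fs i)} (subB-elim S R' h₁ i si))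
        cq : ∀ i j → ext true S i ≡ true → ext true S j ≡ true → i ≢ j → A i j ≡ true
        cq fz fz _ _ ne = ⊥-elim (ne refl)
        cq fz (fs j) _ sj _ = nb j sj
        cq (fs i) fz si _ _ = trans (symm sA (fs i) fz) (nb i si)
        cq (fs i) (fs j) si sj ne = cliqueB-elim A⁻ S h₃ i j si sj (λ e → ne (cong fs e))

kt-cl : ∀ t G → fact t * kt t G ≡ cl (adj G) t full
kt-cl t G = trans (cong (fact t *_) (trans (countSubsets-cong {n G} pt) (count-cliques (adj-simple G) t full)))
  (ucl-cl (adj-simple G) t full)
  where
  pt : ∀ S → isCliqueᵇ G S ∧ (sizeᵇ S ≡ᵇ t) ≡ isIn (adj G) t full S
  pt S rewrite subB-intro S full (λ _ _ → refl) = cong (λ z → isCliqueᵇ G S ∧ (z ≡ᵇ t)) (sym (#-def S))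

-- ρ is the graph of a bijection between S and R
record Matched {k l} (S : BSet k) (R : BSet l) (ρ : Fin k → Fin l → Bool) : Set where
  field
    row : ∀ x → # (ρ x) ≡ b2n (S x)
    col : ∀ y → # (λ x → ρ x y) ≡ b2n (R y)
open Matched

-- Every member of `S` has exactly one partner in `R` and conversely, so both counts become sums
-- over the pairs of `ρ`. Restricted to the links of two partners, `ρ` is again a matching.
cl-matched : ∀ {k l} {A : Rel₂ k} {B : Rel₂ l} t {S R ρ} → Matched S R ρ →
  (∀ {x y x' y'} → ρ x y ≡ true → ρ x' y' ≡ true → A x x' ≡ B y y') → cl A t S ≡ cl B t R
cl-matched zero m h = refl
cl-matched {A = A} {B} (suc t) {S} {R} {ρ} m h = begin
  ∑ (λ x → b2n (S x) * cl A t (S ∩ A x)) ≡⟨ sum-cong (λ x → trans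
    (cong (_* cl A t (S ∩ A x)) (trans (sym (row m x)) (count-sum (ρ x))))
    (sym (sum-*ʳ (cl A t (S ∩ A x)) (λ y → b2n (ρ x y))))) ⟩
  ∑ (λ x → ∑ (λ y → b2n (ρ x y) * cl A t (S ∩ A x))) ≡⟨ sum-cong (λ x → sum-cong (λ y → pt x y)) ⟩
  ∑ (λ x → ∑ (λ y → b2n (ρ x y) * cl B t (R ∩ B y))) ≡⟨ sum-swap (λ x y → b2n (ρ x y) * cl B t (R ∩ B y)) ⟩
  ∑ (λ y → ∑ (λ x → b2n (ρ x y) * cl B t (R ∩ B y))) ≡⟨ sum-cong
    (λ y → trans (sum-*ʳ (cl B t (R ∩ B y)) (λ x → b2n (ρ x y)))
    (cong (_* cl B t (R ∩ B y)) (trans (sym (count-sum (λ x → ρ x y))) (col m y)))) ⟩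
  ∑ (λ y → b2n (R y) * cl B t (R ∩ B y)) ∎
  where
  open ≡-Reasoning
  pt : ∀ x y → b2n (ρ x y) * cl A t (S ∩ A x) ≡ b2n (ρ x y) * cl B t (R ∩ B y)
  pt x y with ρ x y in e
  ... | false = refl
  ... | true = cong (1 *_) (cl-matched {A = A} {B} t {ρ = ρ'} m'
    (λ p q → h (proj₁ (∧-true {ρ _ _} p)) (proj₁ (∧-true {ρ _ _} q))))
    where
    ρ' : _ → _ → Bool
    ρ' x' y' = ρ x' y' ∧ A x x'
    m' : Matched (S ∩ A x) (R ∩ B y) ρ'
    row m' x' with A x x'
    ... | true = trans (count-cong (λ y' → ∧-identityʳ (ρ x' y')))
      (trans (row m x') (cong b2n (sym (∧-identityʳ (S x')))))
    ... | false = trans (count-zero _ (λ y' → ∧-zeroʳ (ρ x' y'))) (cong b2n (sym (∧-zeroʳ (S x'))))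
    col m' y' with B y y' in e'
    ... | true = trans (count-cong q) (trans (col m y') (cong b2n (sym (∧-identityʳ (R y')))))
      where
      q : ∀ x' → ρ x' y' ∧ A x x' ≡ ρ x' y'
      q x' with ρ x' y' in e₁
      ... | false = refl
      ... | true = trans (h e e₁) e'
    ... | false = trans (count-zero _ q) (cong b2n (sym (∧-zeroʳ (R y'))))
      where
      q : ∀ x' → ρ x' y' ∧ A x x' ≡ false
      q x' with ρ x' y' in e₁
      ... | false = refl
      ... | true = trans (h e e₁) e'

count-eqᵇ : ∀ {k} (x : Fin k) → # (eqᵇ x) ≡ 1
count-eqᵇ x = trans (count-split (eqᵇ x) x) (cong₂ _+_ (count-zero _ z) (cong b2n (eqᵇ-refl x)))
  where
  z : ∀ y → (eqᵇ x \\ x) y ≡ false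
  z y with eqᵇ x y
  ... | true = refl
  ... | false = refl

module _ (G H : Graph) (iso : G ≃ H) where
  open _≃_ iso
  private
    A = adj G
    B = adj H

    -- The isomorphism is defined only at a vertex with a proof that it is not isolated. The Boolean
    -- and its equation are arguments so that a case distinction on them leaves this proof
    -- available.
    ρ-aux : ∀ x b → NI A x ≡ b → BSet (n H)
    ρ-aux x false e y = false
    ρ-aux x true  e y = eqᵇ (f x (NI-elim A e)) y

    ρ : Fin (n G) → Fin (n H) → Bool
    ρ x = ρ-aux x (NI A x) refl

    ρ-elim : ∀ x b e y → ρ-aux x b e y ≡ true → Σ (NonIso G x) λ p → f x p ≡ y
    ρ-elim x true e y h = NI-elim A e , eqᵇ-true h

    ρ-intro : ∀ x b e y → (∀ p → f x p ≡ y) → NonIso G x → ρ-aux x b e y ≡ true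
    ρ-intro x false e y h (z , p) = ⊥-elim (false≢true (NI-false A e z) p)
    ρ-intro x true  e y h _ = trans (cong (λ w → eqᵇ w y) (h _)) (eqᵇ-refl y)

    m : Matched (NI A) (NI B) ρ
    row m x = go (NI A x) refl
      where
      go : ∀ b e → # (ρ-aux x b e) ≡ b2n b
      go false e = count-zero _ (λ _ → refl)
      go true  e = count-eqᵇ _
    col m y = go (NI B y) refl
      where
      go : ∀ b → NI B y ≡ b → # (λ x → ρ x y) ≡ b2n b
      go false e = count-zero _ (λ x → ¬true (λ h → absurd x h))
        where
        absurd : ∀ x → ρ x y ≡ true → ⊥
        absurd x h with ρ-elim x (NI A x) refl y h
        ... | p , refl with f-ni x p
        ... | z , q = false≢true (NI-false B e z) q
      go true e = trans (count-cong eqv) (count-eqᵇ x₀)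
        where
        x₀ = g y (NI-elim B e)
        eqv : ∀ x → ρ x y ≡ eqᵇ x₀ x
        eqv x = bool-ext to from
          where
          to : ρ x y ≡ true → eqᵇ x₀ x ≡ true
          to h with ρ-elim x (NI A x) refl y h
          ... | p , refl = trans (cong (λ w → eqᵇ w x) (gf x p (NI-elim B e))) (eqᵇ-refl x)
          from : eqᵇ x₀ x ≡ true → ρ x y ≡ true
          from h with eqᵇ-true {i = x₀} h
          ... | refl = ρ-intro x₀ (NI A x₀) refl y (λ p → fg y (NI-elim B e) p) (g-ni y (NI-elim B e))

  -- Cliques of order at least 2 contain no isolated vertices, so a matching of the non-isolated
  -- ones is enough.
  cl-≃ : ∀ a → cl A (2 + a) full ≡ cl B (2 + a) full
  cl-≃ a = trans (cl-NI (adj-simple G) a) (trans (cl-matched {A = A} {B} (2 + a) m pres)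
    (sym (cl-NI (adj-simple H) a)))
    where
    pres : ∀ {x y x' y'} → ρ x y ≡ true → ρ x' y' ≡ true → A x x' ≡ B y y'
    pres {x} {y} {x'} {y'} h h' with ρ-elim x (NI A x) refl y h | ρ-elim x' (NI A x') refl y' h'
    ... | p , refl | p' , refl = sym (adj-pres x x' p p')

module _ (G H : Graph) where
  private
    U = adj (G ∪ H)

    inl : BSet (n G + n H)
    inl u with splitAt (n G) u
    ... | inj₁ _ = true
    ... | inj₂ _ = false

  cl-∪ : ∀ t → cl (adj (G ∪ H)) (suc t) full ≡ cl (adj G) (suc t) full + cl (adj H) (suc t) full
  cl-∪ t = trans (cl-comp (adj-simple (G ∪ H)) inl nc t) (cong₂ _+_
    (sym (cl-matched {A = adj G} {U} (suc t) mˡ presˡ)) (sym (cl-matched {A = adj H} {U} (suc t) mʳ presʳ)))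
    where
    nc : NoCross U inl
    nc x y xx xy with splitAt (n G) x | splitAt (n G) y
    ... | inj₁ _ | inj₁ _ = refl
    ρˡ : Fin (n G) → Fin (n G + n H) → Bool
    ρˡ x u = eqᵇ (x ↑ˡ n H) u
    ρʳ : Fin (n H) → Fin (n G + n H) → Bool
    ρʳ x u = eqᵇ (n G ↑ʳ x) u
    mˡ : Matched full inl ρˡ
    row mˡ x = count-eqᵇ _
    col mˡ u with splitAt (n G) u in e
    ... | inj₁ x₀ = trans (count-cong q) (count-eqᵇ x₀)
      where
      q : ∀ x → eqᵇ (x ↑ˡ n H) u ≡ eqᵇ x₀ x
      q x = bool-ext (λ h → trans (cong (eqᵇ x₀) (↑ˡ-injective (n H) x x₀
        (trans (eqᵇ-true h) (sym (splitAt⁻¹-↑ˡ e))))) (eqᵇ-refl x₀))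
        (λ h → trans (cong (λ w → eqᵇ (w ↑ˡ n H) u) (sym (eqᵇ-true {i = x₀} h)))
          (trans (cong (λ w → eqᵇ w u) (splitAt⁻¹-↑ˡ e)) (eqᵇ-refl u)))
    ... | inj₂ y₀ = count-zero _ (λ x → eqᵇ-false (λ { refl → absurd x e }))
      where
      absurd : ∀ x → splitAt (n G) (x ↑ˡ n H) ≡ inj₂ y₀ → ⊥
      absurd x e' with trans (sym (splitAt-↑ˡ (n G) x (n H))) e'
      ... | ()
    mʳ : Matched full (not ∘ inl) ρʳ
    row mʳ x = count-eqᵇ _
    col mʳ u with splitAt (n G) u in e
    ... | inj₂ x₀ = trans (count-cong q) (count-eqᵇ x₀)
      where
      q : ∀ x → eqᵇ (n G ↑ʳ x) u ≡ eqᵇ x₀ x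
      q x = bool-ext (λ h → trans (cong (eqᵇ x₀) (↑ʳ-injective (n G) x x₀
        (trans (eqᵇ-true h) (sym (splitAt⁻¹-↑ʳ e))))) (eqᵇ-refl x₀))
        (λ h → trans (cong (λ w → eqᵇ (n G ↑ʳ w) u) (sym (eqᵇ-true {i = x₀} h)))
          (trans (cong (λ w → eqᵇ w u) (splitAt⁻¹-↑ʳ e)) (eqᵇ-refl u)))
    ... | inj₁ y₀ = count-zero _ (λ x → eqᵇ-false (λ { refl → absurd x e }))
      where
      absurd : ∀ x → splitAt (n G) (n G ↑ʳ x) ≡ inj₁ y₀ → ⊥
      absurd x e' with trans (sym (splitAt-↑ʳ (n G) (n H) x)) e'
      ... | ()
    presˡ : ∀ {x u x' u'} → ρˡ x u ≡ true → ρˡ x' u' ≡ true → adj G x x' ≡ U u u'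
    presˡ {x} {u} {x'} {u'} h h' with eqᵇ-true h | eqᵇ-true h'
    ... | refl | refl rewrite splitAt-↑ˡ (n G) x (n H) | splitAt-↑ˡ (n G) x' (n H) = refl
    presʳ : ∀ {x u x' u'} → ρʳ x u ≡ true → ρʳ x' u' ≡ true → adj H x x' ≡ U u u'
    presʳ {x} {u} {x'} {u'} h h' with eqᵇ-true h | eqᵇ-true h'
    ... | refl | refl rewrite splitAt-↑ʳ (n G) (n H) x | splitAt-↑ʳ (n G) (n H) x' = refl

-- Colex graphs and the equality case

record Enum {k} (S : BSet k) (c : ℕ) : Set where
  field
    elt : Fin c → Fin k
    elt-inj : ∀ {i j} → elt i ≡ elt j → i ≡ j
    elt-in : ∀ i → S (elt i) ≡ true
    elt-onto : ∀ x → S x ≡ true → ∃ λ i → elt i ≡ x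
open Enum

enum : ∀ {k} (S : BSet k) c → # S ≡ c → Enum S c
enum {zero} S c e with trans (sym e) (#-def S)
... | refl = record { elt = λ () ; elt-inj = λ { {()} } ; elt-in = λ () ; elt-onto = λ () }
enum {suc k} S c e with S fz in ez | trans (sym e) (count-suc S)
... | false | e' = record
  { elt = λ i → fs (elt E i)
  ; elt-inj = λ h → elt-inj E (fs-injective h)
  ; elt-in = elt-in E
  ; elt-onto = λ { fz p → ⊥-elim (false≢true ez p) ; (fs x) p → proj₁ (elt-onto E x p) , cong fs
    (proj₂ (elt-onto E x p)) }
  }
  where E = enum (S ∘ fs) c (sym e')
... | true | refl = record
  { elt = λ { fz → fz ; (fs i) → fs (elt E i) }
  ; elt-inj = λ { {fz} {fz} h → refl ; {fs i} {fs j} h → cong fs (elt-inj E (fs-injective h)) }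
  ; elt-in = λ { fz → ez ; (fs i) → elt-in E i }
  ; elt-onto = λ { fz p → fz , refl ; (fs x) p → fs (proj₁ (elt-onto E x p)) , cong fs (proj₂ (elt-onto E x p)) }
  }
  where E = enum (S ∘ fs) _ refl

module _ (G H : Graph) {m} (e : Fin m → Fin (n G)) (e' : Fin m → Fin (n H))
  (inj : ∀ {i j} → e i ≡ e j → i ≡ j) (inj' : ∀ {i j} → e' i ≡ e' j → i ≡ j)
  (cover : ∀ x → NonIso G x → ∃ λ i → e i ≡ x) (cover' : ∀ y → NonIso H y → ∃ λ i → e' i ≡ y)
  (same-adj : ∀ i j → adj G (e i) (e j) ≡ adj H (e' i) (e' j)) where

  ≃-by-labels : G ≃ H
  ≃-by-labels = record
    { f = λ v p → e' (proj₁ (cover v p))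
    ; g = λ w p → e (proj₁ (cover' w p))
    ; f-ni = λ v p → f-ni v p
    ; g-ni = λ w p → g-ni w p
    ; gf = λ v p p' → trans (cong e (inj' (proj₂ (cover' _ p')))) (proj₂ (cover v p))
    ; fg = λ w p p' → trans (cong e' (inj (proj₂ (cover _ p')))) (proj₂ (cover' w p))
    ; adj-pres = λ u v p p' → trans (sym (same-adj _ _)) (cong₂ (adj G) (proj₂ (cover u p)) (proj₂ (cover v p')))
    }
    where
    f-ni : ∀ v p → NonIso H (e' (proj₁ (cover v p)))
    f-ni v p@(u , vu) with cover u (v , trans (adj-sym G u v) vu)
    ... | j , ej = e' j , trans (sym (same-adj _ j)) (trans (cong₂ (adj G) (proj₂ (cover v p)) ej) vu)
    g-ni : ∀ w p → NonIso G (e (proj₁ (cover' w p)))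
    g-ni w p@(u , wu) with cover' u (w , trans (adj-sym H u w) wu)
    ... | j , ej = e j , trans (same-adj _ j) (trans (cong₂ (adj H) (proj₂ (cover' w p)) ej) wu)

cl-complete : ∀ {k} {A : Rel₂ k} → Simple A → ∀ t S → (∀ x y → S x ≡ true → S y ≡ true → x ≢ y → A x y ≡ true) → cl
  A t S ≡ ff (# S) t
cl-complete sA zero    S h = refl
cl-complete {A = A} sA (suc t) S h with # S in eqS
... | zero = cl-empty A t S (count-zero⁻ S eqS)
... | suc c = trans (sum-cong pt) (trans (sum-*ʳ (ff c t) (λ x → b2n (S x)))
  (cong (_* ff c t) (trans (sym (count-sum S)) eqS)))
  where
  pt : ∀ x → b2n (S x) * cl A t (S ∩ A x) ≡ b2n (S x) * ff c t
  pt x with S x in e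
  ... | false = refl
  ... | true = cong (1 *_) (trans (cl-complete sA t (S ∩ A x)
    (λ y z p q → h y z (proj₁ (∧-true p)) (proj₁ (∧-true q))))
        (cong (λ z → ff z t) (trans (count-cong q) (suc-injective (trans (sym (count-∈ S x e)) eqS)))))
    where
    q : ∀ y → S y ∧ A x y ≡ S y ∧ not (eqᵇ x y)
    q y with S y in e' | eqᵇ x y in e''
    ... | false | _ = refl
    ... | true | true = trans (cong (A x) (sym (eqᵇ-true {i = x} e''))) (irr sA x)
    ... | true | false = h x y e e' (eqᵇ-≢ e'')

cl-restrict : ∀ {k} {A : Rel₂ k} → Simple A → ∀ a S W → (∀ x → W x ≡ true → S x ≡ true) →
  (∀ x y → S x ≡ true → S y ≡ true → A x y ≡ true → W x ≡ true) → cl A (2 + a) S ≡ cl A (2 + a) W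
cl-restrict {k} {A} sA a S W W⊂S h = sum-cong pt
  where
  pt : ∀ x → b2n (S x) * cl A (suc a) (S ∩ A x) ≡ b2n (W x) * cl A (suc a) (W ∩ A x)
  pt x with W x in ew | S x in es
  ... | true | false = ⊥-elim (false≢true es (W⊂S x ew))
  ... | false | false = refl
  ... | false | true = trans (+-identityʳ _) (cl-empty A a (S ∩ A x)
    (λ y → ¬true (λ p → false≢true ew (h x y es (proj₁ (∧-true p)) (proj₂ (∧-true {S y} p))))))
  ... | true | true = cong (1 *_) (cl-cong (suc a) (λ y → bool-ext
      (λ p → ∧-intro (h y x (proj₁ (∧-true p)) es (trans (symm sA y x) (proj₂ (∧-true {S y} p))))
        (proj₂ (∧-true {S y} p)))
      (λ p → ∧-intro (W⊂S y (proj₁ (∧-true p))) (proj₂ (∧-true {W y} p)))))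

C2-tri : ∀ a → a C 2 ≡ tri a
C2-tri zero    = refl
C2-tri (suc a) = trans (sym (nCk+nC[k+1]≡[n+1]C[k+1] a 1)) (cong₂ _+_ (nC1≡n a) (C2-tri a))

count-below : ∀ m c → c ≤ m → # {m} (λ y → toℕ y <ᵇ c) ≡ c
count-below zero    zero z≤n = count-zero _ (λ ())
count-below (suc m) zero z≤n = count-zero _ (λ _ → refl)
count-below (suc m) (suc c) (s≤s le) = trans (count-suc (λ y → toℕ y <ᵇ suc c)) (cong suc (count-below m c le))

module Colex (R s : ℕ) (s<R : s < R) where
  b = tri R + s

  pos-order : ∀ {x y} → x < y → colexPos x y ≡ tri y + x
  pos-order {x} {y} l = cong₂ _+_ (trans (cong (_C 2) (m≤n⇒m⊔n≡n (<⇒≤ l))) (C2-tri y)) (m≤n⇒m⊓n≡m (<⇒≤ l))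

  pos-< : ∀ x y → x < y → (colexPos x y <ᵇ b) ≡ true → y < R ⊎ (y ≡ R × x < s)
  pos-< x y l h with <-cmp y R
  ... | tri< p _ _ = inj₁ p
  ... | tri≈ _ refl _ = inj₂ (refl , +-cancelˡ-< (tri y) x s (subst (_< b) (pos-order l) (<ᵇ⇒< _ _ (→T h))))
  ... | tri> _ _ p = ⊥-elim (<⇒≱ (subst (_< b) (pos-order l) (<ᵇ⇒< _ _ (→T h)))
        (≤-trans (≤-trans (+-monoʳ-≤ (tri R) (<⇒≤ s<R)) (≤-reflexive (+-comm (tri R) R)))
          (≤-trans (tri-mono p) (m≤m+n (tri y) x))))

  pos-inside : ∀ x y → x < y → y < R → (colexPos x y <ᵇ b) ≡ true
  pos-inside x y l p = T→ (<⇒<ᵇ (subst (_< b) (sym (pos-order l)) (<-≤-trans (+-monoʳ-< (tri y) l)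
    (≤-trans (≤-reflexive (+-comm (tri y) y)) (≤-trans (tri-mono p) (m≤m+n (tri R) s))))))

  pos-last : ∀ x → x < s → (colexPos x R <ᵇ b) ≡ true
  pos-last x l = T→ (<⇒<ᵇ (subst (_< b) (sym (pos-order (<-trans l s<R))) (+-monoʳ-< (tri R) l)))

  private A = adj (colex b)

  R<2+b : R < 2 + b
  R<2+b = go R s<R
    where
    go : ∀ R → s < R → R < 2 + (tri R + s)
    go (suc r) _ = s≤s (s≤s (≤-trans (m≤m+n r (tri r)) (m≤m+n (tri (suc r)) s)))

  -- Label `fz` is the vertex outside the clique, at number `R`; the labels `fs i` are the clique.
  lab : Fin (suc R) → Fin (2 + b)
  lab fz     = fromℕ< R<2+b
  lab (fs i) = fromℕ< (<-trans (toℕ<n i) R<2+b)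

  lab-top : toℕ (lab fz) ≡ R
  lab-top = toℕ-fromℕ< _

  lab-low : ∀ i → toℕ (lab (fs i)) ≡ toℕ i
  lab-low i = toℕ-fromℕ< _

  lab-inj : ∀ {i j} → lab i ≡ lab j → i ≡ j
  lab-inj {fz}   {fz}   e = refl
  lab-inj {fz}   {fs j} e = ⊥-elim (<⇒≢ (toℕ<n j) (trans (sym (lab-low j)) (trans (cong toℕ (sym e)) lab-top)))
  lab-inj {fs i} {fz}   e = ⊥-elim (<⇒≢ (toℕ<n i) (trans (sym (lab-low i)) (trans (cong toℕ e) lab-top)))
  lab-inj {fs i} {fs j} e = cong fs (toℕ-injective (trans (sym (lab-low i)) (trans (cong toℕ e) (lab-low j))))

  edge-cases : ∀ x y → A x y ≡ true → (toℕ x < R × toℕ y < R) ⊎ ((toℕ x ≡ R × toℕ y < s) ⊎ (toℕ y ≡ R × toℕ x < s))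
  edge-cases x y h with ∧-true {not (eqᵇ x y)} h
  ... | ne , p with <-cmp (toℕ x) (toℕ y)
  ... | tri≈ _ e _ = ⊥-elim (eqᵇ-≢ (not-true ne) (toℕ-injective e))
  ... | tri< l _ _ with pos-< (toℕ x) (toℕ y) l p
  ... | inj₁ q = inj₁ (<-trans l q , q)
  ... | inj₂ (e , q) = inj₂ (inj₂ (e , q))
  edge-cases x y h | ne , p | tri> _ _ l with pos-< (toℕ y) (toℕ x) l
    (subst (λ z → (z <ᵇ b) ≡ true) (colexPos-sym (toℕ x) (toℕ y)) p)
  ... | inj₁ q = inj₁ (q , <-trans l q)
  ... | inj₂ (e , q) = inj₂ (inj₁ (e , q))

  edge-low : ∀ x y → x ≢ y → toℕ x < R → toℕ y < R → A x y ≡ true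
  edge-low x y ne p q with <-cmp (toℕ x) (toℕ y)
  ... | tri≈ _ e _ = ⊥-elim (ne (toℕ-injective e))
  ... | tri< l _ _ = ∧-intro (not-false (eqᵇ-false ne)) (pos-inside _ _ l q)
  ... | tri> _ _ l = ∧-intro (not-false (eqᵇ-false ne)) (subst (λ z → (z <ᵇ b) ≡ true)
    (colexPos-sym (toℕ y) (toℕ x)) (pos-inside _ _ l p))

  edge-top : ∀ x y → toℕ x ≡ R → toℕ y < s → A x y ≡ true
  edge-top x y e q = ∧-intro (not-false (eqᵇ-false (λ { refl → <⇒≢ (<-trans q s<R) e })))
    (subst (λ z → (z <ᵇ b) ≡ true) (trans (cong (λ w → colexPos (toℕ y) w) (sym e)) (colexPos-sym (toℕ y) (toℕ x)))
      (pos-last (toℕ y) q))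

  lab-cover : ∀ y → NonIso (colex b) y → ∃ λ i → lab i ≡ y
  lab-cover y (u , h) with edge-cases y u h
  ... | inj₁ (p , _) = fs (fromℕ< p) , toℕ-injective (trans (lab-low (fromℕ< p)) (toℕ-fromℕ< p))
  ... | inj₂ (inj₁ (e , _)) = fz , toℕ-injective (trans lab-top (sym e))
  ... | inj₂ (inj₂ (_ , q)) = fs (fromℕ< (<-trans q s<R)) , toℕ-injective
    (trans (lab-low (fromℕ< (<-trans q s<R))) (toℕ-fromℕ< (<-trans q s<R)))

  adj-low : ∀ i j → A (lab (fs i)) (lab (fs j)) ≡ not (eqᵇ i j)
  adj-low i j with i ≟F j
  ... | yes refl = irr (adj-simple (colex b)) (lab (fs i))
  ... | no ne = edge-low _ _ (λ e → ne (fs-injective (lab-inj e))) (subst (_< R) (sym (lab-low i)) (toℕ<n i))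
    (subst (_< R) (sym (lab-low j)) (toℕ<n j))

  adj-top : ∀ i → A (lab fz) (lab (fs i)) ≡ (toℕ i <ᵇ s)
  adj-top i = bool-ext to (λ h → edge-top _ _ lab-top (subst (_< s) (sym (lab-low i)) (<ᵇ⇒< _ _ (→T h))))
    where
    to : A (lab fz) (lab (fs i)) ≡ true → (toℕ i <ᵇ s) ≡ true
    to h with edge-cases (lab fz) (lab (fs i)) h
    ... | inj₁ (p , _) = ⊥-elim (<⇒≢ p lab-top)
    ... | inj₂ (inj₁ (_ , q)) = T→ (<⇒<ᵇ (subst (_< s) (lab-low i) q))
    ... | inj₂ (inj₂ (e , _)) = ⊥-elim (<⇒≢ (toℕ<n i) (trans (sym (lab-low i)) e))

  -- Delete the vertex `R`: what remains is a clique on the first `R` vertices, and the link is a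
  -- clique on the first `s`.
  cl-colex : ∀ a → cl A (2 + a) full ≡ val (suc a) R s
  cl-colex a = trans (cl-del sA (suc a) full x₀) (cong₂ (λ p q → p + (2 + a) * q)
      (trans (cl-restrict sA a (full \\ x₀) W W⊂ edgeW) (trans
        (cl-complete sA (2 + a) W (λ x y p q ne → edge-low x y ne (<ᵇ⇒< _ _ (→T p)) (<ᵇ⇒< _ _ (→T q))))
        (cong (λ z → ff z (2 + a)) (count-below (2 + b) R (<⇒≤ R<2+b)))))
      (trans (+-identityʳ _) (trans (cl-cong (suc a) nb) (trans
        (cl-complete sA (suc a) V (λ x y p q ne → edge-low x y ne (<-trans (<ᵇ⇒< _ _ (→T p)) s<R)
        (<-trans (<ᵇ⇒< _ _ (→T q)) s<R))) (cong (λ z → ff z (suc a))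
        (count-below (2 + b) s (≤-trans (<⇒≤ s<R) (<⇒≤ R<2+b))))))))
    where
    sA = adj-simple (colex b)
    x₀ = lab fz
    W V : BSet (2 + b)
    W y = toℕ y <ᵇ R
    V y = toℕ y <ᵇ s
    nb : ∀ y → A x₀ y ≡ V y
    nb y = bool-ext to (λ h → edge-top x₀ y lab-top (<ᵇ⇒< _ _ (→T h)))
      where
      to : A x₀ y ≡ true → V y ≡ true
      to h with edge-cases x₀ y h
      ... | inj₁ (p , _) = ⊥-elim (<⇒≢ p lab-top)
      ... | inj₂ (inj₁ (_ , q)) = T→ (<⇒<ᵇ q)
      ... | inj₂ (inj₂ (_ , q)) = ⊥-elim (<⇒≢ (<-trans q s<R) lab-top)
    W⊂ : ∀ x → W x ≡ true → (full \\ x₀) x ≡ true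
    W⊂ x h = not-false (eqᵇ-false {i = x₀} (λ { refl → <⇒≢ (<ᵇ⇒< _ _ (→T h)) lab-top }))
    edgeW : ∀ x y → (full \\ x₀) x ≡ true → (full \\ x₀) y ≡ true → A x y ≡ true → W x ≡ true
    edgeW x y p q h with edge-cases x y h
    ... | inj₁ (l , _) = T→ (<⇒<ᵇ l)
    ... | inj₂ (inj₁ (e , _)) = ⊥-elim (eqᵇ-≢ (not-true p) (toℕ-injective (trans lab-top (sym e))))
    ... | inj₂ (inj₂ (_ , l)) = T→ (<⇒<ᵇ (<-trans l s<R))

ff-2 : ∀ x → ff x 2 ≡ 2 * tri x
ff-2 zero = refl
ff-2 (suc zero) = refl
ff-2 (suc (suc x)) = trans (cong (suc (suc x) *_) (*-identityʳ (suc x))) (sym (2tri (suc x)))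

clique-of-max : ∀ {k} {A : Rel₂ k} → Simple A → ∀ a S → 2 + a ≤ # S → ff (# S) (2 + a) ≤ cl A (2 + a) S → Clique A S
clique-of-max {A = A} sA a S le h x y sx sy ne with A x y in e
... | true = refl
... | false = ⊥-elim (<⇒≱ (nonclique-< sA a S x y sx sy ne e le) h)

isolate : (G : Graph) → Fin (n G) → Graph
isolate G x = starOff G x (adj G x)

isolate-degSum : ∀ G x → degSum (adj G) ≡ degSum (adj (isolate G x)) + 2 * # (adj G x)
isolate-degSum G x = star-degSum G x (adj G x) (λ _ p → p)

isolate-cl : ∀ G x a → cl (adj G) (suc a) full ≤ cl (adj (isolate G x)) (suc a) full + suc a * cl (adj G) a (adj G x)
isolate-cl G x a = star-cl G x (adj G x) a

isolate-keep : ∀ G x u w → eqᵇ x u ≡ false → eqᵇ x w ≡ false → adj (isolate G x) u w ≡ adj G u w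
isolate-keep G x u w p q rewrite p | q = ∧-identityʳ _

-- Equality is traced through the proof of `kruskal-katona`. On at most `suc r` vertices the edges
-- leave no pair non-adjacent. Otherwise take a vertex of degree `d ≤ r`: if `d ≤ s`, isolating it
-- leaves an extremal graph with the same `r`; if `d > s`, strict convexity forces `d = r` and a
-- complete link, so its closed neighbourhood is the clique.
kruskal-katona-equality : ∀ m a (G : Graph) r s → degSum (adj G) ≡ 2 * (tri (suc r) + s) → s ≤ r → 2 + a ≤ r → tri
  (suc r) + s ≤ m →
  val (2 + a) (suc r) s ≤ cl (adj G) (3 + a) full → ∃ λ X → # X ≡ suc r × Clique (adj G) X
kruskal-katona-equality m a G r s eq s≤r a≤r le h with n₀ (adj G) ≤? suc r
... | yes p = NI A , size , clique-of-max sA 0 (NI A) (≤-trans (s≤s (≤-trans (s≤s z≤n) a≤r)) (≤-reflexive (sym size)))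
      (≤-trans (≤-reflexive (trans (cong (λ z → ff z 2) size) (ff-2 (suc r))))
        (≤-trans (*-monoʳ-≤ 2 (m≤m+n (tri (suc r)) s)) (≤-reflexive (trans (sym eq) e2NI))))
  where
  A = adj G
  sA = adj-simple G
  e2NI : degSum A ≡ cl A 2 (NI A)
  e2NI = trans (sym (cl-2 A)) (cl-NI sA 0)
  size : n₀ A ≡ suc r
  size with m≤n⇒m<n∨m≡n p
  ... | inj₂ e = e
  ... | inj₁ (s≤s lt) = ⊥-elim (<⇒≱ (small r (≤-trans (s≤s z≤n) a≤r))
    (≤-trans (m≤m+n (tri (suc r)) s) (*-cancelˡ-≤ 2 (≤-trans (≤-reflexive (trans (sym eq) e2NI))
    (≤-trans (cl-≤-ff A (irr sA) 2 (NI A)) (≤-trans (≤-reflexive (ff-2 (n₀ A))) (*-monoʳ-≤ 2 (tri-mono lt))))))))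
    where
    small : ∀ r → 1 ≤ r → tri r < tri (suc r)
    small (suc r) _ = s≤s (m≤n+m (tri (suc r)) r)
... | no ¬p with low-vertex (adj G) r s eq s≤r (≰⇒> ¬p)
... | v , 1≤d , d≤r = go (d ≤? s) m le
  where
  A = adj G
  sA = adj-simple G
  t = 3 + a
  α = 2 + a
  d = # (A v)
  H = isolate G v
  τ = cl A α (A v)
  τ≤ : τ ≤ ff d α
  τ≤ = cl-≤-ff A (irr sA) α (A v)
  upper : cl A t full ≤ cl (adj H) t full + t * τ
  upper = isolate-cl G v α
  go : _ → ∀ m → tri (suc r) + s ≤ m → ∃ λ X → # X ≡ suc r × Clique A X
  go (yes d≤s) zero le = ⊥-elim (<⇒≱ 1≤d (≤-trans d≤s (≤-trans (m≤n+m s (tri (suc r))) le)))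
  go (yes d≤s) (suc m) le with kruskal-katona-equality m a H r (s ∸ d)
    (edges-drop G H _ d (tri (suc r) + (s ∸ d)) eq (isolate-degSum G v) me) (≤-trans (m∸n≤m s d) s≤r) a≤r
        (≤-pred (≤-trans (≤-trans (≤-trans (≤-reflexive (+-comm 1 _)) (+-monoʳ-≤ _ 1≤d)) (≤-reflexive me)) le)) hH
    where
    me : tri (suc r) + (s ∸ d) + d ≡ tri (suc r) + s
    me = trans (+-assoc (tri (suc r)) _ d) (cong (tri (suc r) +_) (m∸n+n≡m d≤s))
    hH : val α (suc r) (s ∸ d) ≤ cl (adj H) t full
    hH = +-cancelʳ-≤ (t * ff d α) _ _ (≤-trans (≤-reflexive (ar (ff (suc r) t) t (ff (s ∸ d) α) (ff d α)))
      (≤-trans (+-monoʳ-≤ (ff (suc r) t) (*-monoʳ-≤ t (≤-trans (ff-super (s ∸ d) d (s≤s z≤n))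
        (≤-reflexive (cong (λ z → ff z α) (m∸n+n≡m d≤s))))))
        (≤-trans h (≤-trans upper (+-monoʳ-≤ (cl (adj H) t full) (*-monoʳ-≤ t τ≤))))))
      where
      ar : ∀ f t x y → f + t * x + t * y ≡ f + t * (x + y)
      ar = solve-∀
  ... | X , sz , cq = X , sz , λ x y px py ne → proj₁ (∧-true {A x y} (cq x y px py ne))
  go (no d≰s) _ _ = N[ A , v ] , trans (#-N[] sA v) (cong suc d≡r) , Clique-N[] sA nbr
    where
    r₁ = pred r
    1≤r : 1 ≤ r
    1≤r = ≤-trans 1≤d d≤r
    r≡ : suc r₁ ≡ r
    r≡ = suc-pred r {{>-nonZero 1≤r}}
    g = r ∸ d
    d+g : d + g ≡ r
    d+g = m+[n∸m]≡n d≤r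
    s<d : s < d
    s<d = ≰⇒> d≰s
    σ≤r₁ : s + g ≤ r₁
    σ≤r₁ = ≤-pred (≤-trans (+-monoˡ-≤ g s<d) (≤-reflexive (trans d+g (sym r≡))))
    me : tri (suc r₁) + (s + g) + d ≡ tri (suc r) + s
    me = trans (cong (λ z → tri z + (s + g) + d) r≡) (trans (ar (tri r) s g d) (cong (λ z → z + tri r + s) d+g))
      where
      ar : ∀ x s g d → x + (s + g) + d ≡ d + g + x + s
      ar = solve-∀
    kH : cl (adj H) t full ≤ val α r (s + g)
    kH = subst (λ z → cl (adj H) t full ≤ val α z (s + g)) r≡
      (kruskal-katona (tri (suc r₁) + (s + g)) (suc a) H r₁ (s + g)
        (edges-drop G H _ d (tri (suc r₁) + (s + g)) eq (isolate-degSum G v) me) σ≤r₁ ≤-refl)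
    main : ff r α + ff s α ≤ ff (s + g) α + τ
    main = *-cancelˡ-≤ t (+-cancelˡ-≤ (ff r t) _ _ (≤-trans (≤-reflexive
      (trans (ar₁ (ff r t) t (ff r α) (ff s α)) (cong (_+ t * ff s α) (sym (ff-pascal r α)))))
      (≤-trans h (≤-trans upper (≤-trans (+-monoˡ-≤ (t * τ) kH) (≤-reflexive (ar₂ (ff r t) t (ff (s + g) α) τ)))))))
      where
      ar₁ : ∀ f t x y → f + t * (x + y) ≡ f + t * x + t * y
      ar₁ = solve-∀
      ar₂ : ∀ f t x y → f + t * x + t * y ≡ f + t * (x + y)
      ar₂ = solve-∀
    g0 : g ≡ 0
    g0 = zero-g g refl
      where
      zero-g : ∀ g' → g ≡ g' → g' ≡ 0
      zero-g zero _ = refl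
      zero-g (suc g') e = ⊥-elim (<⇒≱ (subst₂ (λ u z → ff (s + u) α + ff d α < ff s α + ff z α) (sym e)
        (trans (cong (d +_) (sym e)) d+g)
            (ff-conv< (suc a) g' s<d (s≤s z≤n) (≤-pred (≤-trans a≤r
              (≤-reflexive (trans (sym d+g) (trans (cong (d +_) e) (+-suc d g'))))))))
          (≤-trans (≤-reflexive (+-comm (ff s α) (ff r α))) (≤-trans main (+-monoʳ-≤ (ff (s + g) α) τ≤))))
    d≡r : d ≡ r
    d≡r = trans (sym (+-identityʳ d)) (trans (cong (d +_) (sym g0)) d+g)
    τ≥ : ff d α ≤ τ
    τ≥ = +-cancelˡ-≤ (ff s α) _ _ (≤-trans (≤-reflexive (trans (+-comm (ff s α) _)
      (cong (λ z → ff z α + ff s α) d≡r))) (≤-trans main (≤-reflexive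
      (cong (λ z → ff z α + τ) (trans (cong (s +_) g0) (+-identityʳ s))))))
    nbr : Clique A (A v)
    nbr = clique-of-max sA a (A v) (≤-trans a≤r (≤-reflexive (sym d≡r))) τ≥

-- Listing `Y` first gives the neighbours of the extra vertex the numbers below `s`, as in the colex
-- graph.
enum-first : ∀ {k} (X Y : BSet k) s w R → s + w ≡ R → (∀ x → Y x ≡ true → X x ≡ true) → # Y ≡ s → # X ≡ R →
  Σ (Enum X R) λ E → ∀ i → Y (elt E i) ≡ (toℕ i <ᵇ s)
enum-first {k} X Y s w .(s + w) refl Y⊂X #Y #X = record { elt = e ; elt-inj = inj ; elt-in = mem ; elt-onto = onto }
  , order
  where
  Z : BSet k
  Z = X ∩ (not ∘ Y)
  EY = enum Y s #Y
  EZ = enum Z w (+-cancelˡ-≡ s (# Z) w (trans (cong (_+ # Z) (trans (sym #Y) (count-cong q)))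
    (trans (sym (count-⊕ X Y)) #X)))
    where
    q : ∀ x → Y x ≡ X x ∧ Y x
    q x with Y x in ey
    ... | false = sym (∧-zeroʳ _)
    ... | true rewrite Y⊂X x ey = refl
  pick : Fin s ⊎ Fin w → Fin k
  pick (inj₁ i) = elt EY i
  pick (inj₂ j) = elt EZ j
  e : Fin (s + w) → Fin k
  e i = pick (splitAt s i)
  notY : ∀ j → Y (elt EZ j) ≡ false
  notY j = not-true (proj₂ (∧-true {X (elt EZ j)} (elt-in EZ j)))
  inj : ∀ {i j} → e i ≡ e j → i ≡ j
  inj {i} {j} h with splitAt s i in ei | splitAt s j in ej
  ... | inj₁ x | inj₁ y = trans (sym (splitAt⁻¹-↑ˡ ei)) (trans (cong (_↑ˡ w) (elt-inj EY h)) (splitAt⁻¹-↑ˡ ej))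
  ... | inj₂ x | inj₂ y = trans (sym (splitAt⁻¹-↑ʳ ei)) (trans (cong (s ↑ʳ_) (elt-inj EZ h)) (splitAt⁻¹-↑ʳ ej))
  ... | inj₁ x | inj₂ y = ⊥-elim (false≢true (notY y) (trans (cong Y (sym h)) (elt-in EY x)))
  ... | inj₂ x | inj₁ y = ⊥-elim (false≢true (notY x) (trans (cong Y h) (elt-in EY y)))
  mem : ∀ i → X (e i) ≡ true
  mem i with splitAt s i
  ... | inj₁ x = Y⊂X _ (elt-in EY x)
  ... | inj₂ y = proj₁ (∧-true (elt-in EZ y))
  onto : ∀ x → X x ≡ true → ∃ λ i → e i ≡ x
  onto x px with Y x in ey
  ... | true = proj₁ (elt-onto EY x ey) ↑ˡ w , trans (cong pick (splitAt-↑ˡ s _ w)) (proj₂ (elt-onto EY x ey))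
  ... | false = s ↑ʳ proj₁ z , trans (cong pick (splitAt-↑ʳ s w _)) (proj₂ z)
    where z = elt-onto EZ x (∧-intro px (not-false ey))
  order : ∀ i → Y (e i) ≡ (toℕ i <ᵇ s)
  order i with splitAt s i in ei
  ... | inj₁ x = trans (elt-in EY x) (sym (T→ (<⇒<ᵇ (subst (_< s)
    (trans (sym (toℕ-↑ˡ x w)) (cong toℕ (splitAt⁻¹-↑ˡ ei))) (toℕ<n x)))))
  ... | inj₂ y = trans (notY y) (sym (¬true (λ h → <⇒≱ (<ᵇ⇒< _ _ (→T h))
    (≤-trans (m≤m+n s (toℕ y)) (≤-reflexive (trans (sym (toℕ-↑ʳ s y)) (cong toℕ (splitAt⁻¹-↑ʳ ei))))))))

enum-adj : ∀ {k c} {A : Rel₂ k} {X : BSet k} → Simple A → Clique A X → (E : Enum X c) → ∀ i j → A (elt E i)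
  (elt E j) ≡ not (eqᵇ i j)
enum-adj sA cq E i j with i ≟F j
... | yes refl = irr sA (elt E i)
... | no ne = cq _ _ (elt-in E i) (elt-in E j) (λ e → ne (elt-inj E e))

-- Some non-isolated `x` lies outside the clique `X`, as `X` carries only `tri (suc r)` edges.
-- Isolating `x` keeps these, so its degree is at most `s`; strict superadditivity makes it equal to
-- `s`, and then its link is complete.
colex-unique : ∀ a (G : Graph) r s → degSum (adj G) ≡ 2 * (tri (suc r) + s) → s ≤ r → 2 + a ≤ s →
  val (2 + a) (suc r) s ≤ cl (adj G) (3 + a) full → G ≃ colex (tri (suc r) + s)
colex-unique a G r s eq s≤r a≤s h with kruskal-katona-equality (tri (suc r) + s) a G r s eq s≤r (≤-trans a≤s s≤r)
  ≤-refl h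
... | X , #X , cqX with any? (λ x → (NI (adj G) x Data.Bool.≟ true) ×-dec (X x Data.Bool.≟ false))
... | no none = ⊥-elim (<⇒≱ (m<m+n (tri (suc r)) (≤-trans (s≤s z≤n) a≤s))
  (*-cancelˡ-≤ 2 (≤-trans (≤-reflexive (sym eq))
      (≤-trans (≤-reflexive (trans (sym (cl-2 A)) (cl-NI (adj-simple G) 0)))
        (≤-trans (cl-mono {A = A} 2 {NI A} {X} sb (λ _ _ p → p))
        (≤-reflexive (trans (cl-complete (adj-simple G) 2 X cqX)
          (trans (cong (λ z → ff z 2) #X) (ff-2 (suc r))))))))))
  where
  A = adj G
  sb : ∀ x → NI A x ≡ true → X x ≡ true
  sb x p with X x in e
  ... | true = refl
  ... | false = ⊥-elim (none (x , p , e))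
... | yes (x , nix , nx) = ≃-by-labels G (colex (tri (suc r) + s)) lbl Cx.lab lbl-inj Cx.lab-inj lbl-cover
  Cx.lab-cover same-adj
  where
  module Cx = Colex (suc r) s (s≤s s≤r)
  A = adj G
  sA = adj-simple G
  t = 3 + a
  α = 2 + a
  d = # (A x)
  τ = cl A α (A x)
  H = isolate G x
  1≤d : 1 ≤ d
  1≤d = count-point (A x) (proj₁ (NI-elim A nix)) (proj₂ (NI-elim A nix))
  keepX : Clique (adj H) X
  keepX u w pu pw ne = trans (isolate-keep G x u w (eqᵇ-false (λ { refl → false≢true nx pu }))
    (eqᵇ-false (λ { refl → false≢true nx pw }))) (cqX u w pu pw ne)
  inX : cl (adj H) 2 X ≡ 2 * tri (suc r)
  inX = trans (cl-complete (adj-simple H) 2 X keepX) (trans (cong (λ z → ff z 2) #X) (ff-2 (suc r)))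
  d≤s : d ≤ s
  d≤s = +-cancelˡ-≤ (tri (suc r)) d s (*-cancelˡ-≤ 2 (≤-trans (≤-reflexive (*-distribˡ-+ 2 (tri (suc r)) d))
    (≤-trans (+-monoˡ-≤ (2 * d) (≤-trans (≤-reflexive (sym inX))
      (≤-trans (cl-mono {A = adj H} 2 {X} {full} (λ _ _ → refl) (λ _ _ p → p)) (≤-reflexive (cl-2 (adj H))))))
      (≤-reflexive (trans (sym (isolate-degSum G x)) eq)))))
  me : tri (suc r) + (s ∸ d) + d ≡ tri (suc r) + s
  me = trans (+-assoc (tri (suc r)) _ d) (cong (tri (suc r) +_) (m∸n+n≡m d≤s))
  eH : degSum (adj H) ≡ 2 * (tri (suc r) + (s ∸ d))
  eH = edges-drop G H _ d (tri (suc r) + (s ∸ d)) eq (isolate-degSum G x) me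
  kH : cl (adj H) t full ≤ val α (suc r) (s ∸ d)
  kH = kruskal-katona (tri (suc r) + (s ∸ d)) (suc a) H r (s ∸ d) eH (≤-trans (m∸n≤m s d) s≤r) ≤-refl
  main : ff s α ≤ ff (s ∸ d) α + τ
  main = *-cancelˡ-≤ t (+-cancelˡ-≤ (ff (suc r) t) _ _ (≤-trans h
    (≤-trans (isolate-cl G x α) (≤-trans (+-monoˡ-≤ (t * τ) kH)
    (≤-reflexive (ar (ff (suc r) t) t (ff (s ∸ d) α) τ))))))
    where
    ar : ∀ f t x y → f + t * x + t * y ≡ f + t * (x + y)
    ar = solve-∀
  τ≤ : τ ≤ ff d α
  τ≤ = cl-≤-ff A (irr sA) α (A x)
  d≡s : d ≡ s
  d≡s with m≤n⇒m<n∨m≡n d≤s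
  ... | inj₂ e = e
  ... | inj₁ d<s = ⊥-elim (<⇒≱ lt (≤-trans main (≤-trans (+-monoʳ-≤ (ff (s ∸ d) α) τ≤)
    (≤-reflexive (+-comm (ff (s ∸ d) α) (ff d α))))))
    where
    d' = pred d
    d≡ : suc d' ≡ d
    d≡ = suc-pred d {{>-nonZero 1≤d}}
    lt : ff d α + ff (s ∸ d) α < ff s α
    lt = subst₂ (λ u z → ff u α + ff (s ∸ d) α < ff z α) d≡ (trans (cong (s ∸ d +_) d≡) (m∸n+n≡m d≤s))
      (ff-conv< (suc a) {0} {s ∸ d} d' (m<n⇒0<n∸m d<s) (s≤s z≤n)
        (≤-pred (≤-trans a≤s (≤-reflexive (trans (sym (m∸n+n≡m d≤s))
        (trans (cong (s ∸ d +_) (sym d≡)) (+-suc (s ∸ d) d')))))))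
  s∸d : s ∸ d ≡ 0
  s∸d = trans (cong (s ∸_) d≡s) (n∸n≡0 s)
  nbr : Clique A (A x)
  nbr = clique-of-max sA a (A x) (≤-trans a≤s (≤-reflexive (sym d≡s)))
    (≤-trans (≤-reflexive (cong (λ z → ff z α) d≡s)) (≤-trans main (≤-reflexive (cong (λ z → ff z α + τ) s∸d))))
  -- Once `x` is isolated exactly `tri (suc r)` edges are left, and `X` accounts for all of them.
  inside : ∀ u w → adj H u w ≡ true → X u ≡ true
  inside u w p with X u in e
  ... | true = refl
  ... | false = ⊥-elim (<⇒≱ small big)
    where
    small : degSum (adj H) < 2 * tri (suc r) + 2
    small = ≤-trans (s≤s (≤-reflexive (trans eH (cong (2 *_) (trans (cong (tri (suc r) +_) s∸d) (+-identityʳ _))))))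
      (≤-trans (≤-reflexive (+-comm 1 _)) (+-monoʳ-≤ (2 * tri (suc r)) (s≤s z≤n)))
    big : 2 * tri (suc r) + 2 ≤ degSum (adj H)
    big = ≤-trans (+-mono-≤ (≤-trans (≤-reflexive (sym inX))
      (cl-mono {A = adj H} 2 {X} {full \\ u} (λ y py → not-false (eqᵇ-false (λ { refl → false≢true e py })))
      (λ _ _ q → q)))
        (*-monoʳ-≤ 2 (≤-trans (count-point (adj H u) w p) (≤-trans (≤-reflexive (sym (cl-1 (adj H) (adj H u))))
          (m≤m+n _ 0)))))
      (≤-reflexive (trans (sym (cl-del (adj-simple H) 1 full u)) (cl-2 (adj H))))
  x≠ : ∀ y → A x y ≡ true → eqᵇ x y ≡ false
  x≠ y p = adj-≠ sA p
  -- Since `s ≥ 2` and the link of `x` is complete, `y` has another neighbour `z` in it; the edge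
  -- between them survives the isolation of `x`.
  Y⊂X : ∀ y → A x y ≡ true → X y ≡ true
  Y⊂X y p with count-pos (A x \\ y) (≤-pred (≤-trans (s≤s (s≤s z≤n))
    (≤-trans a≤s (≤-reflexive (trans (sym d≡s) (count-∈ (A x) y p))))))
  ... | z , q with ∧-true {A x z} q
  ... | xz , ne = inside y z (trans (isolate-keep G x y z (x≠ y p) (x≠ z xz)) (nbr y z p xz (eqᵇ-≢ (not-true ne))))
  EX = enum-first X (A x) s (suc r ∸ s) (suc r) (m+[n∸m]≡n (≤-trans s≤r (n≤1+n r))) Y⊂X d≡s #X
  E = proj₁ EX
  lbl : Fin (suc (suc r)) → Fin (n G)
  lbl fz     = x
  lbl (fs i) = elt E i
  lbl-inj : ∀ {i j} → lbl i ≡ lbl j → i ≡ j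
  lbl-inj {fz}   {fz}   _ = refl
  lbl-inj {fz}   {fs j} e = ⊥-elim (false≢true nx (trans (cong X e) (elt-in E j)))
  lbl-inj {fs i} {fz}   e = ⊥-elim (false≢true nx (trans (cong X (sym e)) (elt-in E i)))
  lbl-inj {fs i} {fs j} e = cong fs (elt-inj E e)
  lbl-cover : ∀ y → NonIso G y → ∃ λ i → lbl i ≡ y
  lbl-cover y (z , yz) with eqᵇ x y in ey
  ... | true = fz , eqᵇ-true ey
  ... | false = fs (proj₁ w) , proj₂ w
    where
    Xy : X y ≡ true
    Xy with eqᵇ x z in ez
    ... | false = inside y z (trans (isolate-keep G x y z ey ez) yz)
    ... | true = Y⊂X y (trans (symm sA x y) (trans (cong (A y) (eqᵇ-true {i = x} ez)) yz))
    w = elt-onto E y Xy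
  same-adj : ∀ i j → A (lbl i) (lbl j) ≡ adj (colex (tri (suc r) + s)) (Cx.lab i) (Cx.lab j)
  same-adj fz     fz     = trans (irr sA x) (sym (irr (adj-simple (colex (tri (suc r) + s))) (Cx.lab fz)))
  same-adj fz     (fs j) = trans (proj₂ EX j) (sym (Cx.adj-top j))
  same-adj (fs i) fz     = trans (symm sA _ x) (trans (proj₂ EX i)
    (trans (sym (Cx.adj-top i)) (symm (adj-simple (colex (tri (suc r) + s))) (Cx.lab fz) (Cx.lab (fs i)))))
  same-adj (fs i) (fs j) = trans (enum-adj sA cqX E i j) (sym (Cx.adj-low i j))

-- Composition of isomorphisms and splitting off a component K_{Δ+1}.

≃-refl : ∀ G → G ≃ G
≃-refl G = ≃-by-labels G G (λ v → v) (λ v → v) (λ e → e) (λ e → e) (λ x _ → x , refl) (λ x _ → x , refl)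
  (λ _ _ → refl)

≃-trans : ∀ {G H L} → G ≃ H → H ≃ L → G ≃ L
≃-trans {G} {H} {L} i j = record
  { f = λ v p → J.f (I.f v p) (I.f-ni v p)
  ; g = λ w p → I.g (J.g w p) (J.g-ni w p)
  ; f-ni = λ v p → J.f-ni _ _
  ; g-ni = λ w p → I.g-ni _ _
  ; gf = λ v p p' → back₁ v p _ (J.gf _ _ p') _
  ; fg = λ w p p' → back₂ w p _ (I.fg _ _ p') _
  ; adj-pres = λ u v p p' → trans (J.adj-pres _ _ _ _) (I.adj-pres u v p p')
  }
  where
  module I = _≃_ i
  module J = _≃_ j
  back₁ : ∀ v p w → w ≡ I.f v p → (q : NonIso H w) → I.g w q ≡ v
  back₁ v p w refl q = I.gf v p q
  back₂ : ∀ w p v → v ≡ J.g w p → (q : NonIso H v) → J.f v q ≡ w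
  back₂ w p v refl q = J.fg w p q

module _ (M G H : Graph) (iso : G ≃ H) where
  open _≃_ iso
  private
    SG : Fin (n M) ⊎ Fin (n G) → Fin (n M) ⊎ Fin (n G) → Bool
    SG = sumAdj (adj M) (adj G)
    SH : Fin (n M) ⊎ Fin (n H) → Fin (n M) ⊎ Fin (n H) → Bool
    SH = sumAdj (adj M) (adj H)

    nbG : ∀ {x} → (∃ λ w → SG (inj₂ x) w ≡ true) → NonIso G x
    nbG (inj₂ y , h) = y , h
    nbH : ∀ {x} → (∃ λ w → SH (inj₂ x) w ≡ true) → NonIso H x
    nbH (inj₂ y , h) = y , h

    φ : ∀ z → (∃ λ w → SG z w ≡ true) → Fin (n M) ⊎ Fin (n H)
    φ (inj₁ i) p = inj₁ i
    φ (inj₂ x) p = inj₂ (f x (nbG p))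
    ψ : ∀ z → (∃ λ w → SH z w ≡ true) → Fin (n M) ⊎ Fin (n G)
    ψ (inj₁ i) p = inj₁ i
    ψ (inj₂ x) p = inj₂ (g x (nbH p))

    φ-ni : ∀ z p → ∃ λ w → SH (φ z p) w ≡ true
    φ-ni (inj₁ i) (inj₁ j , h) = inj₁ j , h
    φ-ni (inj₂ x) p = inj₂ (proj₁ (f-ni x (nbG p))) , proj₂ (f-ni x (nbG p))
    ψ-ni : ∀ z p → ∃ λ w → SG (ψ z p) w ≡ true
    ψ-ni (inj₁ i) (inj₁ j , h) = inj₁ j , h
    ψ-ni (inj₂ x) p = inj₂ (proj₁ (g-ni x (nbH p))) , proj₂ (g-ni x (nbH p))

    ψφ : ∀ z p z' → z' ≡ φ z p → ∀ q → ψ z' q ≡ z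
    ψφ (inj₁ i) p _ refl q = refl
    ψφ (inj₂ x) p _ refl q = cong inj₂ (gf x (nbG p) (nbH q))
    φψ : ∀ z p z' → z' ≡ ψ z p → ∀ q → φ z' q ≡ z
    φψ (inj₁ i) p _ refl q = refl
    φψ (inj₂ x) p _ refl q = cong inj₂ (fg x (nbH p) (nbG q))

    φ-pres : ∀ z z' p p' → SH (φ z p) (φ z' p') ≡ SG z z'
    φ-pres (inj₁ i) (inj₁ j) p p' = refl
    φ-pres (inj₁ i) (inj₂ y) p p' = refl
    φ-pres (inj₂ x) (inj₁ j) p p' = refl
    φ-pres (inj₂ x) (inj₂ y) p p' = adj-pres x y (nbG p) (nbG p')

    downG : ∀ {u} → NonIso (M ∪ G) u → ∃ λ w → SG (splitAt (n M) u) w ≡ true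
    downG (w , h) = splitAt (n M) w , h
    downH : ∀ {u} → NonIso (M ∪ H) u → ∃ λ w → SH (splitAt (n M) u) w ≡ true
    downH (w , h) = splitAt (n M) w , h
    jG = join (n M) (n G)
    jH = join (n M) (n H)
    upG : ∀ z → (∃ λ w → SG z w ≡ true) → NonIso (M ∪ G) (jG z)
    upG z (w , h) = jG w , trans (cong₂ SG (splitAt-join (n M) (n G) z) (splitAt-join (n M) (n G) w)) h
    upH : ∀ z → (∃ λ w → SH z w ≡ true) → NonIso (M ∪ H) (jH z)
    upH z (w , h) = jH w , trans (cong₂ SH (splitAt-join (n M) (n H) z) (splitAt-join (n M) (n H) w)) h

  ∪-congʳ : (M ∪ G) ≃ (M ∪ H)
  ∪-congʳ = record
    { f = λ u p → jH (φ (splitAt (n M) u) (downG p))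
    ; g = λ u p → jG (ψ (splitAt (n M) u) (downH p))
    ; f-ni = λ u p → upH (φ (splitAt (n M) u) (downG p)) (φ-ni (splitAt (n M) u) (downG p))
    ; g-ni = λ u p → upG (ψ (splitAt (n M) u) (downH p)) (ψ-ni (splitAt (n M) u) (downH p))
    ; gf = λ u p p' → trans (cong jG (ψφ (splitAt (n M) u) (downG p) _ (splitAt-join (n M) (n H) _) _))
      (join-splitAt (n M) (n G) u)
    ; fg = λ u p p' → trans (cong jH (φψ (splitAt (n M) u) (downH p) _ (splitAt-join (n M) (n G) _) _))
      (join-splitAt (n M) (n H) u)
    ; adj-pres = λ u v p p' → trans (cong₂ SH (splitAt-join (n M) (n H) (φ (splitAt (n M) u) (downG p)))
      (splitAt-join (n M) (n H) (φ (splitAt (n M) v) (downG p'))))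
      (φ-pres (splitAt (n M) u) (splitAt (n M) v) (downG p) (downG p'))
    }

cl-K : ∀ k t → cl (adj (K k)) t full ≡ ff k t
cl-K k t = trans (cl-complete (adj-simple (K k)) t full (λ x y _ _ ne → not-false (eqᵇ-false ne)))
  (cong (λ z → ff z t) (count-full k))

cl-copies : ∀ q k L t → cl (adj (copiesK∪ q k L)) (suc t) full ≡ q * ff k (suc t) + cl (adj L) (suc t) full
cl-copies zero    k L t = refl
cl-copies (suc q) k L t = trans (cl-∪ (K k) (copiesK∪ q k L) t)
  (trans (cong₂ _+_ (cl-K k (suc t)) (cl-copies q k L t)) (sym (+-assoc (ff k (suc t)) (q * ff k (suc t)) _)))

relabel : (G : Graph) {c : ℕ} → (Fin c → Fin (n G)) → Graph
relabel G {c} e = record { n = c ; adj = λ i j → adj G (e i) (e j) ; adj-sym = λ i j → adj-sym G (e i) (e j) ;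
  adj-irrefl = λ i → adj-irrefl G (e i) }

sum-inj : ∀ {c k} (e : Fin c → Fin k) → (∀ {i j} → e i ≡ e j → i ≡ j) → (w : Fin k → ℕ) → ∑ (w ∘ e) ≤ ∑ w
sum-inj e inj w = begin
  ∑ (w ∘ e) ≡⟨ sum-cong (λ i → sym (sum-single (e i) w)) ⟩
  ∑ (λ i → ∑ (λ x → b2n (eqᵇ (e i) x) * w x)) ≡⟨ sum-swap (λ i x → b2n (eqᵇ (e i) x) * w x) ⟩
  ∑ (λ x → ∑ (λ i → b2n (eqᵇ (e i) x) * w x)) ≡⟨ sum-cong (λ x → trans (sum-*ʳ (w x) (λ i → b2n (eqᵇ (e i) x)))
    (cong (_* w x) (sym (count-sum (λ i → eqᵇ (e i) x))))) ⟩
  ∑ (λ x → # (λ i → eqᵇ (e i) x) * w x) ≤⟨ sum-mono (λ x → *-monoˡ-≤ (w x) (one x)) ⟩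
  ∑ (λ x → 1 * w x) ≡⟨ sum-cong (λ x → +-identityʳ (w x)) ⟩
  ∑ w ∎
  where
  open ≤-Reasoning
  one : ∀ x → # (λ i → eqᵇ (e i) x) ≤ 1
  one x with find (λ i → eqᵇ (e i) x)
  ... | inj₂ none = ≤-trans (≤-reflexive (count-zero _ none)) z≤n
  ... | inj₁ (i , h) = ≤-trans (count-mono {Q = eqᵇ i} (λ j h' → trans
    (cong (eqᵇ i) (inj (trans (eqᵇ-true h') (sym (eqᵇ-true h))))) (eqᵇ-refl i))) (≤-reflexive (count-eqᵇ i))

count-inj : ∀ {c k} (e : Fin c → Fin k) → (∀ {i j} → e i ≡ e j → i ≡ j) → (P : BSet k) → # (P ∘ e) ≤ # P
count-inj e inj P = subst₂ _≤_ (sym (count-sum (P ∘ e))) (sym (count-sum P)) (sum-inj e inj (b2n ∘ P))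

split-clique : ∀ (G : Graph) X k c → Clique (adj G) X → NoCross (adj G) X → Enum X k → (E' : Enum (not ∘ X) c) →
  G ≃ (K k ∪ relabel G (elt E'))
split-clique G X k c cq nc E E' = ≃-by-labels G (K k ∪ relabel G (elt E')) e (λ u → u) (λ {i} {j} h → e-inj i j h)
  (λ h → h) cover (λ u _ → u , refl) same-adj
  where
  A = adj G
  pick : Fin k ⊎ Fin c → Fin (n G)
  pick (inj₁ i) = elt E i
  pick (inj₂ j) = elt E' j
  e : Fin (k + c) → Fin (n G)
  e u = pick (splitAt k u)
  pick-inj : ∀ z w → pick z ≡ pick w → z ≡ w
  pick-inj (inj₁ i) (inj₁ j) h = cong inj₁ (elt-inj E h)
  pick-inj (inj₂ i) (inj₂ j) h = cong inj₂ (elt-inj E' h)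
  pick-inj (inj₁ i) (inj₂ j) h = ⊥-elim (false≢true (not-true (elt-in E' j)) (trans (cong X (sym h)) (elt-in E i)))
  pick-inj (inj₂ i) (inj₁ j) h = ⊥-elim (false≢true (not-true (elt-in E' i)) (trans (cong X h) (elt-in E j)))
  e-inj : ∀ u w → e u ≡ e w → u ≡ w
  e-inj u w h = trans (sym (join-splitAt k c u)) (trans (cong (join k c) (pick-inj (splitAt k u) (splitAt k w) h))
    (join-splitAt k c w))
  cover : ∀ x → NonIso G x → ∃ λ u → e u ≡ x
  cover x _ with X x in ex
  ... | true = join k c (inj₁ (proj₁ o)) , trans (cong pick (splitAt-join k c (inj₁ (proj₁ o)))) (proj₂ o)
    where o = elt-onto E x ex
  ... | false = join k c (inj₂ (proj₁ o)) , trans (cong pick (splitAt-join k c (inj₂ (proj₁ o)))) (proj₂ o)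
    where o = elt-onto E' x (not-false ex)
  pick-adj : ∀ z w → A (pick z) (pick w) ≡ sumAdj (adj (K k)) (adj (relabel G (elt E'))) z w
  pick-adj (inj₁ i) (inj₁ j) = enum-adj (adj-simple G) cq E i j
  pick-adj (inj₂ i) (inj₂ j) = refl
  pick-adj (inj₁ i) (inj₂ j) = ¬true (λ h → false≢true (not-true (elt-in E' j)) (nc _ _ (elt-in E i) h))
  pick-adj (inj₂ i) (inj₁ j) = ¬true (λ h → false≢true (not-true (elt-in E' i))
    (nc _ _ (elt-in E j) (trans (adj-sym G _ _) h)))
  same-adj : ∀ u w → A (e u) (e w) ≡ adj (K k ∪ relabel G (elt E')) u w
  same-adj u w = pick-adj (splitAt k u) (splitAt k w)

FullAt : ∀ {k} → Rel₂ k → ℕ → Fin k → Set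
FullAt A Δ v = # (A v) ≡ Δ × Clique A (A v)

full? : ∀ {k} (A : Rel₂ k) Δ → (∃ (FullAt A Δ)) ⊎ NoFull A Δ
full? A Δ with any? (λ v → (# (A v) ≟ Δ) ×-dec (cliqueB A (A v) Data.Bool.≟ true))
... | yes (v , e , c) = inj₁ (v , e , λ x y px py ne → cliqueB-elim A (A v) c x y px py ne)
... | no none = inj₂ nf
  where
  nf : NoFull A Δ
  nf v e with allFin-fail (¬true (λ h → none (v , e , h)))
  ... | x , h with allFin-fail h
  ... | z , h' with A v x in vx | A v z in vz | eqᵇ x z in exz | A x z in axz
  ... | true | true | false | false = x , z , vx , vz , eqᵇ-≢ exz , axz

module _ (G : Graph) (Δ : ℕ) (v : Fin (n G)) (md : MaxDeg (adj G) Δ) (fv : FullAt (adj G) Δ v) where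
  private
    A = adj G
    sA = adj-simple G

    X : BSet (n G)
    X = N[ A , v ]

    size : # X ≡ suc Δ
    size = trans (#-N[] sA v) (cong suc (proj₁ fv))

    cq : Clique A X
    cq = Clique-N[] sA (proj₂ fv)

    -- A vertex of the clique `X` has Δ neighbours in `X` already, all that the maximum degree
    -- permits.
    nc : NoCross A X
    nc x y px axy = proj₁ (∧-true (subset-eq (X \\ x) (A x) (λ z h → cq x z px (proj₁ (∧-true h))
      (λ { refl → eqᵇ-≢ (not-true (proj₂ (∧-true {X x} h))) refl }))
      (≤-trans (md x) (≤-reflexive (sym (suc-injective (trans (sym (count-∈ X x px)) size))))) y axy))

    E = enum X (suc Δ) size
    E' = enum (not ∘ X) _ refl

  outside : Graph
  outside = relabel G (elt E')

  outside-≃ : G ≃ (K (suc Δ) ∪ outside)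
  outside-≃ = split-clique G X (suc Δ) _ cq nc E E'

  outside-md : MaxDeg (adj outside) Δ
  outside-md i = ≤-trans (count-inj (elt E') (elt-inj E') (A (elt E' i))) (md (elt E' i))

  outside-cl : ∀ a → cl A (2 + a) full ≡ ff (suc Δ) (2 + a) + cl (adj outside) (2 + a) full
  outside-cl a = trans (cl-≃ G (K (suc Δ) ∪ outside) outside-≃ a)
    (trans (cl-∪ (K (suc Δ)) outside (suc a)) (cong (_+ cl (adj outside) (2 + a) full) (cl-K (suc Δ) (2 + a))))

  -- Edges are ordered 2-cliques up to a factor 2, so this is `outside-cl` for `a = 0`.
  outside-edges : edges G ≡ tri (suc Δ) + edges outside
  outside-edges = *-cancelˡ-≡ (edges G) _ 2 (trans (sym (handshake G)) (trans (sym (cl-2 A)) (trans (outside-cl 0)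
    (trans (cong₂ _+_ (ff-2 (suc Δ)) (trans (cl-2 (adj outside)) (handshake outside)))
      (sym (*-distribˡ-+ 2 (tri (suc Δ)) (edges outside)))))))

-- The extremal family and the theorem.

clique-contains : ∀ (G : Graph) X r → # X ≡ r → Clique (adj G) X → ContainsK G r
clique-contains G X r #X cq = elt E , λ i j ne → cq _ _ (elt-in E i) (elt-in E j) (λ e → ne (elt-inj E e))
  where E = enum X r #X

C2-unique : ∀ {R s r' s'} → s < R → s' < r' → (r' C 2) + s' ≡ tri R + s → r' ≡ R × s' ≡ s
C2-unique {r' = r'} {s'} l l' e = tri-unique l' l (trans (cong (_+ s') (sym (C2-tri r'))) e)

colex-member : ∀ a Δ (G : Graph) r s → s ≤ r → MaxDeg (adj G) Δ → edges G ≡ tri (suc r) + s →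
  val (2 + a) (suc r) s ≤ cl (adj G) (3 + a) full → InFamily (3 + a) Δ (tri (suc r) + s) G
colex-member a Δ G r s s≤r md eG h with 2 + a ≤? s
... | yes a≤s = inj₁ (colex-unique a G r s e2G s≤r a≤s h)
  where
  e2G = trans (handshake G) (cong (2 *_) eG)
... | no a≰s with tri (suc r) + s ≟ 0
-- The second alternative of `InFamily` requires `0 < b`, so for `b = 0` the edgeless graph is
-- matched with the colex graph by the empty labelling.
... | yes b0 = inj₁ (≃-by-labels G (colex (tri (suc r) + s)) {0} (λ ()) (λ ()) (λ { {()} }) (λ { {()} }) noneG noneC
  (λ ()))
  where
  noneG : ∀ x → NonIso G x → ∃ λ (i : Fin 0) → _
  noneG x (y , xy) = ⊥-elim (<⇒≱ (count-point (adj G x) y xy)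
    (≤-trans (sum-point (λ u → # (adj G u)) x) (≤-reflexive (trans (handshake G) (cong (2 *_) (trans eG b0))))))
  noneC : ∀ y → NonIso (colex (tri (suc r) + s)) y → ∃ λ (i : Fin 0) → _
  noneC y (u , yu) = ⊥-elim (<⇒≱ (count-point (adj (colex (tri (suc r) + s)) y) u yu)
    (≤-trans (sum-point (λ u → # (adj (colex (tri (suc r) + s)) u)) y)
      (≤-reflexive (trans (sym (cl-2 (adj (colex (tri (suc r) + s)))))
        (trans (Colex.cl-colex (suc r) s (s≤s s≤r) 0) zero-val)))))
    where
    s0 : s ≡ 0
    s0 = m+n≡0⇒n≡0 (tri (suc r)) b0
    zero-val : val 1 (suc r) s ≡ 0
    zero-val = trans (cong₂ (λ x y → x + 2 * ff y 1) (trans (ff-2 (suc r))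
      (cong (2 *_) (m+n≡0⇒m≡0 (tri (suc r)) b0))) s0) refl
... | no b≢0 = inj₂ (n≢0⇒n>0 b≢0 , fam)
  where
  fam : ∀ r' s' → (r' C 2) + s' ≡ tri (suc r) + s → s' < r' →
        (suc s' < 3 + a) × (edges G ≡ tri (suc r) + s) × MaxDegLe G Δ × (3 + a ≤ r' → ContainsK G r')
  fam r' s' e l with C2-unique {suc r} {s} {r'} {s'} (s≤s s≤r) l e
  ... | refl , refl = s≤s (≰⇒> a≰s) , eG , (λ v → ≤-trans (≤-reflexive (sym (#-def (adj G v)))) (md v)) , K⊂
    where
    K⊂ : 3 + a ≤ suc r → ContainsK G (suc r)
    K⊂ (s≤s a≤r) with kruskal-katona-equality (tri (suc r) + s) a G r s (trans (handshake G) (cong (2 *_) eG)) s≤r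
      a≤r ≤-refl h
    ... | X , #X , cq = clique-contains G X (suc r) #X cq

-- Induction on `q`, removing one K_{Δ+1} at a time. Without such a component, `strict` excludes
-- equality unless `q = 0`, and then the Kruskal-Katona case remains. For `q = 0` such a component
-- would have too many edges.
extremal : ∀ a Δ → 2 + a ≤ Δ → ∀ q (G : Graph) r s → s ≤ r → suc r ≤ Δ → MaxDeg (adj G) Δ →
  edges G ≡ q * tri (suc Δ) + (tri (suc r) + s) →
  cl (adj G) (3 + a) full ≤ q * ff (suc Δ) (3 + a) + val (2 + a) (suc r) s
  × (q * ff (suc Δ) (3 + a) + val (2 + a) (suc r) s ≤ cl (adj G) (3 + a) full →
     Σ Graph λ L → InFamily (3 + a) Δ (tri (suc r) + s) L × (G ≃ copiesK∪ q (suc Δ) L))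
extremal a Δ a≤Δ q G r s s≤r r<Δ md eG with full? (adj G) Δ
extremal a Δ a≤Δ zero G r s s≤r r<Δ md eG | inj₂ nf =
  kruskal-katona (tri (suc r) + s) (suc a) G r s (trans (handshake G) (cong (2 *_) eG)) s≤r ≤-refl ,
  λ h → G , colex-member a Δ G r s s≤r md eG h , ≃-refl G
extremal a Δ a≤Δ (suc q) G r s s≤r r<Δ md eG | inj₂ nf = <⇒≤ lt , λ h → ⊥-elim (<⇒≱ lt h)
  where
  lt = strict (edges G) a Δ a≤Δ G q (suc r) s md nf (s≤s s≤r) r<Δ (edges G) ≤-refl (sym eG) (handshake G)
extremal a Δ a≤Δ zero G r s s≤r r<Δ md eG | inj₁ (v , fv) = ⊥-elim (<⇒≱ (tri-< {suc r} {s} (s≤s s≤r) r<Δ)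
  (≤-trans (m≤m+n (tri (suc Δ)) (edges (outside G Δ v md fv)))
    (≤-reflexive (trans (sym (outside-edges G Δ v md fv)) eG))))
extremal a Δ a≤Δ (suc q) G r s s≤r r<Δ md eG | inj₁ (v , fv) = upper , lower
  where
  F = ff (suc Δ) (3 + a)
  H = outside G Δ v md fv
  G≡ : cl (adj G) (3 + a) full ≡ F + cl (adj H) (3 + a) full
  G≡ = outside-cl G Δ v md fv (suc a)
  IH = extremal a Δ a≤Δ q H r s s≤r r<Δ (outside-md G Δ v md fv)
    (+-cancelˡ-≡ (tri (suc Δ)) _ _ (trans (sym (outside-edges G Δ v md fv)) (trans eG (+-assoc (tri (suc Δ)) _ _))))
  assoc : suc q * F + val (2 + a) (suc r) s ≡ F + (q * F + val (2 + a) (suc r) s)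
  assoc = +-assoc F (q * F) _
  upper : cl (adj G) (3 + a) full ≤ suc q * F + val (2 + a) (suc r) s
  upper = ≤-trans (≤-reflexive G≡) (≤-trans (+-monoʳ-≤ F (proj₁ IH)) (≤-reflexive (sym assoc)))
  lower : suc q * F + val (2 + a) (suc r) s ≤ cl (adj G) (3 + a) full → Σ Graph λ L → InFamily (3 + a) Δ
    (tri (suc r) + s) L × (G ≃ copiesK∪ (suc q) (suc Δ) L)
  lower h = proj₁ ih , proj₁ (proj₂ ih) ,
    ≃-trans (outside-≃ G Δ v md fv) (∪-congʳ (K (suc Δ)) H (copiesK∪ q (suc Δ) (proj₁ ih)) (proj₂ (proj₂ ih)))
    where ih = proj₂ IH (+-cancelˡ-≤ F _ _ (≤-trans (≤-reflexive (sym assoc)) (≤-trans h (≤-reflexive G≡))))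

-- The map from `Fin r` is injective, as non-equal indices go to adjacent vertices; so each sum over
-- the clique is part of a sum over `G`.
contains-ff : ∀ (G : Graph) r t → ContainsK G r → ff r t ≤ cl (adj G) t full
contains-ff G r t (f , h) = ≤-trans (≤-reflexive (sym (cl-K r t)))
  (≤-trans (≤-reflexive (cl-congS {B = λ i j → adj G (f i) (f j)} t (λ _ → refl) (λ i j _ _ → agree i j)))
  (pull t full))
  where
  A = adj G
  inj : ∀ {i j} → f i ≡ f j → i ≡ j
  inj {i} {j} e with i ≟F j
  ... | yes p = p
  ... | no ne = ⊥-elim (false≢true (adj-irrefl G (f j)) (trans (cong (λ z → A z (f j)) (sym e)) (h i j ne)))
  agree : ∀ i j → not (eqᵇ i j) ≡ A (f i) (f j)
  agree i j with i ≟F j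
  ... | yes refl = sym (adj-irrefl G (f i))
  ... | no ne = sym (h i j ne)
  pull : ∀ t S → cl (λ i j → A (f i) (f j)) t (λ i → S (f i)) ≤ cl A t S
  pull zero    S = ≤-refl
  pull (suc t) S = ≤-trans (sum-mono (λ i → *-monoʳ-≤ (b2n (S (f i))) (pull t (S ∩ A (f i)))))
    (sum-inj f inj (λ x → b2n (S x) * cl A t (S ∩ A x)))

-- For `s < t - 1` the last row carries no clique of order t, so a K_{r+1} alone attains the bound;
-- if even `suc r < t`, the bound is 0.
family-value : ∀ a Δ r s L → s ≤ r → InFamily (3 + a) Δ (tri (suc r) + s) L → cl (adj L) (3 + a) full ≡ val (2 + a)
  (suc r) s
family-value a Δ r s L s≤r (inj₁ iso) = trans (cl-≃ L (colex (tri (suc r) + s)) iso (suc a))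
  (Colex.cl-colex (suc r) s (s≤s s≤r) (suc a))
family-value a Δ r s L s≤r (inj₂ (_ , fam)) with fam (suc r) s (cong (_+ s) (C2-tri (suc r))) (s≤s s≤r)
... | s≤s s< , eL , _ , cK = ≤-antisym (kruskal-katona (tri (suc r) + s) (suc a) L r s
  (trans (handshake L) (cong (2 *_) eL)) s≤r ≤-refl) low
  where
  val0 : val (2 + a) (suc r) s ≡ ff (suc r) (3 + a)
  val0 = trans (cong (λ z → ff (suc r) (3 + a) + (3 + a) * z) (ff-zero s<))
    (trans (cong (ff (suc r) (3 + a) +_) (*-zeroʳ (3 + a))) (+-identityʳ _))
  low : val (2 + a) (suc r) s ≤ cl (adj L) (3 + a) full
  low with 3 + a ≤? suc r
  ... | yes le = ≤-trans (≤-reflexive val0) (contains-ff L (suc r) (3 + a) (cK le))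
  ... | no nle = ≤-trans (≤-reflexive (trans val0 (ff-zero (≰⇒> nle)))) z≤n

theorem1p8 : (t Δ : ℕ) → 3 ≤ t → t ≤ Δ + 1 →
    (G : Graph) → MaxDegLe G Δ →
    (q b : ℕ) → edges G ≡ q * (suc Δ C 2) + b → b < suc Δ C 2 →
    (kt t G ≤ kt t (copiesK∪ q (suc Δ) (colex b)))
    × ((kt t G ≡ kt t (copiesK∪ q (suc Δ) (colex b)))
    ⇔ Σ Graph (λ L → InFamily t Δ b L × (G ≃ copiesK∪ q (suc Δ) L)))
theorem1p8 (suc (suc (suc a))) Δ (s≤s (s≤s (s≤s z≤n))) t≤ G mdG q b eG b< with rep b
... | r , s , s≤r , refl = *-cancelˡ-≤ (fact t) {{>-nonZero (fact-pos t)}}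
  (subst₂ _≤_ (sym (kt-cl t G)) (sym (trans (kt-cl t R) valR)) (proj₁ ex)) ,
    mk⇔ (λ e → proj₂ ex (≤-reflexive (trans (sym valR) (trans (sym (kt-cl t R))
      (trans (cong (fact t *_) (sym e)) (kt-cl t G))))))
        (λ { (L , mem , iso) → *-cancelˡ-≡ (kt t G) (kt t R) (fact t) {{>-nonZero (fact-pos t)}}
          (trans (kt-cl t G) (trans (fromL L mem iso) (sym (trans (kt-cl t R) valR)))) })
  where
  t = 3 + a
  R = copiesK∪ q (suc Δ) (colex (tri (suc r) + s))
  valR : cl (adj R) t full ≡ q * ff (suc Δ) t + val (2 + a) (suc r) s
  valR = trans (cl-copies q (suc Δ) (colex (tri (suc r) + s)) (2 + a))
    (cong (q * ff (suc Δ) t +_) (Colex.cl-colex (suc r) s (s≤s s≤r) (suc a)))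
  a≤Δ : 2 + a ≤ Δ
  a≤Δ = ≤-pred (≤-trans t≤ (≤-reflexive (+-comm Δ 1)))
  ex = extremal a Δ a≤Δ q G r s s≤r (tri-<⁻ {suc r} {s} (subst (tri (suc r) + s <_) (C2-tri (suc Δ)) b<))
    (λ v → ≤-trans (≤-reflexive (#-def (adj G v))) (mdG v))
    (trans eG (cong (λ z → q * z + (tri (suc r) + s)) (C2-tri (suc Δ))))
  fromL : ∀ L → InFamily t Δ (tri (suc r) + s) L → G ≃ copiesK∪ q (suc Δ) L → cl (adj G) t full ≡ q * ff (suc Δ) t +
    val (2 + a) (suc r) s
  fromL L mem iso = trans (cl-≃ G (copiesK∪ q (suc Δ) L) iso (suc a))
    (trans (cl-copies q (suc Δ) L (2 + a)) (cong (q * ff (suc Δ) t +_) (family-value a Δ r s L s≤r mem)))
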